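{- There are a predicate $T(e,x,z)$ on $\mathbb{N}\times\omega^\omega\times\mathbb{N}$ that is primitive recursive over $\omega^\omega$ and a (partial) TTE-computable function $U(z;x)$ from $\mathbb{N}\times\omega^\omega$ to $\omega^\omega$ such that for every MS-computable partial function $F:\omega^\omega\to\omega^\omega$ there is some $e\in\mathbb{N}$ such that for all $x\in\omega^\omega$ $$F(x)\simeq U\bigl(\mu z\,T(e,x,z);\,x\bigr),$$ where $\mu z\,T(e,x,z)$ is the least $z\in\mathbb{N}$ such that $T(e,x,z)$ holds (undefined if there is none), and $\simeq$ means that both sides are undefined or both are defined and equal.
   Context: Write $\mathbb{N}=\omega=\{0,1,2,\dots\}$, $\mathcal{N}=\omega^\omega$ (Baire space), and $0_{\mathcal{N}}$ for the constant zero sequence. All functions may be partial. TTE-computability. Fix standard effective enumerations of oracle Turing machines with $q$ oracles from $\mathcal{N}$ ($q\ge 0$). $\Phi^{\vec x}(e,i)$ is the result of the $e$-th machine on input $i$ with oracles $\vec x=(x_1,\dots,x_q)$, and $\Phi^{\vec x}(e)$ is the sequence $y\in\mathcal{N}$ with $y(i)=\Phi^{\vec x}(e,i)$; it is defined iff $\Phi^{\vec x}(e,i)$ is defined for all $i$. Put $\Psi_q(e;\vec x)=\Phi^{\vec x}(e)$ (the universal TTE-computable function $\mathbb{N}\times\mathcal{N}^q\to\mathcal{N}$). A partial function $\mathbb{N}^p\times\mathcal{N}^q\to\mathcal{N}$ is TTE-computable if it has the form $(\vec n;\vec x)\mapsto\Phi^{\vec x}(h(\vec n))$ for a (classically) total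 recursive $h$. Primitive recursive functions over $\mathcal{N}$. Fix a recursive list $(e_i)_{i\in\mathbb{N}}$ of indices such that the $e_i$-th oracle machine computes the $i$-th primitive recursive functional (the function of the numerical input that is primitive recursive relative to the oracles, via the $i$-th primitive recursive definition), and put $\Theta_q(i;\vec x)=\Psi_q(e_i;\vec x)$. The class of primitive recursive functions over $\mathcal{N}$ is the smallest class of functions from $\mathbb{N}^p\times\mathcal{N}^q$ ($p+q\ge1$) to $\mathbb{N}$ or $\mathcal{N}$ that contains: the zero function $\mathbb{N}\to\mathbb{N}$, the successor function $\mathbb{N}\to\mathbb{N}$, all projections $(n_1,\dots,n_p;x_1,\dots,x_q)\mapsto n_i$ or $x_j$, the functions $\Theta_q$, and $\chi:\mathcal{N}\to\mathbb{N}$ with $\chi(0_{\mathcal{N}})=1$ and $\chi(x)=0$ for $x\ne0_{\mathcal{N}}$; and that is closed under composition $f(g_1(\vec m;\vec y),\dots,g_p(\vec m;\vec y);h_1(\vec m;\vec y),\dots,h_q(\vec m;\vec y))$ (with $g_i$ having codomain $\mathbb{N}$ and $h_j$ codomain $\mathcal{N}$), and primitive recursion on a numerical variable: $F(0,\vec n;\vec x)=G(\vec n;\vec x)$, $F(k+1,\vec n;\vec x)=H(k,\vec n;\vec x,F(k,\vec n;\vec x))$ for codomain $\mathcal{N}$, and analogously $F(k+1,\vec n;\vec x)=H(k,\vec n,F(k,\vec n;\vec x);\vec x)$ for codomain $\mathbb{N}$. A predicate is primitive recursive over $\mathcal{N}$ if its characteristic function is. MS-machines over $\mathcal{N}$.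 A master-slave machine consists of a master, which is an ordinary deterministic Turing machine with a finite program handling natural numbers and equipped with a billboard (holding a natural number $p$) and a Boolean bit $k$ it can read, together with finitely many Baire tapes $t_1,\dots,t_r$, each holding an element of $\mathcal{N}$; these comprise the input tapes, working tapes, a zero-test tape and an output tape. Besides ordinary Turing machine commands, the master's program may contain: (i) slave-calling commands with a designated target tape $t_l$: if $p$ is on the billboard and $\vec y=(y_1,\dots,y_r)$ are the current contents of the Baire tapes, the content of $t_l$ is replaced by $\Phi^{\vec y}(p)$ and the master enters a specified next state, provided $\Phi^{\vec y}(p)$ is defined (otherwise the whole computation is undefined); (ii) zero-test commands: the bit $k$ is set to $1$ if the content of the zero-test tape is $0_{\mathcal{N}}$, and to $0$ otherwise, and the master enters a specified next state. On input $(\vec n;\vec x)\in\mathbb{N}^p\times\mathcal{N}^q$, $\vec n$ is put on the master's tape, $x_1,\dots,x_q$ on the input tapes, and all other Baire tapes hold $0_{\mathcal{N}}$. If the master reaches its halting state after finitely many steps, the output is the number on the master's output tape (codomain $\mathbb{N}$) or the content of the output Baire tape (codomain $\mathcal{N}$); if it never halts or some slave call is undefined, the result is undefined. A partial function $\mathbb{N}^p\times\mathcal{N}^q\to\mathbb{N}$ or $\mathcal{N}$ is MS-computable over $\mathcal{N}$ if it is computed in this sense by some MS-machine. -}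

module Defs where

open import Axiom.ExcludedMiddle using (ExcludedMiddle)
open import Data.Bool.Base using (Bool; true; false; if_then_else_)
open import Data.Fin.Base using (Fin; zero; suc; fromℕ<; _↑ʳ_)
open import Data.List.Base as List using (List; []; _∷_; _++_)
open import Data.Nat.Base using (ℕ; zero; suc; _+_; _<_)
open import Data.Nat.Properties using (_≟_; _<?_)
open import Data.Product.Base using (_×_; _,_; ∃; proj₁; proj₂)
open import Data.Sum.Base using (_⊎_)
open import Data.Vec.Base as Vec
  using (Vec; []; _∷_; _∷ʳ_; lookup; replicate; _[_]≔_; fromList; toList)
open import Function.Base using (const)
open import Function.Bundles using (_⇔_)
open import Level using (0ℓ)
open import Relation.Binary.Construct.Closure.ReflexiveTransitive using (Star)
open import Relation.Binary.PropositionalEquality using (_≡_; _≗_)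
open import Relation.Nullary.Decidable.Core using (yes; no; does)
open import Relation.Nullary.Negation.Core using (¬_)

------------------------------------------------------------------------
-- Baire space, partial functions, predicates

-- Elements of Baire space are compared pointwise.
𝒩 : Set
𝒩 = ℕ → ℕ

0𝒩 : 𝒩
0𝒩 = const 0

data Sort : Set where
  num baire : Sort

Val : Sort → Set
Val num   = ℕ
Val baire = 𝒩

Same : ∀ τ → Val τ → Val τ → Set
Same num   m n = m ≡ n
Same baire x y = x ≗ y

-- A partial function ℕᵖ × 𝒩^q → Val τ is given by its graph.  Nothing here
-- forces a graph to be single-valued or closed under Same; the notions of
-- computability below do, since they determine the graph completely.
Partial : ℕ → ℕ → Sort → Set₁
Partial p q τ = Vec ℕ p → Vec 𝒩 q → Val τ → Set

Predicate : ℕ → ℕ → Set₁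
Predicate p q = Vec ℕ p → Vec 𝒩 q → Set

-- Kleene equality of two possibly undefined elements of 𝒩, each given by
-- the collection of its values.
infix 4 _≃_
_≃_ : (𝒩 → Set) → (𝒩 → Set) → Set
P ≃ Q = (¬ ∃ P × ¬ ∃ Q) ⊎ (∃ λ y → ∃ λ y′ → P y × Q y′ × y ≗ y′)

-- "μ P is defined and equal to z".
μ : (ℕ → Set) → ℕ → Set
μ P z = P z × (∀ w → w < z → ¬ P w)

------------------------------------------------------------------------
-- Coding of finite sequences

-- The inverse of the Cantor pairing function.
unpair : ℕ → ℕ × ℕ
unpair zero    = 0 , 0
unpair (suc n) with unpair n
... | zero  , b = suc b , 0
... | suc a , b = a , suc b

-- A bijection ℕ → List ℕ: 0 codes [], and 1 + ⟨a , b⟩ codes a ∷ sequence b.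
-- The first argument of sequence′ bounds the recursion; b < 1 + ⟨a , b⟩, so n
-- is a sufficient bound.
sequence′ : ℕ → ℕ → List ℕ
sequence′ zero    _       = []
sequence′ (suc k) zero    = []
sequence′ (suc k) (suc m) = proj₁ (unpair m) ∷ sequence′ k (proj₂ (unpair m))

sequence : ℕ → List ℕ
sequence n = sequence′ n n

------------------------------------------------------------------------
-- Turing machines

-- A zipper: `left` lists the cells to the left of the head, nearest first;
-- cells beyond either list are blank.  Symbols are natural numbers (a finite
-- program writes only finitely many); 0 is the blank.
record Tape : Set where
  constructor tape
  field
    left  : List ℕ
    head  : ℕ
    right : List ℕ

data Direction : Set where
  leftward rightward : Direction

moveHead : Direction → Tape → Tape
moveHead leftward  (tape []       c rs)       = tape [] 0 (c ∷ rs)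
moveHead leftward  (tape (l ∷ ls) c rs)       = tape ls l (c ∷ rs)
moveHead rightward (tape ls       c [])       = tape (c ∷ ls) 0 []
moveHead rightward (tape ls       c (r ∷ rs)) = tape (c ∷ ls) r rs

-- Input convention: n₁,…,nₚ is written as the blocks 1^n₁ 0 … 1^nₚ 0 to the
-- right of a blank cell, which is scanned.
numerals : List ℕ → Tape
numerals ns =
  tape [] 0 (List.concatMap (λ n → List.replicate n 1 ++ (0 ∷ [])) ns)

-- Output convention: the number on a tape is the number of 1s on it.
ones : List ℕ → ℕ
ones []       = 0
ones (1 ∷ cs) = suc (ones cs)
ones (_ ∷ cs) = ones cs

number : Tape → ℕ
number (tape ls c rs) = ones ls + ones (c ∷ rs)

-- Machines have several tapes, numbered by ℕ; a finite program can mention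
-- only finitely many of them.  States are numbered too: a program is the
-- list of the commands belonging to states 0, 1, 2, …, and 0 is initial.
data Command : Set where
  write  : (t symbol next : ℕ) → Command
  move   : Direction → (t next : ℕ) → Command
  branch : (t symbol then else : ℕ) → Command
  halt   : Command

record Config : Set where
  constructor config
  field
    state : ℕ
    tapes : ℕ → Tape

open Config public

replaceTape : ℕ → Tape → (ℕ → Tape) → (ℕ → Tape)
replaceTape t T Ts u = if does (u ≟ t) then T else Ts u

perform : Command → Config → Config
perform (write t a s) (config _ Ts) =
  config s (replaceTape t (record (Ts t) { head = a }) Ts)
perform (move d t s) (config _ Ts) =
  config s (replaceTape t (moveHead d (Ts t)) Ts)
perform (branch t a s s′) (config _ Ts) =
  config (if does (Tape.head (Ts t) ≟ a) then s else s′) Ts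
perform halt c = c

-- Tape 0 is both the input and the output tape.
initial : List ℕ → Config
initial ns = config 0 (replaceTape 0 (numerals ns) (const (numerals [])))

output : Config → ℕ
output c = number (tapes c 0)

-- The command of a given state; the default serves states beyond the program.
fetch : {C : Set} → C → List C → ℕ → C
fetch d []       _       = d
fetch d (c ∷ cs) zero    = c
fetch d (c ∷ cs) (suc s) = fetch d cs s

------------------------------------------------------------------------
-- Oracle machines

-- query j t s: replace the number m on tape t by the m-th term of oracle j.
data OracleCommand (q : ℕ) : Set where
  basic : Command → OracleCommand q
  query : (j : Fin q) (t next : ℕ) → OracleCommand q

OracleProgram : ℕ → Set
OracleProgram q = List (OracleCommand q)

module _ {q} (P : OracleProgram q) (xs : Vec 𝒩 q) where

  command : Config → OracleCommand q
  command c = fetch (basic halt) P (state c)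

  performOracle : OracleCommand q → Config → Config
  performOracle (basic b)     c             = perform b c
  performOracle (query j t s) (config _ Ts) =
    config s (replaceTape t (numerals (lookup xs j (number (Ts t)) ∷ [])) Ts)

  run : ℕ → Config → Config
  run zero    c = c
  run (suc k) c = run k (performOracle (command c) c)

oracleCommand : ∀ q → List ℕ → OracleCommand q
oracleCommand q (0 ∷ t ∷ a ∷ s ∷ [])      = basic (write t a s)
oracleCommand q (1 ∷ t ∷ s ∷ [])          = basic (move leftward t s)
oracleCommand q (2 ∷ t ∷ s ∷ [])          = basic (move rightward t s)
oracleCommand q (3 ∷ t ∷ a ∷ s ∷ s′ ∷ []) = basic (branch t a s s′)
oracleCommand q (4 ∷ j ∷ t ∷ s ∷ []) with j <? q
... | yes j<q = query (fromℕ< j<q) t s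
... | no  _   = basic halt
oracleCommand q _                         = basic halt

-- The effective enumeration of the oracle machines with q oracles; it is
-- onto OracleProgram q.
machine : ∀ q → ℕ → OracleProgram q
machine q e = List.map (λ c → oracleCommand q (sequence c)) (sequence e)

-- Φ xs e ns v: the e-th machine with oracles xs, started on the numbers ns,
-- halts with output v.
Φ : ∀ {p q} → Vec 𝒩 q → ℕ → Vec ℕ p → ℕ → Set
Φ {q = q} xs e ns v = ∃ λ k →
  let c = run (machine q e) xs k (initial (toList ns))
  in command (machine q e) xs c ≡ basic halt × output c ≡ v

Ψ : ∀ {q} → ℕ → Vec 𝒩 q → 𝒩 → Set
Ψ e xs y = ∀ i → Φ xs e (i ∷ []) (y i)

Recursive : ∀ {p} → (Vec ℕ p → ℕ) → Set
Recursive h = ∃ λ e → ∀ ns → Φ [] e ns (h ns)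

TTEComputable : ∀ {p q} → Partial p q baire → Set
TTEComputable F = ∃ λ h →
  Recursive h × (∀ ns xs y → F ns xs y ⇔ Ψ (h ns) xs y)

------------------------------------------------------------------------
-- Primitive recursive functionals of numbers, relative to q oracles

data PR (q : ℕ) : ℕ → Set where
  zero   : ∀ {n} → PR q n
  suc    : PR q 1
  proj   : ∀ {n} → Fin n → PR q n
  oracle : Fin q → PR q 1
  comp   : ∀ {m n} → PR q m → Vec (PR q n) m → PR q n
  rec    : ∀ {n} → PR q n → PR q (2 + n) → PR q (1 + n)

module _ {q} (xs : Vec 𝒩 q) where

  mutual
    evalPR : ∀ {n} → PR q n → Vec ℕ n → ℕ
    evalPR zero        _             = 0
    evalPR suc         (n ∷ [])      = suc n
    evalPR (proj i)    ns            = lookup ns i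
    evalPR (oracle j)  (n ∷ [])      = lookup xs j n
    evalPR (comp f gs) ns            = evalPR f (evalPRs gs ns)
    evalPR (rec g h)   (zero ∷ ns)   = evalPR g ns
    evalPR (rec g h)   (suc k ∷ ns)  =
      evalPR h (k ∷ evalPR (rec g h) (k ∷ ns) ∷ ns)

    evalPRs : ∀ {m n} → Vec (PR q n) m → Vec ℕ n → Vec ℕ m
    evalPRs []       _  = []
    evalPRs (g ∷ gs) ns = evalPR g ns ∷ evalPRs gs ns

-- An effective enumeration of PR q n, onto.  The first argument of
-- definition′ bounds the recursion; the entries of sequence i are smaller
-- than i.  Numbers that code no definition are read as `zero`.
definition′ : ℕ → List ℕ → ∀ q n → PR q n
definition′ (suc k) (1 ∷ []) q 1 = suc
definition′ (suc k) (2 ∷ i ∷ []) q n with i <? n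
... | yes i<n = proj (fromℕ< i<n)
... | no  _   = zero
definition′ (suc k) (3 ∷ j ∷ []) q 1 with j <? q
... | yes j<q = oracle (fromℕ< j<q)
... | no  _   = zero
definition′ (suc k) (4 ∷ f ∷ gs) q n =
  comp (definition′ k (sequence f) q (List.length gs))
       (Vec.map (λ g → definition′ k (sequence g) q n) (fromList gs))
definition′ (suc k) (5 ∷ g ∷ h ∷ []) q (suc n) =
  rec (definition′ k (sequence g) q n) (definition′ k (sequence h) q (2 + n))
definition′ _ _ _ _ = zero

definition : ∀ q n → ℕ → PR q n
definition q n i = definition′ i (sequence i) q n

-- Θ i xs is the sequence computed from the oracles xs by the i-th unary
-- primitive recursive definition, that is, Ψ (e i) xs for any list of
-- indices e such that machine e i computes that functional.
Θ : ∀ {q} → ℕ → Vec 𝒩 q → 𝒩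
Θ {q} i xs n = evalPR xs (definition q 1 i) (n ∷ [])

------------------------------------------------------------------------
-- Primitive recursive functions over 𝒩

-- Notations for the functions of the class.  Arity (0 , 0) is not excluded
-- explicitly, but PR𝒩 0 0 τ is empty.
data PR𝒩 : ℕ → ℕ → Sort → Set where
  zero  : PR𝒩 1 0 num
  suc   : PR𝒩 1 0 num
  projℕ : ∀ {p q} → Fin p → PR𝒩 p q num
  proj𝒩 : ∀ {p q} → Fin q → PR𝒩 p q baire
  theta : ∀ {q} → PR𝒩 1 q baire
  chi   : PR𝒩 0 1 num
  comp  : ∀ {p q p′ q′ τ} → PR𝒩 p q τ →
          Vec (PR𝒩 p′ q′ num) p → Vec (PR𝒩 p′ q′ baire) q → PR𝒩 p′ q′ τ
  recℕ  : ∀ {p q} → PR𝒩 p q num → PR𝒩 (2 + p) q num → PR𝒩 (1 + p) q num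
  rec𝒩  : ∀ {p q} → PR𝒩 p q baire → PR𝒩 (1 + p) (1 + q) baire →
          PR𝒩 (1 + p) q baire

-- That χ is a total function is a classical fact.
module _ (em : ExcludedMiddle 0ℓ) where

  χ : 𝒩 → ℕ
  χ x = if does (em {x ≗ 0𝒩}) then 1 else 0

  mutual
    eval : ∀ {p q τ} → PR𝒩 p q τ → Vec ℕ p → Vec 𝒩 q → Val τ
    eval zero           _            _        = 0
    eval suc            (n ∷ [])     _        = suc n
    eval (projℕ i)      ns           _        = lookup ns i
    eval (proj𝒩 j)      _            xs       = lookup xs j
    eval theta          (i ∷ [])     xs       = Θ i xs
    eval chi            _            (x ∷ []) = χ x
    eval (comp f gs hs) ns           xs       =
      eval f (evals gs ns xs) (evals𝒩 hs ns xs)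
    eval (recℕ g h)     (zero ∷ ns)  xs       = eval g ns xs
    eval (recℕ g h)     (suc k ∷ ns) xs       =
      eval h (k ∷ (ns ∷ʳ eval (recℕ g h) (k ∷ ns) xs)) xs
    eval (rec𝒩 g h)     (zero ∷ ns)  xs       = eval g ns xs
    eval (rec𝒩 g h)     (suc k ∷ ns) xs       =
      eval h (k ∷ ns) (xs ∷ʳ eval (rec𝒩 g h) (k ∷ ns) xs)

    evals : ∀ {m p q} → Vec (PR𝒩 p q num) m → Vec ℕ p → Vec 𝒩 q → Vec ℕ m
    evals []       _  _  = []
    evals (g ∷ gs) ns xs = eval g ns xs ∷ evals gs ns xs

    evals𝒩 : ∀ {m p q} → Vec (PR𝒩 p q baire) m → Vec ℕ p → Vec 𝒩 q → Vec 𝒩 m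
    evals𝒩 []       _  _  = []
    evals𝒩 (h ∷ hs) ns xs = eval h ns xs ∷ evals𝒩 hs ns xs

  PrimitiveRecursive : ∀ {p q τ} → (Vec ℕ p → Vec 𝒩 q → Val τ) → Set
  PrimitiveRecursive {p} {q} {τ} f = ∃ λ (c : PR𝒩 p q τ) →
    ∀ ns xs → Same τ (eval c ns xs) (f ns xs)

  PrimitiveRecursivePredicate : ∀ {p q} → Predicate p q → Set
  PrimitiveRecursivePredicate T = ∃ λ f → PrimitiveRecursive {τ = num} f ×
    (∀ ns xs → (T ns xs → f ns xs ≡ 1) × (¬ T ns xs → f ns xs ≡ 0))

------------------------------------------------------------------------
-- Master-slave machines

-- call l s: the slave call with target tape l.
data MasterCommand (r : ℕ) : Set where
  basic    : Command → MasterCommand r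
  call     : (target : Fin r) (next : ℕ) → MasterCommand r
  zeroTest : (next : ℕ) → MasterCommand r
  ifBit    : (then else : ℕ) → MasterCommand r

-- The Baire tapes are, in this order, the q input tapes, the zero-test tape,
-- the output tape, and the working tapes.
record MSMachine (q : ℕ) : Set where
  field
    working : ℕ
    program : List (MasterCommand (q + (2 + working)))

  #tapes : ℕ
  #tapes = q + (2 + working)

  zeroTestTape outputTape : Fin #tapes
  zeroTestTape = q ↑ʳ zero
  outputTape   = q ↑ʳ suc zero

module _ {q} (M : MSMachine q) where

  open MSMachine M

  record MSConfig : Set where
    constructor msConfig
    field
      master     : Config
      bit        : Bool
      baireTapes : Vec 𝒩 #tapes

  open MSConfig

  masterCommand : MSConfig → MasterCommand #tapes
  masterCommand C = fetch (basic halt) program (state (master C))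

  -- The billboard is tape 1 of the master.
  billboard : MSConfig → ℕ
  billboard C = number (tapes (master C) 1)

  goto : ℕ → MSConfig → MSConfig
  goto s C = record C { master = config s (tapes (master C)) }

  -- There is no step from a slave call whose result is undefined.
  data Step (C : MSConfig) : MSConfig → Set where
    basicStep : ∀ {b} → masterCommand C ≡ basic b →
      Step C (record C { master = perform b (master C) })
    callStep : ∀ {l s y} → masterCommand C ≡ call l s →
      Ψ (billboard C) (baireTapes C) y →
      Step C (goto s (record C { baireTapes = baireTapes C [ l ]≔ y }))
    zeroStep : ∀ {s} → masterCommand C ≡ zeroTest s →
      lookup (baireTapes C) zeroTestTape ≗ 0𝒩 →
      Step C (goto s (record C { bit = true }))
    nonzeroStep : ∀ {s} → masterCommand C ≡ zeroTest s →
      ¬ (lookup (baireTapes C) zeroTestTape ≗ 0𝒩) →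
      Step C (goto s (record C { bit = false }))
    bitStep : ∀ {s s′} → masterCommand C ≡ ifBit s s′ →
      Step C (goto (if bit C then s else s′) C)

  start : ∀ {p} → Vec ℕ p → Vec 𝒩 q → MSConfig
  start ns xs =
    msConfig (initial (toList ns)) false (xs Vec.++ replicate (2 + working) 0𝒩)

  result : ∀ τ → MSConfig → Val τ
  result num   C = output (master C)
  result baire C = lookup (baireTapes C) outputTape

  MSResult : ∀ {p} τ → Partial p q τ
  MSResult τ ns xs v = ∃ λ C →
    Star Step (start ns xs) C × masterCommand C ≡ basic halt ×
    Same τ (result τ C) v

MSComputable : ∀ {p q τ} → Partial p q τ → Set
MSComputable {q = q} {τ} F = ∃ λ (M : MSMachine q) →
  ∀ ns xs v → F ns xs v ⇔ MSResult M τ ns xs v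

{-# OPTIONS --safe #-}

module Submission where

open import Axiom.ExcludedMiddle using (ExcludedMiddle)
open import Data.Bool.Base using (Bool; false; if_then_else_; true)
open import Data.Fin.Base using (Fin; fromℕ<; suc; toℕ; zero)
open import Data.Fin.Properties using (fromℕ<-toℕ; toℕ-fromℕ<; toℕ-injective; toℕ<n)
open import Data.List.Base as List using (List; []; _++_; _∷_; length)
open import Data.List.Properties using (++-assoc; ++-identityʳ; foldr-++; length-++; map-++; map-cong; map-id; map-∘)
open import Data.List.Relation.Unary.All using (All; []; _∷_)
open import Data.Nat.Base
open import Data.Nat.Properties
open import Data.Product.Base using (_,_; _×_; proj₁; proj₂; Σ; ∃; ∃₂)
open import Data.Sum.Base using (_⊎_; inj₁; inj₂)
open import Data.Vec.Base as Vec using (Vec; []; _[_]≔_; _∷_; fromList; lookup; replicate; toList)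
open import Data.Vec.Properties using (lookup-map; lookup-replicate; lookup∘tabulate; lookup∘update; lookup∘update′; tabulate-cong; tabulate-∘; tabulate∘lookup)
open import Function.Base using (_∘_)
open import Function.Bundles using (Equivalence; _⇔_; mk⇔)
open import Level using (0ℓ)
open import Relation.Binary.Construct.Closure.ReflexiveTransitive using (Star; _◅_; _◅◅_; ε)
open import Relation.Binary.PropositionalEquality
open import Relation.Nullary.Decidable using (Dec; dec-false; dec-true; does; no; yes)
open import Relation.Nullary.Negation.Core using (contradiction; ¬_)
open import Defs

-- U(z; x) runs the z-th oracle machine on x, so the witness z must be a
-- program.  For a fixed MS-machine, replace the contents of its Baire tapes
-- by the finite history of slave calls that produced them.  A tape is then a
-- partial computable function of x, and its being zero is tested, via χ, by
-- the Π₁ condition that no computation of a term ever halts with a nonzero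
-- value; this is correct as long as all calls so far are defined.  Thus the
-- master can be simulated by primitive recursion over 𝒩 without deciding
-- whether slave calls are defined.  T(e, x, z) says that the simulation has
-- halted after z steps, in a state s, and that z is the index of a program
-- that has s built in and computes the output tape, waiting at each argument
-- for all slave calls in the history of s.  Hence U(z; x) is undefined if one
-- of these calls is undefined.

-- No universal MS-machine is needed: `T` and `U` are fixed, and all that concerns the given machine
-- sits in `e`, the index of a single primitive recursive functional that poses the questions to χ,
-- makes the steps and passes the final judgement. The witness has to carry the final state because
-- `U`, being merely computable, cannot repeat the zero tests; their answers survive only in the
-- list of calls that the master went on to make. After an undefined call the simulated master runs
-- on with meaningless answers. This is harmless: at some argument the program named by the witness
-- then waits forever. A halted state no longer changes, so for each input at most one number is
-- accepted, and its minimality is automatic.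

open ≡-Reasoning

-- Coding of pairs, streams and lists

natrec : ℕ → (ℕ → ℕ → ℕ) → ℕ → ℕ
natrec z f zero    = z
natrec z f (suc n) = f n (natrec z f n)

natrec-cong : ∀ {z f g} n → (∀ j → j < n → ∀ r → f j r ≡ g j r) →
              natrec z f n ≡ natrec z g n
natrec-cong         zero    eq = refl
natrec-cong {g = g} (suc n) eq =
  trans (eq n ≤-refl _) (cong (g n) (natrec-cong n λ j j<n → eq j (m<n⇒m<1+n j<n)))

-- fold z f n = f 0 (f 1 (… (f (n - 1) z))).
fold : ℕ → (ℕ → ℕ → ℕ) → ℕ → ℕ
fold z f n = natrec z (λ j → f (n ∸ suc j)) n

fold-suc : ∀ z f n → fold z f (suc n) ≡ f 0 (fold z (f ∘ suc) n)
fold-suc z f n = cong₂ f (n∸n≡0 n)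
  (natrec-cong n λ j j<n r → cong (λ i → f i r) (+-∸-assoc 1 j<n))

fold-cong : ∀ {z f g} n → (∀ j r → f j r ≡ g j r) → fold z f n ≡ fold z g n
fold-cong n eq = natrec-cong n λ j _ → eq (n ∸ suc j)

ifz : ℕ → ℕ → ℕ → ℕ
ifz zero    a b = a
ifz (suc _) a b = b

dist : ℕ → ℕ → ℕ
dist a b = (a ∸ b) + (b ∸ a)

dist-refl : ∀ a → dist a a ≡ 0
dist-refl a = cong₂ _+_ (n∸n≡0 a) (n∸n≡0 a)

dist≡0⇒≡ : ∀ a b → dist a b ≡ 0 → a ≡ b
dist≡0⇒≡ a b eq = ≤-antisym (m∸n≡0⇒m≤n (m+n≡0⇒m≡0 (a ∸ b) eq)) (m∸n≡0⇒m≤n (m+n≡0⇒n≡0 (a ∸ b) eq))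

ifz-dist-≡ : ∀ {a b} c d → a ≡ b → ifz (dist a b) c d ≡ c
ifz-dist-≡ {a} c d refl rewrite dist-refl a = refl

ifz-dist-≢ : ∀ {a b} c d → a ≢ b → ifz (dist a b) c d ≡ d
ifz-dist-≢ {a} {b} c d a≢b with dist a b in eq
... | zero  = contradiction (dist≡0⇒≡ a b eq) a≢b
... | suc _ = refl

triangle : ℕ → ℕ
triangle zero    = 0
triangle (suc n) = triangle n + suc n

n≤triangle : ∀ n → n ≤ triangle n
n≤triangle zero    = z≤n
n≤triangle (suc n) = m≤n+m (suc n) (triangle n)

opaque

  pair : ℕ → ℕ → ℕ
  pair a b = triangle (a + b) + b

  fst snd : ℕ → ℕ
  fst n = proj₁ (unpair n)
  snd n = proj₂ (unpair n)

opaque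
  unfolding pair

  pair-def : ∀ a b → pair a b ≡ triangle (a + b) + b
  pair-def a b = refl

  pair-0-0 : pair 0 0 ≡ 0
  pair-0-0 = refl

  fst-0 : fst 0 ≡ 0
  fst-0 = refl

  snd-0 : snd 0 ≡ 0
  snd-0 = refl

  pair-suc : ∀ a b → pair a (suc b) ≡ suc (pair (suc a) b)
  pair-suc a b = trans (cong (λ n → triangle n + suc b) (+-suc a b))
                       (+-suc (triangle (suc (a + b))) b)

  pair-suc-0 : ∀ a → pair (suc a) 0 ≡ suc (pair 0 a)
  pair-suc-0 a = begin
    triangle (a + 0) + suc (a + 0) + 0 ≡⟨ +-identityʳ _ ⟩
    triangle (a + 0) + suc (a + 0)     ≡⟨ cong (λ n → triangle n + suc n) (+-identityʳ a) ⟩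
    triangle a + suc a                 ≡⟨ +-suc (triangle a) a ⟩
    suc (triangle a + a)               ∎

  unpair-zero-suc : ∀ n {b} → unpair n ≡ (0 , b) → unpair (suc n) ≡ (suc b , 0)
  unpair-zero-suc n eq rewrite eq = refl

  unpair-suc-suc : ∀ n {a b} → unpair n ≡ (suc a , b) → unpair (suc n) ≡ (a , suc b)
  unpair-suc-suc n eq rewrite eq = refl

  -- Induction along the order in which `unpair` lists the pairs: on the diagonal `a + b`, and
  -- within a diagonal on `b`.
  unpair-pair : ∀ a b → unpair (pair a b) ≡ (a , b)
  unpair-pair a b = onDiagonal (a + b) a b refl
    where
    onDiagonal : ∀ d a b → a + b ≡ d → unpair (pair a b) ≡ (a , b)
    onDiagonal zero    zero    zero    _  = refl
    onDiagonal (suc d) (suc a) zero    eq = trans (cong unpair (pair-suc-0 a))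
      (unpair-zero-suc (pair 0 a)
        (onDiagonal d 0 a (trans (sym (+-identityʳ a)) (suc-injective eq))))
    onDiagonal d       a       (suc b) eq = trans (cong unpair (pair-suc a b))
      (unpair-suc-suc (pair (suc a) b) (onDiagonal d (suc a) b (trans (sym (+-suc a b)) eq)))

  fst-pair : ∀ a b → fst (pair a b) ≡ a
  fst-pair a b = cong proj₁ (unpair-pair a b)

  snd-pair : ∀ a b → snd (pair a b) ≡ b
  snd-pair a b = cong proj₂ (unpair-pair a b)

  pair-unpair : ∀ n → pair (proj₁ (unpair n)) (proj₂ (unpair n)) ≡ n
  pair-unpair zero    = refl
  pair-unpair (suc n) with unpair n in eq | pair-unpair n
  ... | zero  , b | ih = trans (pair-suc-0 b) (cong suc ih)
  ... | suc a , b | ih = trans (pair-suc a b) (cong suc ih)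

  pair-fst-snd : ∀ n → pair (fst n) (snd n) ≡ n
  pair-fst-snd = pair-unpair

  a≤pair : ∀ a b → a ≤ pair a b
  a≤pair a b = ≤-trans (m≤m+n a b) (≤-trans (n≤triangle (a + b)) (m≤m+n _ b))

  b≤pair : ∀ a b → b ≤ pair a b
  b≤pair a b = m≤n+m b _

  -- Tails of a stream shrink strictly until they reach 0. Hence the code of a stream bounds the
  -- number of cells that matter, and `countOnes` may use it as its bound.
  pair≤suc⇒b≤ : ∀ a b {k} → pair a b ≤ suc k → b ≤ k
  pair≤suc⇒b≤ a zero    _  = z≤n
  pair≤suc⇒b≤ a (suc b) le = s≤s⁻¹ (≤-trans (s≤s (≤-trans (m≤n+m (suc b) a) (n≤triangle _)))
    (≤-trans (≤-trans (≤-reflexive (+-comm 1 (triangle (a + suc b)))) (+-monoʳ-≤ _ (s≤s z≤n))) le))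

pair≤0⇒ : ∀ a b → pair a b ≤ 0 → a ≡ 0 × b ≡ 0
pair≤0⇒ a b le = trans (sym (fst-pair a b)) (trans (cong fst eq) fst-0)
               , trans (sym (snd-pair a b)) (trans (cong snd eq) snd-0)
  where eq = n≤0⇒n≡0 le

-- `unpair` recurses on pairs of numbers and is not visibly primitive recursive. Its components can
-- be recovered from the number of the diagonal on which `n` lies, which goes up by one exactly when
-- the next triangular number is reached.
diagonal : ℕ → ℕ
diagonal = natrec 0 λ n d → ifz (triangle (suc d) ∸ suc n) (suc d) d

opaque
  unfolding pair

  diagonal-pair : ∀ n → diagonal n ≡ fst n + snd n
  diagonal-pair zero    = refl
  diagonal-pair (suc n) with unpair n in eq | diagonal-pair n | pair-unpair n
  ... | zero , b | ih | n≡ = trans (cong (λ m → ifz m (suc (diagonal n)) (diagonal n)) next)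
                             (trans (cong suc ih) (sym (+-identityʳ _)))
    where
    next : triangle (suc (diagonal n)) ∸ suc n ≡ 0
    next = m≤n⇒m∸n≡0 (≤-reflexive (begin
      triangle (suc (diagonal n)) ≡⟨ cong (triangle ∘ suc) ih ⟩
      triangle b + suc b          ≡⟨ +-suc (triangle b) b ⟩
      suc (pair 0 b)              ≡⟨ cong suc n≡ ⟩
      suc n                       ∎))
  ... | suc a , b | ih | n≡ = trans (stay (triangle (suc (diagonal n)) ∸ suc n) next)
                                    (trans ih (sym (+-suc a b)))
    where
    stay : ∀ m → 0 < m → ifz m (suc (diagonal n)) (diagonal n) ≡ diagonal n
    stay (suc m) _ = refl

    next : 0 < triangle (suc (diagonal n)) ∸ suc n
    next = m<n⇒0<n∸m (subst₂ _<_
      (trans (+-suc (triangle (suc a + b)) b) (cong suc n≡))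
      (cong (triangle ∘ suc) (sym ih))
      (+-monoʳ-< (triangle (suc a + b)) (s≤s (s≤s (m≤n+m b a)))))

snd-diagonal : ∀ n → n ∸ triangle (diagonal n) ≡ snd n
snd-diagonal n = begin
  n ∸ triangle (diagonal n)                                ≡⟨ cong₂ (λ m d → m ∸ triangle d)
    (sym (pair-fst-snd n)) (diagonal-pair n) ⟩
  pair (fst n) (snd n) ∸ triangle (fst n + snd n)          ≡⟨ cong (_∸ triangle (fst n + snd n))
    (pair-def (fst n) (snd n)) ⟩
  triangle (fst n + snd n) + snd n ∸ triangle (fst n + snd n) ≡⟨ m+n∸m≡n (triangle (fst n + snd n))
    (snd n) ⟩
  snd n                                                    ∎

fst-diagonal : ∀ n → diagonal n ∸ snd n ≡ fst n
fst-diagonal n = trans (cong (_∸ snd n) (diagonal-pair n)) (m+n∸n≡m (fst n) (snd n))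

-- A number l is read as the eventually zero stream fst l, fst (snd l), …;
-- since pair 0 0 = 0, trailing zeros of a list do not change its code.
drop : ℕ → ℕ → ℕ
drop l zero    = l
drop l (suc n) = snd (drop l n)

nth : ℕ → ℕ → ℕ
nth l n = fst (drop l n)

drop-snd : ∀ l n → drop l (suc n) ≡ drop (snd l) n
drop-snd l zero    = refl
drop-snd l (suc n) = cong snd (drop-snd l n)

drop-0 : ∀ n → drop 0 n ≡ 0
drop-0 zero    = refl
drop-0 (suc n) = trans (cong snd (drop-0 n)) snd-0

nth-0 : ∀ n → nth 0 n ≡ 0
nth-0 n = trans (cong fst (drop-0 n)) fst-0

nth-suc : ∀ l n → nth l (suc n) ≡ nth (snd l) n
nth-suc l n = cong fst (drop-snd l n)

nth-pair-suc : ∀ a l n → nth (pair a l) (suc n) ≡ nth l n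
nth-pair-suc a l n = trans (nth-suc (pair a l) n) (cong (λ l → nth l n) (snd-pair a l))

tabulate : ℕ → (ℕ → ℕ) → ℕ
tabulate k f = fold 0 (λ j → pair (f j)) k

nth-tabulate : ∀ {k n} f → n < k → nth (tabulate k f) n ≡ f n
nth-tabulate {suc k} {zero}  f _         =
  trans (cong fst (fold-suc 0 (λ j → pair (f j)) k)) (fst-pair _ _)
nth-tabulate {suc k} {suc n} f (s≤s n<k) =
  trans (cong (λ l → nth l (suc n)) (fold-suc 0 (λ j → pair (f j)) k))
  (trans (nth-pair-suc _ _ n) (nth-tabulate (f ∘ suc) n<k))

nth-tabulate-≥ : ∀ {k n} f → k ≤ n → nth (tabulate k f) n ≡ 0
nth-tabulate-≥ {zero}  {n}     f _         = nth-0 n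
nth-tabulate-≥ {suc k} {suc n} f (s≤s k≤n) =
  trans (cong (λ l → nth l (suc n)) (fold-suc 0 (λ j → pair (f j)) k))
  (trans (nth-pair-suc _ _ n) (nth-tabulate-≥ (f ∘ suc) k≤n))

update : ℕ → ℕ → ℕ → ℕ
update l t v = fold (pair v (drop l (suc t))) (λ j → pair (nth l j)) t

update-suc : ∀ l t v → update l (suc t) v ≡ pair (fst l) (update (snd l) t v)
update-suc l t v = begin
  update l (suc t) v                                                ≡⟨ fold-suc
    (pair v (drop l (2 + t))) (λ j → pair (nth l j)) t ⟩
  pair (fst l) (fold (pair v (drop l (2 + t))) (λ j → pair (nth l (suc j))) t)
    ≡⟨ cong (pair (fst l)) (fold-cong t λ j r → cong (λ a → pair a r) (nth-suc l j)) ⟩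
  pair (fst l) (fold (pair v (drop l (2 + t))) (λ j → pair (nth (snd l) j)) t)
    ≡⟨ cong (λ z → pair (fst l) (fold (pair v z) (λ j → pair (nth (snd l) j)) t))
      (drop-snd l (suc t)) ⟩
  pair (fst l) (update (snd l) t v)                                 ∎

nth-update-≡ : ∀ l t v → nth (update l t v) t ≡ v
nth-update-≡ l zero    v = fst-pair _ _
nth-update-≡ l (suc t) v = trans (cong (λ m → nth m (suc t)) (update-suc l t v))
  (trans (nth-pair-suc _ _ t) (nth-update-≡ (snd l) t v))

nth-update-≢ : ∀ l t v {u} → u ≢ t → nth (update l t v) u ≡ nth l u
nth-update-≢ l zero    v {zero}  u≢t = contradiction refl u≢t
nth-update-≢ l zero    v {suc u} u≢t = trans (nth-pair-suc _ _ u) (sym (nth-suc l u))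
nth-update-≢ l (suc t) v {zero}  u≢t = trans (cong fst (update-suc l t v)) (fst-pair _ _)
nth-update-≢ l (suc t) v {suc u} u≢t = trans (cong (λ m → nth m (suc u)) (update-suc l t v))
  (trans (nth-pair-suc _ _ u)
    (trans (nth-update-≢ (snd l) t v (u≢t ∘ cong suc)) (sym (nth-suc l u))))

streamCode : List ℕ → ℕ
streamCode []       = 0
streamCode (a ∷ as) = pair a (streamCode as)

isOne : ℕ → ℕ
isOne a = ifz (dist a 1) 1 0

onesBelow : ℕ → ℕ → ℕ
onesBelow l k = fold 0 (λ j r → isOne (nth l j) + r) k

onesBelow-streamCode : ∀ as {k} → streamCode as ≤ k → onesBelow (streamCode as) k ≡ ones as
onesBelow-streamCode []       {k}     le = zeros k
  where
  zeros : ∀ k → onesBelow 0 k ≡ 0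
  zeros zero    = refl
  zeros (suc k) = trans
    (cong (λ a → isOne a + natrec 0 (λ j r → isOne (nth 0 (suc k ∸ suc j)) + r) k) (nth-0 (k ∸ k)))
    (trans (natrec-cong {g = λ _ r → r} k (λ j _ r → cong (λ a → isOne a + r) (nth-0 (k ∸ j))))
      (idle k))
    where
    idle : ∀ k → natrec 0 (λ _ r → r) k ≡ 0
    idle zero    = refl
    idle (suc k) = idle k
onesBelow-streamCode (a ∷ as) {zero}  le with pair≤0⇒ a (streamCode as) le
... | refl , eq = onesBelow-streamCode as {zero} (≤-reflexive eq)
onesBelow-streamCode (a ∷ as) {suc k} le = begin
  onesBelow (pair a (streamCode as)) (suc k)
    ≡⟨ fold-suc 0 (λ j r → isOne (nth (pair a (streamCode as)) j) + r) k ⟩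
  isOne (fst (pair a (streamCode as))) + fold 0
    (λ j r → isOne (nth (pair a (streamCode as)) (suc j)) + r) k
    ≡⟨ cong₂ (λ a r → isOne a + r) (fst-pair a (streamCode as))
         (fold-cong k λ j r → cong (λ a → isOne a + r) (nth-pair-suc a (streamCode as) j)) ⟩
  isOne a + onesBelow (streamCode as) k
    ≡⟨ cong (isOne a +_) (onesBelow-streamCode as (pair≤suc⇒b≤ a _ le)) ⟩
  isOne a + ones as
    ≡⟨ headOne a ⟩
  ones (a ∷ as) ∎
  where
  headOne : ∀ a → isOne a + ones as ≡ ones (a ∷ as)
  headOne 0             = refl
  headOne 1             = refl
  headOne (suc (suc a)) = refl

countOnes : ℕ → ℕ
countOnes l = onesBelow l l

countOnes-streamCode : ∀ as → countOnes (streamCode as) ≡ ones as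
countOnes-streamCode as = onesBelow-streamCode as ≤-refl

cons : ℕ → ℕ → ℕ
cons a l = suc (pair a l)

hd tl : ℕ → ℕ
hd l = fst (pred l)
tl l = snd (pred l)

hd-cons : ∀ a l → hd (cons a l) ≡ a
hd-cons = fst-pair

tl-cons : ∀ a l → tl (cons a l) ≡ l
tl-cons = snd-pair

-- The inverse of `sequence`. Machines and definitions are decoded by `sequence`, so their codes are
-- lists with an end; for tapes and tables the streams above are handier, since all missing entries
-- read as 0.
listCode : List ℕ → ℕ
listCode = List.foldr cons 0

sequence′-listCode : ∀ l {k} → listCode l ≤ k → sequence′ k (listCode l) ≡ l
sequence′-listCode []      {zero}  _        = refl
sequence′-listCode []      {suc k} _        = refl
sequence′-listCode (a ∷ l) {suc k} (s≤s le) = cong₂ _∷_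
  (cong proj₁ (unpair-pair a (listCode l)))
  (trans (cong (sequence′ k ∘ proj₂) (unpair-pair a (listCode l)))
         (sequence′-listCode l (≤-trans (b≤pair a (listCode l)) le)))

sequence-listCode : ∀ l → sequence (listCode l) ≡ l
sequence-listCode l = sequence′-listCode l ≤-refl

listCode-sequence′ : ∀ {k} n → n ≤ k → listCode (sequence′ k n) ≡ n
listCode-sequence′ {zero}  zero    _        = refl
listCode-sequence′ {suc k} zero    _        = refl
listCode-sequence′ {suc k} (suc n) (s≤s le) = cong suc (trans
  (cong (pair (proj₁ (unpair n))) (listCode-sequence′ (proj₂ (unpair n))
    (≤-trans (b≤pair (proj₁ (unpair n)) (proj₂ (unpair n)))
      (≤-trans (≤-reflexive (pair-unpair n)) le))))
  (pair-unpair n))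

listCode-sequence : ∀ n → listCode (sequence n) ≡ n
listCode-sequence n = listCode-sequence′ n ≤-refl

seqDrop : ℕ → ℕ → ℕ
seqDrop l zero    = l
seqDrop l (suc n) = tl (seqDrop l n)

seqNth : ℕ → ℕ → ℕ
seqNth l n = hd (seqDrop l n)

listNth : List ℕ → ℕ → ℕ
listNth []      _       = 0
listNth (a ∷ l) zero    = a
listNth (a ∷ l) (suc n) = listNth l n

seqDrop-listCode : ∀ l n → seqDrop (listCode l) n ≡ listCode (List.drop n l)
seqDrop-listCode l zero    = refl
seqDrop-listCode l (suc n) = trans (cong tl (seqDrop-listCode l n)) (step l n)
  where
  step : ∀ l n → tl (listCode (List.drop n l)) ≡ listCode (List.drop (suc n) l)
  step []      zero    = snd-0
  step []      (suc n) = snd-0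
  step (a ∷ l) zero    = tl-cons a (listCode l)
  step (a ∷ l) (suc n) = step l n

seqNth-listCode : ∀ l n → seqNth (listCode l) n ≡ listNth l n
seqNth-listCode l n = trans (cong hd (seqDrop-listCode l n)) (step l n)
  where
  step : ∀ l n → hd (listCode (List.drop n l)) ≡ listNth l n
  step []      zero    = fst-0
  step []      (suc n) = fst-0
  step (a ∷ l) zero    = hd-cons a (listCode l)
  step (a ∷ l) (suc n) = step l n

-- Primitive recursive definability

-- Ties a term to the function that it computes, so that later arguments can speak of the function
-- alone.
record Definable {q n} (f : Vec 𝒩 q → Vec ℕ n → ℕ) : Set where
  field
    term    : PR q n
    correct : ∀ xs ns → evalPR xs term ns ≡ f xs ns

open Definable public

pattern v0 = zero
pattern v1 = suc v0
pattern v2 = suc v1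
pattern v3 = suc v2
pattern v4 = suc v3

module _ {q n : ℕ} where

  projections : ∀ {m} → (Fin m → Fin n) → Vec (PR q n) m
  projections ρ = Vec.tabulate (proj ∘ ρ)

  evalPRs-projections : ∀ {m} (ρ : Fin m → Fin n) xs ns →
    evalPRs xs (projections ρ) ns ≡ Vec.tabulate (lookup ns ∘ ρ)
  evalPRs-projections {zero}  ρ xs ns = refl
  evalPRs-projections {suc m} ρ xs ns =
    cong (lookup ns (ρ zero) ∷_) (evalPRs-projections (ρ ∘ suc) xs ns)

  evalPRs-identity : ∀ xs ns → evalPRs xs (projections (λ i → i)) ns ≡ ns
  evalPRs-identity xs ns = trans (evalPRs-projections (λ i → i) xs ns) (tabulate∘lookup ns)

  convD : ∀ {f g : Vec 𝒩 q → Vec ℕ n → ℕ} → Definable f → (∀ xs ns → f xs ns ≡ g xs ns) →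
    Definable g
  convD d eq .term          = d .term
  convD d eq .correct xs ns = trans (d .correct xs ns) (eq xs ns)

  varD : ∀ i → Definable (λ (_ : Vec 𝒩 q) (ns : Vec ℕ n) → lookup ns i)
  varD i .term          = proj i
  varD i .correct xs ns = refl

  zeroD : Definable (λ (_ : Vec 𝒩 q) (_ : Vec ℕ n) → 0)
  zeroD .term          = zero
  zeroD .correct xs ns = refl

  sucD : ∀ {f : Vec 𝒩 q → Vec ℕ n → ℕ} → Definable f → Definable (λ xs ns → suc (f xs ns))
  sucD d .term          = comp suc (d .term ∷ [])
  sucD d .correct xs ns = cong suc (d .correct xs ns)

  constD : ∀ c → Definable (λ (_ : Vec 𝒩 q) (_ : Vec ℕ n) → c)
  constD zero    = zeroD
  constD (suc c) = sucD (constD c)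

  oracleD : ∀ j {f : Vec 𝒩 q → Vec ℕ n → ℕ} → Definable f →
            Definable (λ xs ns → lookup xs j (f xs ns))
  oracleD j d .term          = comp (oracle j) (d .term ∷ [])
  oracleD j d .correct xs ns = cong (lookup xs j) (d .correct xs ns)

  -- A function need be shown definable only once, on variables; its uses at other arguments are
  -- substitution instances.
  app₁ : ∀ (F : Vec 𝒩 q → ℕ → ℕ) {f : Vec 𝒩 q → Vec ℕ n → ℕ} →
    Definable (λ xs ns → F xs (lookup ns v0)) → Definable f →
    Definable {n = n} (λ xs ns → F xs (f xs ns))
  app₁ F D d .term          = comp {m = 1} (D .term) (d .term ∷ [])
  app₁ F D d .correct xs ns = trans (D .correct xs _) (cong (F xs) (d .correct xs ns))

  app₂ : ∀ (F : Vec 𝒩 q → ℕ → ℕ → ℕ) {f g : Vec 𝒩 q → Vec ℕ n → ℕ} →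
    Definable (λ xs ns → F xs (lookup ns v0) (lookup ns v1)) → Definable f → Definable g →
    Definable {n = n} (λ xs ns → F xs (f xs ns) (g xs ns))
  app₂ F D d e .term          = comp {m = 2} (D .term) (d .term ∷ e .term ∷ [])
  app₂ F D d e .correct xs ns =
    trans (D .correct xs _) (cong₂ (F xs) (d .correct xs ns) (e .correct xs ns))

  app₃ : ∀ (F : Vec 𝒩 q → ℕ → ℕ → ℕ → ℕ) {f g h : Vec 𝒩 q → Vec ℕ n → ℕ} →
    Definable (λ xs ns → F xs (lookup ns v0) (lookup ns v1) (lookup ns v2)) →
    Definable f → Definable g → Definable h →
    Definable {n = n} (λ xs ns → F xs (f xs ns) (g xs ns) (h xs ns))
  app₃ F D d e d′ .term          = comp {m = 3} (D .term) (d .term ∷ e .term ∷ d′ .term ∷ [])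
  app₃ F D d e d′ .correct xs ns rewrite D .correct xs
    (evalPRs xs (d .term ∷ e .term ∷ d′ .term ∷ []) ns)
    | d .correct xs ns | e .correct xs ns | d′ .correct xs ns = refl

  natrecD : ∀ {z k : Vec 𝒩 q → Vec ℕ n → ℕ} {f : Vec 𝒩 q → Vec ℕ (2 + n) → ℕ} →
    Definable z → Definable f → Definable k →
    Definable (λ xs ns → natrec (z xs ns) (λ j r → f xs (j ∷ r ∷ ns)) (k xs ns))
  natrecD d e d′ .term = comp (rec (d .term) (e .term)) (d′ .term ∷ projections (λ i → i))
  natrecD {z} {k} {f} d e d′ .correct xs ns rewrite evalPRs-identity xs ns | d′ .correct xs ns =
    go (k xs ns)
    where
    go : ∀ m → evalPR xs (rec (d .term) (e .term)) (m ∷ ns) ≡ natrec (z xs ns)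
      (λ j r → f xs (j ∷ r ∷ ns)) m
    go zero    = d .correct xs ns
    go (suc m) rewrite go m = e .correct xs _

module _ {q : ℕ} where

  private
    Fun : ℕ → Set
    Fun n = Vec 𝒩 q → Vec ℕ n → ℕ

  opaque

    predD : ∀ {n} {f : Fun n} → Definable f → Definable (λ xs ns → pred (f xs ns))
    predD = app₁ (λ _ → pred)
      (convD (natrecD zeroD (varD v0) (varD v0)) λ xs ns → lemma (lookup ns v0))
      where
      lemma : ∀ m → natrec 0 (λ j _ → j) m ≡ pred m
      lemma zero    = refl
      lemma (suc m) = refl

    ifzD : ∀ {n} {f g h : Fun n} → Definable f → Definable g → Definable h →
      Definable (λ xs ns → ifz (f xs ns) (g xs ns) (h xs ns))
    ifzD = app₃ (λ _ → ifz)
      (convD (natrecD (varD v1) (varD v4) (varD v0)) λ xs ns → lemma (lookup ns v0) _ _)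
      where
      lemma : ∀ m a b → natrec a (λ _ _ → b) m ≡ ifz m a b
      lemma zero    a b = refl
      lemma (suc m) a b = refl

    +D : ∀ {n} {f g : Fun n} → Definable f → Definable g → Definable (λ xs ns → f xs ns + g xs ns)
    +D = app₂ (λ _ → _+_)
      (convD (natrecD (varD v1) (sucD (varD v1)) (varD v0)) λ xs ns → lemma (lookup ns v0) _)
      where
      lemma : ∀ m n → natrec n (λ _ → suc) m ≡ m + n
      lemma zero    n = refl
      lemma (suc m) n = cong suc (lemma m n)

    ∸D : ∀ {n} {f g : Fun n} → Definable f → Definable g → Definable (λ xs ns → f xs ns ∸ g xs ns)
    ∸D = app₂ (λ _ → _∸_)
      (convD (natrecD (varD v0) (predD (varD v1)) (varD v1)) λ xs ns →
        lemma (lookup ns v0) (lookup ns v1))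
      where
      lemma : ∀ m n → natrec m (λ _ → pred) n ≡ m ∸ n
      lemma m zero    = refl
      lemma m (suc n) = trans (cong pred (lemma m n)) (pred[m∸n]≡m∸[1+n] m n)

    distD : ∀ {n} {f g : Fun n} → Definable f → Definable g →
      Definable (λ xs ns → dist (f xs ns) (g xs ns))
    distD = app₂ (λ _ → dist) (+D (∸D (varD v0) (varD v1)) (∸D (varD v1) (varD v0)))

    triangleD : ∀ {n} {f : Fun n} → Definable f → Definable (λ xs ns → triangle (f xs ns))
    triangleD = app₁ (λ _ → triangle)
      (convD (natrecD zeroD (+D (varD v1) (sucD (varD v0))) (varD v0)) λ xs ns →
        lemma (lookup ns v0))
      where
      lemma : ∀ m → natrec 0 (λ j r → r + suc j) m ≡ triangle m
      lemma zero    = refl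
      lemma (suc m) = cong (_+ suc m) (lemma m)

    pairD : ∀ {n} {f g : Fun n} → Definable f → Definable g →
      Definable (λ xs ns → pair (f xs ns) (g xs ns))
    pairD = app₂ (λ _ → pair)
      (convD (+D (triangleD (+D (varD v0) (varD v1))) (varD v1)) λ xs ns →
        sym (pair-def (lookup ns v0) (lookup ns v1)))

    diagonalD : ∀ {n} {f : Fun n} → Definable f → Definable (λ xs ns → diagonal (f xs ns))
    diagonalD = app₁ (λ _ → diagonal) (natrecD zeroD
      (ifzD (∸D (triangleD (sucD (varD v1))) (sucD (varD v0))) (sucD (varD v1)) (varD v1))
        (varD v0))

    sndD : ∀ {n} {f : Fun n} → Definable f → Definable (λ xs ns → snd (f xs ns))
    sndD = app₁ (λ _ → snd)
      (convD (∸D (varD v0) (triangleD (diagonalD (varD v0)))) λ xs ns → snd-diagonal (lookup ns v0))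

    fstD : ∀ {n} {f : Fun n} → Definable f → Definable (λ xs ns → fst (f xs ns))
    fstD = app₁ (λ _ → fst)
      (convD (∸D (diagonalD (varD v0)) (sndD (varD v0))) λ xs ns → fst-diagonal (lookup ns v0))

    dropD : ∀ {n} {f g : Fun n} → Definable f → Definable g →
      Definable (λ xs ns → drop (f xs ns) (g xs ns))
    dropD = app₂ (λ _ → drop)
      (convD (natrecD (varD v0) (sndD (varD v1)) (varD v1)) λ xs ns → lemma _ (lookup ns v1))
      where
      lemma : ∀ l n → natrec l (λ _ → snd) n ≡ drop l n
      lemma l zero    = refl
      lemma l (suc n) = cong snd (lemma l n)

    nthD : ∀ {n} {f g : Fun n} → Definable f → Definable g →
      Definable (λ xs ns → nth (f xs ns) (g xs ns))
    nthD d e = fstD (dropD d e)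

    consD : ∀ {n} {f g : Fun n} → Definable f → Definable g →
      Definable (λ xs ns → cons (f xs ns) (g xs ns))
    consD d e = sucD (pairD d e)

    seqDropD : ∀ {n} {f g : Fun n} → Definable f → Definable g →
      Definable (λ xs ns → seqDrop (f xs ns) (g xs ns))
    seqDropD = app₂ (λ _ → seqDrop)
      (convD (natrecD (varD v0) (sndD (predD (varD v1))) (varD v1)) λ xs ns →
        lemma _ (lookup ns v1))
      where
      lemma : ∀ l n → natrec l (λ _ → tl) n ≡ seqDrop l n
      lemma l zero    = refl
      lemma l (suc n) = cong tl (lemma l n)

    seqNthD : ∀ {n} {f g : Fun n} → Definable f → Definable g →
      Definable (λ xs ns → seqNth (f xs ns) (g xs ns))
    seqNthD d e = fstD (predD (seqDropD d e))

  substHeadD : ∀ {n} {f g : Fun (suc n)} → Definable f → Definable g →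
    Definable (λ xs ns → f xs (g xs ns ∷ Vec.tail ns))
  substHeadD d e .term = comp (d .term) (e .term ∷ projections suc)
  substHeadD {f = f} d e .correct xs (m ∷ ns)
    rewrite evalPRs-projections {q} suc xs (m ∷ ns) | tabulate∘lookup ns | e .correct xs (m ∷ ns) =
      d .correct xs _

  weakenD : ∀ {n} {f : Fun n} → Definable f → Definable (λ xs ns → f xs (Vec.tail ns))
  weakenD d .term = comp (d .term) (projections suc)
  weakenD d .correct xs (m ∷ ns)
    rewrite evalPRs-projections {q} suc xs (m ∷ ns) | tabulate∘lookup ns = d .correct xs ns

  -- `fold` is `natrec` with the counter reversed, so the body is precomposed with `k ∸ suc j`,
  -- where `k` is weakened past the counter and the accumulator.
  foldD : ∀ {n} {z k : Fun n} {f : Fun (2 + n)} → Definable z → Definable f → Definable k →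
    Definable (λ xs ns → fold (z xs ns) (λ j r → f xs (j ∷ r ∷ ns)) (k xs ns))
  foldD d e d′ = natrecD d (substHeadD e (∸D (weakenD (weakenD d′)) (sucD (varD v0)))) d′

  opaque

    updateD : ∀ {n} {f g h : Fun n} → Definable f → Definable g → Definable h →
      Definable (λ xs ns → update (f xs ns) (g xs ns) (h xs ns))
    updateD = app₃ (λ _ → update) (foldD (pairD (varD v2) (dropD (varD v0) (sucD (varD v1))))
      (pairD (nthD (varD v2) (varD v0)) (varD v1)) (varD v1))

    countOnesD : ∀ {n} {f : Fun n} → Definable f → Definable (λ xs ns → countOnes (f xs ns))
    countOnesD = app₁ (λ _ → countOnes) (foldD zeroD
      (+D (ifzD (distD (nthD (varD v2) (varD v0)) (constD 1)) (constD 1) zeroD) (varD v1))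
        (varD v0))

  tabulateD : ∀ {n} {k : Fun n} {f : Fun (suc n)} → Definable k → Definable f →
    Definable (λ xs ns → tabulate (k xs ns) (λ j → f xs (j ∷ ns)))
  tabulateD {f = f} d e = foldD zeroD (pairD (skip e) (varD v1)) d
    where
    skip : ∀ {n} {f : Fun (suc n)} → Definable f →
      Definable (λ xs ns → f xs (Vec.head ns ∷ Vec.tail (Vec.tail ns)))
    skip d .term = comp (d .term) (proj zero ∷ projections (λ i → suc (suc i)))
    skip d .correct xs (m ∷ r ∷ ns)
      rewrite evalPRs-projections {q} (λ i → suc (suc i)) xs (m ∷ r ∷ ns) | tabulate∘lookup ns =
        d .correct xs (m ∷ ns)

-- Register programs on Turing machines

Registers : Set
Registers = ℕ → ℕ

infixl 9 _[_↦_]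
_[_↦_] : Registers → ℕ → ℕ → Registers
(ρ [ r ↦ v ]) u = if does (u ≟ r) then v else ρ u

if-yes : ∀ {A B : Set} (d : Dec A) {x y : B} → A → (if does d then x else y) ≡ x
if-yes d a rewrite dec-true d a = refl

if-no : ∀ {A B : Set} (d : Dec A) {x y : B} → ¬ A → (if does d then x else y) ≡ y
if-no d ¬a rewrite dec-false d ¬a = refl

↦-≡ : ∀ ρ r v → (ρ [ r ↦ v ]) r ≡ v
↦-≡ ρ r v = if-yes (r ≟ r) refl

↦-≢ : ∀ ρ {r u} v → u ≢ r → (ρ [ r ↦ v ]) u ≡ ρ u
↦-≢ ρ {r} {u} v u≢r = if-no (u ≟ r) u≢r

infixr 5 _⨾_
-- `while r c` joins test and decrement because on a unary tape one move to the right serves both: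
-- it shows whether the block is empty and, if not, puts the head on the 1 to be erased.
data Code (q : ℕ) : Set where
  skip  : Code q
  inc   : ℕ → Code q
  query : Fin q → ℕ → Code q
  _⨾_   : Code q → Code q → Code q
  while : ℕ → Code q → Code q

module _ {q} (xs : Vec 𝒩 q) where

  data Exec : Code q → Registers → Registers → Set where
    skip  : ∀ {ρ} → Exec skip ρ ρ
    inc   : ∀ {r ρ} → Exec (inc r) ρ (ρ [ r ↦ suc (ρ r) ])
    query : ∀ {j r ρ} → Exec (query j r) ρ (ρ [ r ↦ lookup xs j (ρ r) ])
    _⨾_   : ∀ {c d ρ ρ′ ρ″} → Exec c ρ ρ′ → Exec d ρ′ ρ″ → Exec (c ⨾ d) ρ ρ″
    exit  : ∀ {r c ρ} → ρ r ≡ 0 → Exec (while r c) ρ ρ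
    loop  : ∀ {r c ρ ρ′ ρ″ n} → ρ r ≡ suc n → Exec c (ρ [ r ↦ n ]) ρ′ →
            Exec (while r c) ρ′ ρ″ → Exec (while r c) ρ ρ″

jump : ∀ {q} → ℕ → OracleCommand q
jump a = basic (branch 0 0 a a)

size : ∀ {q} → Code q → ℕ
size skip        = 0
size (inc r)     = 2
size (query j r) = 1
size (c ⨾ d)     = size c + size d
size (while r c) = 3 + (size c + 1)

-- `a` is the absolute address of the first command. The head rests on the blank just left of its
-- block of 1s, so that an increment prolongs the block to the left.
compile : ∀ {q} → Code q → ℕ → OracleProgram q
compile skip        a = []
compile (inc r)     a = basic (write r 1 (1 + a)) ∷ basic (move leftward r (2 + a)) ∷ []
compile (query j r) a = query j r (1 + a) ∷ []
compile (c ⨾ d)     a = compile c a ++ compile d (size c + a)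
compile (while r c) a =
  basic (move rightward r (1 + a)) ∷ basic (branch r 1 (2 + a) (3 + (size c + 1) + a)) ∷
  basic (write r 0 (3 + a)) ∷ (compile c (3 + a) ++ jump a ∷ [])

length-compile : ∀ {q} (c : Code q) a → length (compile c a) ≡ size c
length-compile skip        a = refl
length-compile (inc r)     a = refl
length-compile (query j r) a = refl
length-compile (c ⨾ d)     a = trans (length-++ (compile c a))
  (cong₂ _+_ (length-compile c a) (length-compile d (size c + a)))
length-compile (while r c) a = cong (3 +_) (trans (length-++ (compile c (3 + a)))
  (cong (_+ 1) (length-compile c (3 + a))))

Zeros : List ℕ → Set
Zeros = All (_≡ 0)

-- Blanks are allowed on both sides, since erasing and moving leave explicit zeros in the zipper.
Holds : Tape → ℕ → Set
Holds T n = ∃₂ λ ls zs → Zeros ls × Zeros zs × T ≡ tape ls 0 (List.replicate n 1 ++ zs)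

Represents : (ℕ → Tape) → Registers → Set
Represents Ts ρ = ∀ r → Holds (Ts r) (ρ r)

ones-zeros : ∀ {as} → Zeros as → ones as ≡ 0
ones-zeros []           = refl
ones-zeros (refl ∷ as≡0) = ones-zeros as≡0

number-holds : ∀ {T n} → Holds T n → number T ≡ n
number-holds {n = n} (ls , zs , ls≡0 , zs≡0 , refl) =
  cong₂ _+_ (ones-zeros ls≡0) (block n)
  where
  block : ∀ n → ones (List.replicate n 1 ++ zs) ≡ n
  block zero    = ones-zeros zs≡0
  block (suc n) = cong suc (block n)

holds-numerals : ∀ n → Holds (numerals (n ∷ [])) n
holds-numerals n = [] , 0 ∷ [] , [] , refl ∷ [] , cong (tape [] 0)
  (++-identityʳ (List.replicate n 1 ++ 0 ∷ []))

holds-blank : Holds (numerals []) 0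
holds-blank = [] , [] , [] , [] , refl

replaceTape-≡ : ∀ t T Ts → replaceTape t T Ts t ≡ T
replaceTape-≡ t T Ts = if-yes (t ≟ t) refl

replaceTape-≢ : ∀ {t u} T Ts → u ≢ t → replaceTape t T Ts u ≡ Ts u
replaceTape-≢ {t} {u} T Ts u≢t = if-no (u ≟ t) u≢t

AgreesOff : ℕ → (ℕ → Tape) → (ℕ → Tape) → Set
AgreesOff r Ts Ts′ = ∀ u → u ≢ r → Ts′ u ≡ Ts u

represents-update : ∀ {Ts Ts′ ρ} r {v} → Represents Ts ρ → AgreesOff r Ts Ts′ →
  Holds (Ts′ r) v → Represents Ts′ (ρ [ r ↦ v ])
represents-update {Ts′ = Ts′} {ρ} r {v} rep agr h u with u ≟ r
... | yes refl = subst (Holds (Ts′ r)) (sym (↦-≡ ρ r v)) h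
... | no u≢r   = subst₂ Holds (sym (agr u u≢r)) (sym (↦-≢ ρ v u≢r)) (rep u)

represents-agrees : ∀ {Ts Ts′ ρ} r → Represents Ts ρ → AgreesOff r Ts Ts′ →
  Holds (Ts′ r) (ρ r) → Represents Ts′ ρ
represents-agrees r rep agr h u with u ≟ r
... | yes refl = h
... | no u≢r   = subst (λ T → Holds T _) (sym (agr u u≢r)) (rep u)

holds-inc : ∀ {T n} → Holds T n → Holds (moveHead leftward (record T { head = 1 })) (suc n)
holds-inc ([]      , zs , _         , zs≡0 , refl) = [] , zs , [] , zs≡0 , refl
holds-inc (.0 ∷ ls , zs , refl ∷ ls≡0 , zs≡0 , refl) = ls , zs , ls≡0 , zs≡0 , refl

holds-right-zero : ∀ {T} → Holds T 0 →
  Tape.head (moveHead rightward T) ≡ 0 × Holds (moveHead rightward T) 0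
holds-right-zero (ls , []     , ls≡0 , zs≡0 , refl)        =
  refl , 0 ∷ ls , [] , refl ∷ ls≡0 , [] , refl
holds-right-zero (ls , .0 ∷ zs , ls≡0 , refl ∷ zs≡0 , refl) =
  refl , 0 ∷ ls , zs , refl ∷ ls≡0 , zs≡0 , refl

holds-right-suc : ∀ {T n} → Holds T (suc n) →
  Tape.head (moveHead rightward T) ≡ 1 × Holds (record (moveHead rightward T) { head = 0 }) n
holds-right-suc (ls , zs , ls≡0 , zs≡0 , refl) = refl , 0 ∷ ls , zs , refl ∷ ls≡0 , zs≡0 , refl

infixr 5 _∷_
data At {q} (P : OracleProgram q) : ℕ → OracleProgram q → Set where
  []  : ∀ {a} → At P a []
  _∷_ : ∀ {a c cs} → fetch (basic halt) P a ≡ c → At P (suc a) cs → At P a (c ∷ cs)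

At-++ : ∀ {q} {P : OracleProgram q} {a} cs {ds} → At P a (cs ++ ds) → At P a cs ×
  At P (length cs + a) ds
At-++     []       at        = [] , at
At-++ {P = P} {a} (c ∷ cs) {ds} (eq ∷ at) with At-++ cs at
... | atc , atd = eq ∷ atc , subst (λ b → At P b ds) (+-suc (length cs) a) atd

At-infix : ∀ {q} (as cs : OracleProgram q) {bs} → At (as ++ cs ++ bs) (length as) cs
At-infix as []       = []
At-infix as (c ∷ cs) {bs} = head as ∷ subst₂ (λ P a → At P a cs)
  (++-assoc as (c ∷ []) (cs ++ bs)) (trans (length-++ as) (+-comm (length as) 1))
    (At-infix (as ++ c ∷ []) cs)
  where
  head : ∀ as → fetch (basic halt) (as ++ c ∷ cs ++ bs) (length as) ≡ c
  head []       = refl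
  head (a ∷ as) = head as

module _ {q} (P : OracleProgram q) (xs : Vec 𝒩 q) where

  run-+ : ∀ k l c → run P xs (k + l) c ≡ run P xs l (run P xs k c)
  run-+ zero    l c = refl
  run-+ (suc k) l c = run-+ k l _

  run-suc : ∀ k c → run P xs (suc k) c ≡ performOracle P xs (command P xs (run P xs k c))
    (run P xs k c)
  run-suc zero    c = refl
  run-suc (suc k) c = run-suc k _

  run-halted : ∀ k c → command P xs c ≡ basic halt → run P xs k c ≡ c
  run-halted zero    c eq = refl
  run-halted (suc k) c eq rewrite eq = run-halted k c eq

  step-from : ∀ {c k c′} d → command P xs c ≡ d → run P xs k (performOracle P xs d c) ≡ c′ →
              run P xs (suc k) c ≡ c′
  step-from d refl eq = eq

  Reaches : Config → ℕ → Registers → Set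
  Reaches c b ρ = ∃₂ λ k Ts → run P xs k c ≡ config b Ts × Represents Ts ρ

  reaches-step : ∀ {a Ts b ρ} {d} → fetch (basic halt) P a ≡ d →
    Reaches (performOracle P xs d (config a Ts)) b ρ → Reaches (config a Ts) b ρ
  reaches-step {d = d} eq (k , Ts′ , r , rep) = suc k , Ts′ , step-from {k = k} d eq r , rep

  reaches-trans : ∀ {c a b ρ ρ′} → Reaches c a ρ →
    (∀ Ts → Represents Ts ρ → Reaches (config a Ts) b ρ′) → Reaches c b ρ′
  reaches-trans {c} (k , Ts , r , rep) f with f Ts rep
  ... | k′ , Ts′ , r′ , rep′ =
    k + k′ , Ts′ , trans (run-+ k k′ c) (trans (cong (run P xs k′) r) r′) , rep′

  reaches-refl : ∀ {a b Ts ρ} → a ≡ b → Represents Ts ρ → Reaches (config a Ts) b ρ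
  reaches-refl refl rep = 0 , _ , refl , rep

  private
    twice : ∀ r T T′ Ts → AgreesOff r Ts (replaceTape r T′ (replaceTape r T Ts))
    twice r T T′ Ts u u≢r =
      trans (replaceTape-≢ T′ (replaceTape r T Ts) u≢r) (replaceTape-≢ T Ts u≢r)

  jump-reaches : ∀ {a b Ts ρ} → fetch (basic halt) P a ≡ jump b → Represents Ts ρ →
    Reaches (config a Ts) b ρ
  -- Both outcomes of the branch lead to `b`, whatever symbol is scanned.
  jump-reaches {b = b} {Ts} {ρ} eq rep = reaches-step eq (same (does (Tape.head (Ts 0) ≟ 0)))
    where
    same : ∀ t → Reaches (config (if t then b else b) Ts) b ρ
    same true  = reaches-refl refl rep
    same false = reaches-refl refl rep

  while-exit : ∀ {r c a Ts ρ} → At P a (compile (while r c) a) → Represents Ts ρ → ρ r ≡ 0 →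
    Reaches (config a Ts) (size (while r c) + a) ρ
  while-exit {r} {c} {a} {Ts} {ρ} (at₀ ∷ at₁ ∷ _) rep eq =
    reaches-step at₀ (reaches-step at₁ (branching (Tape.head (Ts′ r) ≟ 1)))
    where
    Ts′ = replaceTape r (moveHead rightward (Ts r)) Ts
    now = holds-right-zero (subst (Holds (Ts r)) eq (rep r))

    Ts′r : Ts′ r ≡ moveHead rightward (Ts r)
    Ts′r = replaceTape-≡ r _ Ts

    branching : (d : Dec (Tape.head (Ts′ r) ≡ 1)) →
      Reaches (config (if does d then 2 + a else 3 + (size c + 1) + a) Ts′) (size (while r c) + a) ρ
    branching (yes p) = contradiction
      (trans (sym (proj₁ now)) (trans (cong Tape.head (sym Ts′r)) p)) λ ()
    branching (no _)  = reaches-refl refl (represents-agrees r rep (λ u → replaceTape-≢ _ Ts)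
      (subst₂ Holds (sym Ts′r) (sym eq) (proj₂ now)))

  while-enter : ∀ {r c a Ts ρ n} → At P a (compile (while r c) a) → Represents Ts ρ → ρ r ≡ suc n →
    Reaches (config a Ts) (3 + a) (ρ [ r ↦ n ])
  while-enter {r} {c} {a} {Ts} {ρ} {n} (at₀ ∷ at₁ ∷ at₂ ∷ _) rep eq =
    reaches-step at₀ (reaches-step at₁ (branching (Tape.head (Ts′ r) ≟ 1)))
    where
    Ts′ = replaceTape r (moveHead rightward (Ts r)) Ts
    now = holds-right-suc (subst (Holds (Ts r)) eq (rep r))

    Ts′r : Ts′ r ≡ moveHead rightward (Ts r)
    Ts′r = replaceTape-≡ r _ Ts

    branching : (d : Dec (Tape.head (Ts′ r) ≡ 1)) →
      Reaches (config (if does d then 2 + a else 3 + (size c + 1) + a) Ts′) (3 + a) (ρ [ r ↦ n ])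
    branching (yes _) = reaches-step at₂ (reaches-refl refl
      (represents-update r rep (twice r _ _ Ts)
        (subst (λ T → Holds T n) (sym (replaceTape-≡ r _ Ts′))
          (subst (λ T → Holds (record T { head = 0 }) n) (sym Ts′r) (proj₂ now)))))
    branching (no ¬p) = contradiction (trans (cong Tape.head Ts′r) (proj₁ now)) ¬p

  compile-correct : ∀ {c ρ ρ′} → Exec xs c ρ ρ′ → ∀ {a Ts} → At P a (compile c a) →
    Represents Ts ρ →
    Reaches (config a Ts) (size c + a) ρ′

  -- One pass through the loop, back to its entry. Besides its use in the induction, it serves to
  -- show that an unsuccessful search never halts.
  while-continue : ∀ {r c a Ts ρ ρ′ n} → At P a (compile (while r c) a) → Represents Ts ρ →
    ρ r ≡ suc n →
    Exec xs c (ρ [ r ↦ n ]) ρ′ → Reaches (config a Ts) a ρ′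

  compile-correct skip at rep = reaches-refl refl rep
  compile-correct (inc {r} {ρ}) {a} {Ts} (at₀ ∷ at₁ ∷ _) rep =
    reaches-step at₀ (reaches-step at₁ (reaches-refl refl
    (represents-update r rep (twice r _ _ Ts)
      (subst (λ T → Holds T (suc (ρ r))) (sym (replaceTape-≡ r _ Ts′))
        (subst (λ T → Holds (moveHead leftward T) (suc (ρ r))) (sym (replaceTape-≡ r _ Ts))
          (holds-inc (rep r)))))))
    where Ts′ = replaceTape r (record (Ts r) { head = 1 }) Ts
  compile-correct (query {j} {r} {ρ}) {a} {Ts} (at₀ ∷ _) rep = reaches-step at₀ (reaches-refl refl
    (represents-update r rep (λ u → replaceTape-≢ _ Ts)
      (subst₂ Holds (sym (replaceTape-≡ r _ Ts)) (cong (lookup xs j) (number-holds (rep r)))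
        (holds-numerals _))))
  compile-correct (_⨾_ {c} {d} {ρ″ = ρ″} e f) {a} at rep with At-++ (compile c a) at
  ... | atc , atd = reaches-trans (compile-correct e atc rep) λ Ts rep′ →
    subst (λ b → Reaches (config (size c + a) Ts) b ρ″) sizes
      (compile-correct f (subst (λ n → At P (n + a) (compile d (size c + a)))
        (length-compile c a) atd) rep′)
    where
    sizes : size d + (size c + a) ≡ size c + size d + a
    sizes = trans (sym (+-assoc (size d) (size c) a)) (cong (_+ a) (+-comm (size d) (size c)))
  compile-correct (exit {r} {c} eq) at rep = while-exit {r} {c} at rep eq
  compile-correct (loop {r} {c} eq e f) at rep =
    reaches-trans (while-continue {r} {c} at rep eq e) λ Ts rep′ → compile-correct f at rep′

  while-continue {r} {c} {a} at@(_ ∷ _ ∷ _ ∷ at₃) rep eq e with At-++ (compile c (3 + a)) at₃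
  ... | atc , at-jump ∷ _ = reaches-trans (while-enter {r} {c} at rep eq) λ Ts rep′ →
    reaches-trans (compile-correct e atc rep′) λ Ts′ rep″ →
      jump-reaches (subst (λ n → fetch (basic halt) P (n + (3 + a)) ≡ jump a)
        (length-compile c (3 + a)) at-jump) rep″

-- Primitive recursive functionals as register programs

clear : ∀ {q} → ℕ → Code q
clear r = while r skip

-- A register can be copied only by counting it down; the second copy in `t` is there to restore
-- `s`.
copy : ∀ {q} → (src dst tmp : ℕ) → Code q
copy s d t = clear d ⨾ clear t ⨾ while s (inc d ⨾ inc t) ⨾ while t (inc s)

toCode  : ∀ {q n} → PR q n → Vec ℕ n → (out base : ℕ) → Code q
toCodes : ∀ {q n m} → Vec (PR q n) m → Vec ℕ n → (out base : ℕ) → Code q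

toCode zero           ins       out b = clear out
toCode suc            (r ∷ [])  out b = copy r out b ⨾ inc out
toCode (proj i)       ins       out b = copy (lookup ins i) out b
toCode (oracle j)     (r ∷ [])  out b = copy r out b ⨾ query j out
toCode (comp {m} f gs) ins      out b =
  toCodes gs ins b (m + b) ⨾ toCode f (Vec.tabulate λ i → toℕ i + b) out (m + b)
-- Register b counts down, 1 + b counts up, out accumulates.
toCode (rec g h)      (r ∷ ins) out b =
  copy r b (1 + b) ⨾ clear (1 + b) ⨾ toCode g ins out (3 + b) ⨾
  while b (toCode h (1 + b ∷ out ∷ ins) (2 + b) (3 + b) ⨾ copy (2 + b) out (3 + b) ⨾ inc (1 + b))

toCodes []       ins o b = skip
toCodes (g ∷ gs) ins o b = toCode g ins o b ⨾ toCodes gs ins (suc o) b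

map-agree : ∀ {n} {ρ ρ′ : Registers} (ins : Vec ℕ n) →
  (∀ i → ρ′ (lookup ins i) ≡ ρ (lookup ins i)) →
            Vec.map ρ′ ins ≡ Vec.map ρ ins
map-agree []        eq = refl
map-agree (r ∷ ins) eq = cong₂ _∷_ (eq zero) (map-agree ins (eq ∘ suc))

module _ {q} (xs : Vec 𝒩 q) where

  -- Registers from b on are scratch space.
  Sets : Code q → ℕ → Registers → ℕ → ℕ → Set
  Sets c b ρ r v = ∃ λ ρ′ → Exec xs c ρ ρ′ × ρ′ r ≡ v × (∀ u → u < b → u ≢ r → ρ′ u ≡ ρ u)

  clear-exec : ∀ ρ r → ∃ λ ρ′ → Exec xs (clear r) ρ ρ′ × ρ′ r ≡ 0 × (∀ u → u ≢ r → ρ′ u ≡ ρ u)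
  clear-exec ρ r = go (ρ r) ρ refl
    where
    go : ∀ n ρ → ρ r ≡ n → ∃ λ ρ′ → Exec xs (clear r) ρ ρ′ × ρ′ r ≡ 0 × (∀ u → u ≢ r → ρ′ u ≡ ρ u)
    go zero    ρ eq = ρ , exit eq , eq , λ _ _ → refl
    go (suc n) ρ eq with go n (ρ [ r ↦ n ]) (↦-≡ ρ r n)
    ... | ρ′ , e , z , frame = ρ′ , loop eq skip e , z , λ u u≢r → trans (frame u u≢r) (↦-≢ ρ n u≢r)

  drain₁ : ∀ {s d} → s ≢ d → ∀ n ρ → ρ s ≡ n → ∃ λ ρ′ →
    Exec xs (while s (inc d)) ρ ρ′ × ρ′ s ≡ 0 × ρ′ d ≡ ρ d + n ×
    (∀ u → u ≢ s → u ≢ d → ρ′ u ≡ ρ u)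
  drain₁ {s} {d} s≢d zero    ρ eq = ρ , exit eq , eq , sym (+-identityʳ _) , λ _ _ _ → refl
  drain₁ {s} {d} s≢d (suc n) ρ eq with drain₁ s≢d n (ρ₁ [ d ↦ suc (ρ₁ d) ])
                                         (trans (↦-≢ ρ₁ _ s≢d) (↦-≡ ρ s n))
    where ρ₁ = ρ [ s ↦ n ]
  ... | ρ′ , e , z , d≡ , frame = ρ′ , loop eq inc e , z
      , trans d≡ (trans (cong (_+ n) (trans (↦-≡ ρ₁ d _) (cong suc (↦-≢ ρ n (≢-sym s≢d)))))
        (sym (+-suc (ρ d) n)))
      , λ u u≢s u≢d → trans (frame u u≢s u≢d) (trans (↦-≢ ρ₁ _ u≢d) (↦-≢ ρ n u≢s))
    where ρ₁ = ρ [ s ↦ n ]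

  drain₂ : ∀ {s d t} → s ≢ d → s ≢ t → d ≢ t → ∀ n ρ → ρ s ≡ n → ∃ λ ρ′ →
    Exec xs (while s (inc d ⨾ inc t)) ρ ρ′ × ρ′ s ≡ 0 × ρ′ d ≡ ρ d + n × ρ′ t ≡ ρ t + n ×
    (∀ u → u ≢ s → u ≢ d → u ≢ t → ρ′ u ≡ ρ u)
  drain₂ s≢d s≢t d≢t zero ρ eq =
    ρ , exit eq , eq , sym (+-identityʳ _) , sym (+-identityʳ _) , λ _ _ _ _ → refl
  drain₂ {s} {d} {t} s≢d s≢t d≢t (suc n) ρ eq = finish (drain₂ s≢d s≢t d≢t n ρ₃ ρ₃s)
    where
    ρ₁ = ρ [ s ↦ n ]
    ρ₂ = ρ₁ [ d ↦ suc (ρ₁ d) ]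
    ρ₃ = ρ₂ [ t ↦ suc (ρ₂ t) ]

    ρ₃s : ρ₃ s ≡ n
    ρ₃s = trans (↦-≢ ρ₂ _ s≢t) (trans (↦-≢ ρ₁ _ s≢d) (↦-≡ ρ s n))

    ρ₃d : ρ₃ d ≡ suc (ρ d)
    ρ₃d = trans (↦-≢ ρ₂ _ d≢t) (trans (↦-≡ ρ₁ d _) (cong suc (↦-≢ ρ n (≢-sym s≢d))))

    ρ₃t : ρ₃ t ≡ suc (ρ t)
    ρ₃t = trans (↦-≡ ρ₂ t _) (cong suc (trans (↦-≢ ρ₁ _ (≢-sym d≢t)) (↦-≢ ρ n (≢-sym s≢t))))

    finish : (∃ λ ρ′ → Exec xs (while s (inc d ⨾ inc t)) ρ₃ ρ′ × ρ′ s ≡ 0 × ρ′ d ≡ ρ₃ d + n ×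
      ρ′ t ≡ ρ₃ t + n × (∀ u → u ≢ s → u ≢ d → u ≢ t → ρ′ u ≡ ρ₃ u)) → ∃ λ ρ′ →
        Exec xs (while s (inc d ⨾ inc t)) ρ ρ′ × ρ′ s ≡ 0 × ρ′ d ≡ ρ d + suc n ×
          ρ′ t ≡ ρ t + suc n × (∀ u → u ≢ s → u ≢ d → u ≢ t → ρ′ u ≡ ρ u)
    finish (ρ′ , e , z , d≡ , t≡ , frame) = ρ′ , loop eq (inc ⨾ inc) e , z
      , trans d≡ (trans (cong (_+ n) ρ₃d) (sym (+-suc (ρ d) n)))
      , trans t≡ (trans (cong (_+ n) ρ₃t) (sym (+-suc (ρ t) n)))
      , λ u u≢s u≢d u≢t → trans (frame u u≢s u≢d u≢t)
          (trans (↦-≢ ρ₂ _ u≢t) (trans (↦-≢ ρ₁ _ u≢d) (↦-≢ ρ n u≢s)))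

  copy-sets : ∀ {s d t b} → s ≢ d → s < b → d < b → b ≤ t → ∀ ρ → Sets (copy s d t) b ρ d (ρ s)
  copy-sets {s} {d} {t} {b} s≢d s<b d<b b≤t ρ
    with clear-exec ρ d
  ... | ρ₁ , e₁ , ρ₁d , frame₁
    with clear-exec ρ₁ t
  ... | ρ₂ , e₂ , ρ₂t , frame₂
    with drain₂ s≢d (<⇒≢ (<-≤-trans s<b b≤t)) (<⇒≢ (<-≤-trans d<b b≤t)) (ρ₂ s) ρ₂ refl
  ... | ρ₃ , e₃ , ρ₃s , ρ₃d , ρ₃t , frame₃
    with drain₁ (≢-sym (<⇒≢ (<-≤-trans s<b b≤t))) (ρ₃ t) ρ₃ refl
  ... | ρ₄ , e₄ , ρ₄t , ρ₄s , frame₄ = ρ₄ , e₁ ⨾ e₂ ⨾ e₃ ⨾ e₄ , ρ₄d , frame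
    where
    below : ∀ {u} → u < b → u ≢ t
    below u<b = <⇒≢ (<-≤-trans u<b b≤t)

    ρ₂s : ρ₂ s ≡ ρ s
    ρ₂s = trans (frame₂ s (below s<b)) (frame₁ s s≢d)

    ρ₄d : ρ₄ d ≡ ρ s
    ρ₄d = trans (frame₄ d (below d<b) (≢-sym s≢d)) (trans ρ₃d
      (cong₂ _+_ (trans (frame₂ d (below d<b)) ρ₁d) ρ₂s))

    frame : ∀ u → u < b → u ≢ d → ρ₄ u ≡ ρ u
    frame u u<b u≢d with u ≟ s
    ... | yes refl =
      trans ρ₄s (trans (cong₂ _+_ ρ₃s (trans ρ₃t (cong₂ _+_ ρ₂t ρ₂s))) refl)
    ... | no u≢s =
      trans (frame₄ u (below u<b) u≢s) (trans (frame₃ u u≢s u≢d (below u<b))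
        (trans (frame₂ u (below u<b)) (frame₁ u u≢d)))

  -- The inputs must survive until the end of the computation: they stay below the scratch registers
  -- and differ from the output register, which a recursion overwrites at every pass.
  Fits : ∀ {n} → Vec ℕ n → ℕ → ℕ → Set
  Fits ins out b = ∀ i → lookup ins i < b × lookup ins i ≢ out

  rec-fits : ∀ {n} {ins : Vec ℕ n} {out b} → Fits ins out b → out < b →
    Fits (1 + b ∷ out ∷ ins) (2 + b) (3 + b)
  rec-fits fits out<b zero          = m<n⇒m<1+n ≤-refl , <⇒≢ ≤-refl
  rec-fits fits out<b (suc zero)    = m≤n⇒m≤o+n 3 out<b , <⇒≢ (m≤n⇒m≤o+n 2 out<b)
  rec-fits fits out<b (suc (suc i)) =
    m≤n⇒m≤o+n 3 (proj₁ (fits i)) , <⇒≢ (m≤n⇒m≤o+n 2 (proj₁ (fits i)))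

  module _ {n} {g : PR q n} {h : PR q (2 + n)} {ins : Vec ℕ n} {out b} (fits : Fits ins out b)
    (out<b : out < b)
    (ns : Vec ℕ n) (step-sets : ∀ ρ →
      Sets (toCode h (1 + b ∷ out ∷ ins) (2 + b) (3 + b)) (3 + b) ρ (2 + b)
      (evalPR xs h (Vec.map ρ (1 + b ∷ out ∷ ins)))) where

    private
      value : ℕ → ℕ
      value k = evalPR xs (rec g h) (k ∷ ns)

      body : Code q
      body = toCode h (1 + b ∷ out ∷ ins) (2 + b) (3 + b) ⨾ copy (2 + b) out (3 + b) ⨾ inc (1 + b)

    body-exec : ∀ i ρ → ρ (1 + b) ≡ i → ρ out ≡ value i → Vec.map ρ ins ≡ ns → ∃ λ ρ′ →
      Exec xs body ρ ρ′ × ρ′ (1 + b) ≡ suc i × ρ′ out ≡ value (suc i) ×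
      (∀ u → u ≤ b → u ≢ out → ρ′ u ≡ ρ u)
    body-exec i ρ ρi ρout ρins with step-sets ρ
    ... | ρ₁ , e₁ , v₁ , frame₁
      with copy-sets {2 + b} {out} {3 + b} {3 + b} (≢-sym (<⇒≢ (m≤n⇒m≤o+n 2 out<b))) ≤-refl
        (m≤n⇒m≤o+n 3 out<b) ≤-refl ρ₁
    ... | ρ₂ , e₂ , v₂ , frame₂ = _ , e₁ ⨾ e₂ ⨾ inc
      , trans (↦-≡ ρ₂ (1 + b) _)
        (cong suc (trans (frame₂ (1 + b) (m<n⇒m<1+n ≤-refl) (≢-sym (<⇒≢ (m<n⇒m<1+n out<b))))
          (trans (frame₁ (1 + b) (m<n⇒m<1+n ≤-refl) (<⇒≢ ≤-refl)) ρi)))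
      , trans (↦-≢ ρ₂ _ (<⇒≢ (m<n⇒m<1+n out<b))) (trans v₂ (trans v₁ (cong (evalPR xs h)
          (cong₂ _∷_ ρi (cong₂ _∷_ ρout ρins)))))
      , λ u u≤b u≢out → trans (↦-≢ ρ₂ _ (<⇒≢ (s≤s u≤b)))
          (trans (frame₂ u (m≤n⇒m≤o+n 2 (s≤s u≤b)) u≢out)
                 (frame₁ u (m≤n⇒m≤o+n 2 (s≤s u≤b)) (<⇒≢ (m≤n⇒m≤o+n 1 (s≤s u≤b)))))

    -- The loop invariant: `i` passes are done, `c` remain, and `out` holds the value at `i`. The
    -- inputs are untouched because `Fits` keeps them away from `b` and `out`.
    iterate : ∀ c i ρ → ρ b ≡ c → ρ (1 + b) ≡ i → ρ out ≡ value i → Vec.map ρ ins ≡ ns → ∃ λ ρ′ →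
      Exec xs (while b body) ρ ρ′ × ρ′ out ≡ value (c + i) × (∀ u → u < b → u ≢ out → ρ′ u ≡ ρ u)
    iterate zero    i ρ ρb ρi ρout ρins = ρ , exit ρb , ρout , λ _ _ _ → refl
    iterate (suc c) i ρ ρb ρi ρout ρins
      with body-exec i (ρ [ b ↦ c ]) (trans (↦-≢ ρ c (≢-sym (<⇒≢ ≤-refl))) ρi)
        (trans (↦-≢ ρ c (<⇒≢ out<b)) ρout)
             (trans (map-agree ins λ i → ↦-≢ ρ c (<⇒≢ (proj₁ (fits i)))) ρins)
    ... | ρ₁ , e₁ , i₁ , out₁ , frame₁
      with iterate c (suc i) ρ₁ (trans (frame₁ b ≤-refl (≢-sym (<⇒≢ out<b))) (↦-≡ ρ b c)) i₁ out₁
             (trans (map-agree ins λ i → trans (frame₁ _ (<⇒≤ (proj₁ (fits i))) (proj₂ (fits i)))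
                                               (↦-≢ ρ c (<⇒≢ (proj₁ (fits i))))) ρins)
    ... | ρ₂ , e₂ , out₂ , frame₂ = ρ₂ , loop ρb e₁ e₂ , trans out₂ (cong value (+-suc c i))
      , λ u u<b u≢out → trans (frame₂ u u<b u≢out)
        (trans (frame₁ u (<⇒≤ u<b) u≢out) (↦-≢ ρ c (<⇒≢ u<b)))

  toCode-sets : ∀ {n} (f : PR q n) {ins out b} → Fits ins out b → out < b → ∀ ρ →
    Sets (toCode f ins out b) b ρ out (evalPR xs f (Vec.map ρ ins))

  toCodes-sets : ∀ {m n} (gs : Vec (PR q n) m) {ins o b} → (∀ i → lookup ins i < o) → m + o ≤ b →
    ∀ ρ →
    ∃ λ ρ′ → Exec xs (toCodes gs ins o b) ρ ρ′ ×
    (∀ i → ρ′ (toℕ i + o) ≡ lookup (evalPRs xs gs (Vec.map ρ ins)) i) × (∀ u → u < o → ρ′ u ≡ ρ u)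

  toCode-sets zero {out = out} fits out<b ρ with clear-exec ρ out
  ... | ρ′ , e , z , frame = ρ′ , e , z , λ u _ u≢out → frame u u≢out
  toCode-sets suc {r ∷ []} {out} fits out<b ρ
    with copy-sets (proj₂ (fits zero)) (proj₁ (fits zero)) out<b ≤-refl ρ
  ... | ρ′ , e , v , frame = _ , e ⨾ inc , trans (↦-≡ ρ′ out _) (cong suc v)
      , λ u u<b u≢out → trans (↦-≢ ρ′ _ u≢out) (frame u u<b u≢out)
  toCode-sets (proj i) {ins} {out} {b} fits out<b ρ =
    subst (Sets (copy (lookup ins i) out b) b ρ out) (sym (lookup-map i ρ ins))
      (copy-sets (proj₂ (fits i)) (proj₁ (fits i)) out<b ≤-refl ρ)
  toCode-sets (oracle j) {r ∷ []} {out} fits out<b ρ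
    with copy-sets (proj₂ (fits zero)) (proj₁ (fits zero)) out<b ≤-refl ρ
  ... | ρ′ , e , v , frame = _ , e ⨾ query , trans (↦-≡ ρ′ out _) (cong (lookup xs j) v)
      , λ u u<b u≢out → trans (↦-≢ ρ′ _ u≢out) (frame u u<b u≢out)
  toCode-sets (comp {m} f gs) {ins} {out} {b} fits out<b ρ
    with toCodes-sets gs (proj₁ ∘ fits) ≤-refl ρ
  ... | ρ₁ , e₁ , vs , frame₁
    with toCode-sets f {Vec.tabulate λ i → toℕ i + b} {out} {m + b}
           (λ i → subst (λ r → r < m + b × r ≢ out) (sym (lookup∘tabulate _ i))
             (+-monoˡ-< b (toℕ<n i) , ≢-sym (<⇒≢ (<-≤-trans out<b (m≤n+m b (toℕ i))))))
           (<-≤-trans out<b (m≤n+m b m)) ρ₁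
  ... | ρ₂ , e₂ , v , frame₂ = ρ₂ , e₁ ⨾ e₂ , trans v (cong (evalPR xs f) args)
      , λ u u<b u≢out → trans (frame₂ u (<-≤-trans u<b (m≤n+m b m)) u≢out) (frame₁ u u<b)
    where
    args : Vec.map ρ₁ (Vec.tabulate λ i → toℕ i + b) ≡ evalPRs xs gs (Vec.map ρ ins)
    args = trans (sym (tabulate-∘ ρ₁ _)) (trans (tabulate-cong vs) (tabulate∘lookup _))
  toCode-sets (rec g h) {r ∷ ins} {out} {b} fits out<b ρ
    with copy-sets {r} {b} {1 + b} {1 + b} (<⇒≢ (proj₁ (fits zero)))
      (m<n⇒m<1+n (proj₁ (fits zero))) ≤-refl ≤-refl ρ
  ... | ρ₁ , e₁ , v₁ , frame₁
    with clear-exec ρ₁ (1 + b)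
  ... | ρ₂ , e₂ , v₂ , frame₂
    with toCode-sets g {ins} {out} {3 + b}
      (λ i → m≤n⇒m≤o+n 3 (proj₁ (fits (suc i))) , proj₂ (fits (suc i)))
           (m≤n⇒m≤o+n 3 out<b) ρ₂
  ... | ρ₃ , e₃ , v₃ , frame₃
    with iterate (fits ∘ suc) out<b (Vec.map ρ ins)
      (toCode-sets h (rec-fits (fits ∘ suc) out<b) ≤-refl) (ρ r) 0 ρ₃
           (trans (frame₃ b (m≤n⇒m≤o+n 2 ≤-refl) (≢-sym (<⇒≢ out<b)))
             (trans (frame₂ b (<⇒≢ ≤-refl)) v₁))
           (trans (frame₃ (1 + b) (m<n⇒m<1+n ≤-refl) (≢-sym (<⇒≢ (m<n⇒m<1+n out<b)))) v₂)
           (trans v₃ (cong (evalPR xs g) ρ₂ins))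
           (trans (map-agree ins λ i →
             frame₃ _ (m≤n⇒m≤o+n 3 (proj₁ (fits (suc i)))) (proj₂ (fits (suc i)))) ρ₂ins)
    where
    ρ₂ins : Vec.map ρ₂ ins ≡ Vec.map ρ ins
    ρ₂ins = map-agree ins λ i → let r<b = proj₁ (fits (suc i)) in
      trans (frame₂ _ (<⇒≢ (m<n⇒m<1+n r<b))) (frame₁ _ (m<n⇒m<1+n r<b) (<⇒≢ r<b))
  ... | ρ₄ , e₄ , v₄ , frame₄ =
    ρ₄ , e₁ ⨾ e₂ ⨾ e₃ ⨾ e₄
      , trans v₄ (cong (λ k → evalPR xs (rec g h) (k ∷ Vec.map ρ ins)) (+-identityʳ (ρ r)))
    , λ u u<b u≢out → trans (frame₄ u u<b u≢out) (trans (frame₃ u (m≤n⇒m≤o+n 3 u<b) u≢out)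
        (trans (frame₂ u (<⇒≢ (m<n⇒m<1+n u<b))) (frame₁ u (m<n⇒m<1+n u<b) (<⇒≢ u<b))))

  toCodes-sets []       ins<o le ρ = ρ , skip , (λ ()) , λ _ _ → refl
  toCodes-sets {suc m} (g ∷ gs) {ins} {o} {b} ins<o le ρ
    with toCode-sets g {ins} {o} {b}
      (λ i → <-≤-trans (ins<o i) (≤-trans (m≤n+m o (suc m)) le) , <⇒≢ (ins<o i))
           (≤-trans (s≤s (m≤n+m o m)) le) ρ
  ... | ρ₁ , e₁ , v₁ , frame₁
    with toCodes-sets gs {ins} {suc o} {b} (λ i → m<n⇒m<1+n (ins<o i))
      (≤-trans (≤-reflexive (+-suc m o)) le) ρ₁
  ... | ρ₂ , e₂ , vs , frame₂ = ρ₂ , e₁ ⨾ e₂ , values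
      , λ u u<o → trans (frame₂ u (m<n⇒m<1+n u<o)) (below u u<o)
    where
    below : ∀ u → u < o → ρ₁ u ≡ ρ u
    below u u<o = frame₁ u (<-≤-trans u<o (≤-trans (m≤n+m o (suc m)) le)) (<⇒≢ u<o)

    values : ∀ i → ρ₂ (toℕ i + o) ≡ lookup (evalPRs xs (g ∷ gs) (Vec.map ρ ins)) i
    values zero    = trans (frame₂ o ≤-refl) v₁
    values (suc i) = trans (cong ρ₂ (sym (+-suc (toℕ i) o))) (trans (vs i)
      (cong (λ ns → lookup (evalPRs xs gs ns) i) (map-agree ins λ i → below _ (ins<o i))))

-- Search programs with a built-in parameter

commandCode : ∀ {q} → OracleCommand q → List ℕ
commandCode (basic (write t a s))        = 0 ∷ t ∷ a ∷ s ∷ []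
commandCode (basic (move leftward t s))  = 1 ∷ t ∷ s ∷ []
commandCode (basic (move rightward t s)) = 2 ∷ t ∷ s ∷ []
commandCode (basic (branch t a s s′))    = 3 ∷ t ∷ a ∷ s ∷ s′ ∷ []
commandCode (basic halt)                 = []
commandCode (query j t s)                = 4 ∷ toℕ j ∷ t ∷ s ∷ []

oracleCommand-code : ∀ {q} (c : OracleCommand q) → oracleCommand q (commandCode c) ≡ c
oracleCommand-code (basic (write t a s))        = refl
oracleCommand-code (basic (move leftward t s))  = refl
oracleCommand-code (basic (move rightward t s)) = refl
oracleCommand-code (basic (branch t a s s′))    = refl
oracleCommand-code (basic halt)                 = refl
oracleCommand-code {q} (query j t s) with toℕ j <? q
... | yes j<q = cong (λ i → query i t s) (fromℕ<-toℕ j j<q)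
... | no  j≮q = contradiction (toℕ<n j) j≮q

index : ∀ {q} → OracleProgram q → ℕ
index P = listCode (List.map (listCode ∘ commandCode) P)

machine-index : ∀ {q} (P : OracleProgram q) → machine q (index P) ≡ P
machine-index {q} P = trans
  (cong (List.map (λ c → oracleCommand q (sequence c)))
    (sequence-listCode (List.map (listCode ∘ commandCode) P)))
  (trans (sym (map-∘ P))
    (trans (map-cong (λ c → trans (cong (oracleCommand q) (sequence-listCode (commandCode c)))
    (oracleCommand-code c)) P) (map-id P)))

index-++ : ∀ {q} (P Q : OracleProgram q) →
  index (P ++ Q) ≡ List.foldr cons (index Q) (List.map (listCode ∘ commandCode) P)
index-++ P Q = trans (cong listCode (map-++ _ P Q)) (foldr-++ cons 0 (List.map _ P) _)

at-head : ∀ {q} {P : OracleProgram q} {a c cs} → At P a (c ∷ cs) → fetch (basic halt) P a ≡ c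
at-head (eq ∷ _) = eq

module _ {q : ℕ} where

  incs : ℕ → ℕ → Code q
  incs r zero    = skip
  incs r (suc n) = inc r ⨾ incs r n

  incs-exec : ∀ {xs} r n ρ → ∃ λ ρ′ → Exec xs (incs r n) ρ ρ′ × ρ′ r ≡ ρ r + n ×
    (∀ u → u ≢ r → ρ′ u ≡ ρ u)
  incs-exec r zero    ρ = ρ , skip , sym (+-identityʳ (ρ r)) , λ _ _ → refl
  incs-exec r (suc n) ρ with incs-exec r n (ρ [ r ↦ suc (ρ r) ])
  ... | ρ′ , e , eq , frame = ρ′ , inc ⨾ e
      , trans eq (trans (cong (_+ n) (↦-≡ ρ r _)) (sym (+-suc (ρ r) n)))
      , λ u u≢r → trans (frame u u≢r) (↦-≢ ρ _ u≢r)

  -- Search for the least positive k with f (i, s, k) > 0, where register 0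
  -- holds i and register 1 holds s, and output f (i, s, k) - 1.
  module Search {f : Vec 𝒩 q → Vec ℕ 3 → ℕ} (F : Definable f) where

    arguments : Vec ℕ 3
    arguments = 0 ∷ 1 ∷ 2 ∷ []

    notFoundD : Definable (λ xs ns → ifz (f xs ns) 1 0)
    notFoundD = ifzD F (constD 1) (constD 0)

    valueD : Definable (λ xs ns → pred (f xs ns))
    valueD = predD F

    -- The counter goes up before the test, so 0 is never tried.
    try : Code q
    try = inc 2 ⨾ toCode (notFoundD .term) arguments 3 5

    deliver : Code q
    deliver = toCode (valueD .term) arguments 4 5 ⨾ copy 4 0 5

    search : Code q
    search = inc 3 ⨾ while 3 try ⨾ deliver

    -- Command 0 is the jump to the loader; `search` starts at 1 and is followed by a single halt.
    loaderStart : ℕ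
    loaderStart = 2 + size search

    loader : ℕ → ℕ → OracleProgram q
    loader s a = compile (incs 1 s) a ++ jump 1 ∷ []

    front : OracleProgram q
    front = jump loaderStart ∷ (compile search 1 ++ basic halt ∷ [])

    -- Only the loader depends on `s`, and it stands last: the addresses in `front` are fixed, and
    -- by `index-++` the index is a fixed stack of `cons` on the index of the loader. This makes
    -- `searchIndex` primitive recursive.
    searchProgram : ℕ → OracleProgram q
    searchProgram s = front ++ loader s loaderStart

    opaque

      searchIndex : ℕ → ℕ
      searchIndex s = index (searchProgram s)

      searchIndex-def : ∀ s → searchIndex s ≡ index (searchProgram s)
      searchIndex-def s = refl

    loaderBlock : ℕ → ℕ → ℕ
    loaderBlock a n = cons (listCode (0 ∷ 1 ∷ 1 ∷ suc a ∷ []))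
      (cons (listCode (1 ∷ 1 ∷ suc (suc a) ∷ [])) n)

    -- Each increment compiles to two commands, so the block numbered j starts at address
    -- `j + j + a`.
    index-loader : ∀ s a → index (loader s a) ≡
      fold (index {q} (jump 1 ∷ [])) (λ j → loaderBlock (j + j + a)) s
    index-loader zero    a = refl
    index-loader (suc s) a = trans (cong (loaderBlock a) (trans (index-loader s (2 + a))
      (fold-cong s λ j r → cong (λ b → loaderBlock b r) (shift j))))
      (sym (fold-suc (index {q} (jump 1 ∷ [])) (λ j → loaderBlock (j + j + a)) s))
      where
      shift : ∀ j → j + j + (2 + a) ≡ suc j + suc j + a
      shift j = trans (+-suc (j + j) (suc a))
        (cong suc (trans (+-suc (j + j) a) (cong (_+ a) (sym (+-suc j j)))))

    searchIndexD : ∀ {q′ n} {g : Vec 𝒩 q′ → Vec ℕ n → ℕ} → Definable g →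
      Definable (λ xs ns → searchIndex (g xs ns))
    searchIndexD = app₁ (λ _ → searchIndex)
      (convD (prepend (List.map (listCode ∘ commandCode) front)
        (foldD (constD (index {q} (jump 1 ∷ []))) blockD (varD v0)))
      λ xs ns → trans (cong (λ n → List.foldr cons n (List.map (listCode ∘ commandCode) front))
        (sym (index-loader (lookup ns v0) loaderStart)))
        (trans (sym (index-++ front (loader (lookup ns v0) loaderStart)))
          (sym (searchIndex-def (lookup ns v0)))))
      where
      prepend : ∀ {q n} l {g : Vec 𝒩 q → Vec ℕ n → ℕ} → Definable g →
        Definable (λ xs ns → List.foldr cons (g xs ns) l)
      prepend []      d = d
      prepend (a ∷ l) d = consD (constD a) (prepend l d)

      blockD : ∀ {q n} → Definable (λ (_ : Vec 𝒩 q) (ns : Vec ℕ (2 + n)) →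
        loaderBlock (lookup ns v0 + lookup ns v0 + loaderStart) (lookup ns v1))
      blockD = consD (consD (constD 0)
        (consD (constD 1) (consD (constD 1) (consD (sucD position) zeroD))))
        (consD (consD (constD 1) (consD (constD 1) (consD (sucD (sucD position)) zeroD))) (varD v1))
        where position = +D (+D (varD v0) (varD v0)) (constD loaderStart)

    -- Every increment in the loader adds at least 1 to the index. This is what lets the witness
    -- serve as a number of steps: it is at least the halting time recorded in the state.
    n≤searchIndex : ∀ s → s ≤ searchIndex s
    n≤searchIndex s = ≤-trans (loader≥ s loaderStart)
      (≤-trans (foldr≥ (List.map (listCode ∘ commandCode) front))
      (≤-reflexive (trans (sym (index-++ front (loader s loaderStart))) (sym (searchIndex-def s)))))
      where
      foldr≥ : ∀ l {n} → n ≤ List.foldr cons n l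
      foldr≥ []      = ≤-refl
      foldr≥ (a ∷ l) = ≤-trans (foldr≥ l) (m≤n⇒m≤1+n (b≤pair a _))

      loader≥ : ∀ s a → s ≤ index (loader s a)
      loader≥ zero    a = z≤n
      loader≥ (suc s) a = s≤s
        (≤-trans (loader≥ s (2 + a)) (≤-trans (m≤n⇒m≤1+n (b≤pair _ _)) (b≤pair _ _)))

    -- All that execution uses of the program. Arguing about an arbitrary `P` with this layout keeps
    -- the concrete program from being unfolded.
    record Layout (P : OracleProgram q) (s : ℕ) : Set where
      field
        at-jump   : fetch (basic halt) P 0 ≡ jump loaderStart
        at-search : At P 1 (compile search 1)
        at-halt   : fetch (basic halt) P (size search + 1) ≡ basic halt
        at-loader : At P loaderStart (loader s loaderStart)

    layout : ∀ s → Layout (searchProgram s) s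
    layout s with subst (λ Q → At Q 0 (searchProgram s)) (++-identityʳ (searchProgram s))
      (At-infix [] (searchProgram s))
    ... | whole with At-++ front whole
    ... | atJump ∷ rest , atLoader with At-++ (compile search 1) rest
    ... | atSearch , atHalt ∷ [] = record
      { at-jump   = atJump
      ; at-search = atSearch
      ; at-halt   = subst (λ n → fetch (basic halt) (searchProgram s) (n + 1) ≡ basic halt)
        (length-compile search 1) atHalt
      ; at-loader = subst (λ n → At (searchProgram s) n (loader s loaderStart))
          (trans (+-identityʳ (length front)) length-front) atLoader
      }
      where
      length-front : length front ≡ loaderStart
      length-front = cong suc (trans (length-++ (compile search 1))
        (trans (cong (_+ 1) (length-compile search 1)) (+-comm (size search) 1)))

    module _ {P : OracleProgram q} {s : ℕ} (L : Layout P s) (machine≡ : machine q (searchIndex s) ≡ P) (xs : Vec 𝒩 q) (i : ℕ) where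

      open Layout L

      private
        begin₀ : Config
        begin₀ = initial (i ∷ [])

        loaded : ∃ λ ρ → Reaches P xs begin₀ 1 ρ × ρ 0 ≡ i × ρ 1 ≡ s × ρ 2 ≡ 0 × ρ 3 ≡ 0
        loaded with incs-exec {xs} 1 s ((λ _ → 0) [ 0 ↦ i ])
        ... | ρ , e , eq , frame = ρ
          , reaches-trans P xs (jump-reaches P xs at-jump represented) (λ Ts rep →
              reaches-trans P xs (compile-correct P xs e
                (proj₁ (At-++ (compile (incs 1 s) loaderStart) at-loader)) rep) λ Ts rep →
                jump-reaches P xs (subst (λ n → fetch (basic halt) P (n + loaderStart) ≡ jump 1)
                  (length-compile (incs 1 s) loaderStart)
                    (at-head (proj₂ (At-++ (compile (incs 1 s) loaderStart) at-loader)))) rep)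
          , frame 0 (λ ()) , eq , frame 2 (λ ()) , frame 3 (λ ())
          where
          represented : Represents (tapes begin₀) ((λ _ → 0) [ 0 ↦ i ])
          represented zero    = holds-numerals i
          represented (suc u) = holds-blank

        Trying : ℕ → Registers → Set
        Trying k ρ = ρ 0 ≡ i × ρ 1 ≡ s × ρ 2 ≡ k

        tryRegisters : Registers → Registers
        tryRegisters ρ = ρ [ 3 ↦ 0 ] [ 2 ↦ suc (ρ 2) ]

        fits : ∀ {o} → o ≢ 0 → o ≢ 1 → o ≢ 2 → Fits xs arguments o 5
        fits 0≢ 1≢ 2≢ zero          = s≤s z≤n , ≢-sym 0≢
        fits 0≢ 1≢ 2≢ (suc zero)    = s≤s (s≤s z≤n) , ≢-sym 1≢
        fits 0≢ 1≢ 2≢ (suc (suc zero)) = s≤s (s≤s (s≤s z≤n)) , ≢-sym 2≢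

        try-exec : ∀ {k} ρ → Trying k ρ → ∃ λ ρ′ → Exec xs try (ρ [ 3 ↦ 0 ]) ρ′ ×
          Trying (suc k) ρ′ ×
          ρ′ 3 ≡ ifz (f xs (i ∷ s ∷ suc k ∷ [])) 1 0
        try-exec ρ (refl , refl , refl)
          with toCode-sets xs (notFoundD .term) {arguments} {3} {5} (fits (λ ()) (λ ()) (λ ()))
            (s≤s (s≤s (s≤s (s≤s z≤n)))) (tryRegisters ρ)
        ... | ρ′ , e , v , frame = ρ′ , inc ⨾ e
          , (frame 0 (s≤s z≤n) (λ ()) , frame 1 (s≤s (s≤s z≤n)) (λ ())
            , frame 2 (s≤s (s≤s (s≤s z≤n))) (λ ()))
          , trans v (notFoundD .correct xs (ρ 0 ∷ ρ 1 ∷ suc (ρ 2) ∷ []))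

        -- `d` bounds the number of further failures. The search may stop before the given success,
        -- and with another value, so only some success is asserted; callers identify the value by
        -- soundness.
        while-exec : ∀ d {k} ρ {v} → Trying k ρ → ρ 3 ≡ 1 →
          f xs (i ∷ s ∷ suc (k + d) ∷ []) ≡ suc v →
          ∃₂ λ ρ′ k′ → ∃ λ v′ → Exec xs (while 3 try) ρ ρ′ × Trying k′ ρ′ ×
            f xs (i ∷ s ∷ k′ ∷ []) ≡ suc v′
        while-exec d {k} ρ trying flag found with try-exec ρ trying
        ... | ρ′ , e , trying′ , flag′ with f xs (i ∷ s ∷ suc k ∷ []) in eq
        ... | suc v′ = ρ′ , suc k , v′ , loop flag e (exit flag′) , trying′ , eq
        while-exec zero    {k} ρ trying flag found | ρ′ , e , trying′ , flag′ | zero =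
          contradiction (trans (sym eq)
            (trans (cong (λ m → f xs (i ∷ s ∷ suc m ∷ [])) (sym (+-identityʳ k))) found)) λ ()
        while-exec (suc d) {k} ρ trying flag found | ρ′ , e , trying′ , flag′ | zero
          with while-exec d ρ′ trying′ flag′
            (trans (cong (λ m → f xs (i ∷ s ∷ suc m ∷ [])) (sym (+-suc k d))) found)
        ... | ρ″ , k″ , v″ , e′ , trying″ , found″ =
          ρ″ , k″ , v″ , loop flag e e′ , trying″ , found″

        deliver-exec : ∀ {k v} ρ → Trying k ρ → f xs (i ∷ s ∷ k ∷ []) ≡ suc v → ∃ λ ρ′ →
          Exec xs deliver ρ ρ′ × ρ′ 0 ≡ v
        deliver-exec ρ (refl , refl , refl) found
          with toCode-sets xs (valueD .term) {arguments} {4} {5}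
            (fits (λ ()) (λ ()) (λ ())) ≤-refl ρ
        ... | ρ₁ , e₁ , v₁ , _
          with copy-sets xs {4} {0} {5} {5} (λ ()) ≤-refl (s≤s z≤n) ≤-refl ρ₁
        ... | ρ₂ , e₂ , v₂ , _ = ρ₂ , e₁ ⨾ e₂
          , trans v₂ (trans v₁ (trans (valueD .correct xs (ρ 0 ∷ ρ 1 ∷ ρ 2 ∷ []))
            (cong pred found)))

        outputs : ∀ {v} → (∃ λ ρ → Reaches P xs begin₀ (size search + 1) ρ × ρ 0 ≡ v) →
          Φ xs (searchIndex s) (i ∷ []) v
        outputs {v} (ρ , (k , Ts , r , rep) , eq) = k , subst
          (λ Q → command Q xs (run Q xs k begin₀) ≡ basic halt × output (run Q xs k begin₀) ≡ v)
          (sym machine≡)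
          (trans (cong (command P xs) r) at-halt
            , trans (cong output r) (trans (number-holds (rep 0)) eq))

        started : ∃ λ ρ → Reaches P xs begin₀ 3 ρ × Trying 0 ρ × ρ 3 ≡ 1
        started with loaded
        ... | ρ , reach , ρ0 , ρ1 , ρ2 , ρ3 = ρ [ 3 ↦ suc (ρ 3) ]
          , reaches-trans P xs reach
            (λ Ts rep → compile-correct P xs (inc {r = 3})
              (proj₁ (At-++ (compile (inc 3) 1) at-search)) rep)
          , (ρ0 , ρ1 , ρ2) , cong suc ρ3

        at-while : At P 3 (compile (while 3 try) 3)
        at-while = proj₁ (At-++ (compile (while 3 try) 3)
          (proj₂ (At-++ (compile (inc 3) 1) at-search)))

        -- A halted configuration stays as it is, so divergence follows once the run is found at the
        -- loop entry at arbitrarily late times.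
        loops : (∀ k → f xs (i ∷ s ∷ k ∷ []) ≡ 0) → ∀ n → ∃₂ λ t Ts → ∃ λ ρ →
          n ≤ t × run P xs t begin₀ ≡ config 3 Ts × Represents Ts ρ × Trying n ρ × ρ 3 ≡ 1
        loops none zero with started
        ... | ρ , (t , Ts , r , rep) , trying , flag = t , Ts , ρ , z≤n , r , rep , trying , flag
        loops none (suc n) with loops none n
        ... | t , Ts , ρ , n≤t , r , rep , trying , flag with try-exec ρ trying
        ... | ρ′ , e , trying′
          , flag′ with while-continue P xs {3} {try} {3} {Ts} at-while rep flag e
        -- A pass takes at least one step: without any, tape 2 would hold both `n` and `suc n`.
        ... | zero , .Ts , refl , rep′ = contradiction
          (trans (sym (proj₂ (proj₂ trying)))
            (trans (sym (number-holds (rep 2)))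
              (trans (number-holds (rep′ 2)) (proj₂ (proj₂ trying′)))))
          (<⇒≢ ≤-refl)
        ... | suc k , Ts′ , r′ , rep′ = t + suc k , Ts′ , ρ′
          , ≤-trans (s≤s (≤-trans n≤t (m≤m+n t k))) (≤-reflexive (sym (+-suc t k)))
          , trans (run-+ P xs t (suc k) begin₀) (trans (cong (run P xs (suc k)) r) r′)
          , rep′ , trying′ , trans flag′ (cong (λ m → ifz m 1 0) (none (suc n)))

      layout-finds : ∀ {k v} → f xs (i ∷ s ∷ suc k ∷ []) ≡ suc v →
        ∃₂ λ k′ v′ → f xs (i ∷ s ∷ k′ ∷ []) ≡ suc v′ × Φ xs (searchIndex s) (i ∷ []) v′
      layout-finds {k} found with loaded
      ... | ρ , reach , ρ0 , ρ1 , ρ2 , ρ3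
        with while-exec k (ρ [ 3 ↦ suc (ρ 3) ]) (ρ0 , ρ1 , ρ2) (cong suc ρ3) found
      ... | ρ₁ , k′ , v′ , e₁ , trying , found′ with deliver-exec ρ₁ trying found′
      ... | ρ₂ , e₂ , eq = k′ , v′ , found′
        , outputs (ρ₂ , reaches-trans P xs reach
          (λ Ts rep → compile-correct P xs (inc ⨾ e₁ ⨾ e₂) at-search rep) , eq)

      layout-diverges : ∀ {v} → (∀ k → f xs (i ∷ s ∷ k ∷ []) ≡ 0) →
        ¬ Φ xs (searchIndex s) (i ∷ []) v
      layout-diverges none (n , halts , _) with loops none n
      ... | t , Ts , ρ , n≤t , r , _ = contradiction
        (trans (sym halted) (trans (cong (command P xs) r) (at-head at-while))) λ ()
        where
        c : Config
        c = run P xs n begin₀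

        halts′ : command P xs c ≡ basic halt
        halts′ = subst (λ Q → command Q xs (run Q xs n begin₀) ≡ basic halt) machine≡ halts

        halted : command P xs (run P xs t begin₀) ≡ basic halt
        halted = subst (λ m → command P xs (run P xs m begin₀) ≡ basic halt) (m+[n∸m]≡n n≤t)
          (trans (cong (command P xs)
            (trans (run-+ P xs n (t ∸ n) begin₀) (run-halted P xs (t ∸ n) c halts′))) halts′)

    machine-searchIndex : ∀ s → machine q (searchIndex s) ≡ searchProgram s
    machine-searchIndex s =
      trans (cong (machine q) (searchIndex-def s)) (machine-index (searchProgram s))

    opaque

      search-finds : ∀ xs i s {k v} → f xs (i ∷ s ∷ suc k ∷ []) ≡ suc v →
        ∃₂ λ k′ v′ → f xs (i ∷ s ∷ k′ ∷ []) ≡ suc v′ × Φ xs (searchIndex s) (i ∷ []) v′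
      search-finds xs i s = layout-finds (layout s) (machine-searchIndex s) xs i

      search-diverges : ∀ xs i s {v} → (∀ k → f xs (i ∷ s ∷ k ∷ []) ≡ 0) →
        ¬ Φ xs (searchIndex s) (i ∷ []) v
      search-diverges xs i s = layout-diverges (layout s) (machine-searchIndex s) xs i

-- Indices of definitions, and the predicate T

module _ {q : ℕ} where

  infix 4 _≈PR_
  _≈PR_ : ∀ {n} → PR q n → PR q n → Set
  d ≈PR d′ = ∀ xs ns → evalPR xs d ns ≡ evalPR xs d′ ns

  definition-listCode : ∀ {n} k (d : PR q n) l → definition′ k l q n ≈PR d →
    definition′ k (sequence (listCode l)) q n ≈PR d
  definition-listCode {n} k d l =
    subst (λ m → definition′ k m q n ≈PR d) (sym (sequence-listCode l))

  -- The bound is quantified because a subdefinition is decoded with the bound left over from the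
  -- definition around it, which exceeds what its own code would give.
  definitionCode : ∀ {n} (d : PR q n) → ∃ λ l → ∀ k → listCode l ≤ k → definition′ k l q n ≈PR d

  definitionCodes : ∀ {n m} (ds : Vec (PR q n) m) → ∃ λ l → Σ (length l ≡ m) λ eq → ∀ k →
    listCode l ≤ k →
    ∀ xs ns → evalPRs xs (subst (Vec (PR q n)) eq
      (Vec.map (λ g → definition′ k (sequence g) q n) (fromList l))) ns
            ≡ evalPRs xs ds ns

  -- `zero` has no tag of its own; the empty sequence falls through to the default clause.
  definitionCode zero       = [] , λ { zero _ xs ns → refl ; (suc k) _ xs ns → refl }
  definitionCode suc        = 1 ∷ [] , λ { (suc k) _ xs (n ∷ []) → refl }
  definitionCode {n} (proj i) = 2 ∷ toℕ i ∷ [] , λ { (suc k) _ → decoded k }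
    where
    decoded : ∀ k → definition′ (suc k) (2 ∷ toℕ i ∷ []) q n ≈PR proj i
    decoded k xs ns with toℕ i <? n
    ... | yes i<n = cong (lookup ns) (fromℕ<-toℕ i i<n)
    ... | no  i≮n = contradiction (toℕ<n i) i≮n
  definitionCode (oracle j) = 3 ∷ toℕ j ∷ [] , λ { (suc k) _ → decoded k }
    where
    decoded : ∀ k → definition′ (suc k) (3 ∷ toℕ j ∷ []) q 1 ≈PR oracle j
    decoded k xs (m ∷ []) with toℕ j <? q
    ... | yes j<q = cong (λ i → lookup xs i m) (fromℕ<-toℕ j j<q)
    ... | no  j≮q = contradiction (toℕ<n j) j≮q
  definitionCode (comp f gs) with definitionCodes gs
  ... | l , refl , gs≈ with definitionCode f
  ... | m , f≈ = 4 ∷ listCode m ∷ l , λ { (suc k) (s≤s le) xs ns →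
      let le′ = ≤-trans (b≤pair 4 _) le in
      trans (definition-listCode k f m (f≈ k (≤-trans (m≤n⇒m≤1+n (a≤pair _ _)) le′)) xs
              (evalPRs xs (Vec.map (λ g → definition′ k (sequence g) q _) (fromList l)) ns))
            (cong (evalPR xs f) (gs≈ k (≤-trans (m≤n⇒m≤1+n (b≤pair _ _)) le′) xs ns)) }
  definitionCode (rec g h) with definitionCode g | definitionCode h
  ... | l , g≈ | m , h≈ = 5 ∷ listCode l ∷ listCode m ∷ [] , λ { (suc k) (s≤s le) xs (i ∷ ns) → recursion k le xs ns i }
    where
    recursion : ∀ k → pair 5 (cons (listCode l) (cons (listCode m) 0)) ≤ k → ∀ xs ns i →
      evalPR xs (definition′ (suc k) (5 ∷ listCode l ∷ listCode m ∷ []) q _) (i ∷ ns) ≡ evalPR xs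
        (rec g h) (i ∷ ns)
    recursion k le xs ns zero    =
      definition-listCode k g l
        (g≈ k (≤-trans (m≤n⇒m≤1+n (a≤pair _ _)) (≤-trans (b≤pair 5 _) le))) xs ns
    recursion k le xs ns (suc i) = trans
      (definition-listCode k h m
        (h≈ k (≤-trans (m≤n⇒m≤1+n (≤-trans (m≤n⇒m≤1+n (a≤pair _ _)) (b≤pair _ _)))
          (≤-trans (b≤pair 5 _) le))) xs (i ∷ _ ∷ ns))
      (cong (λ r → evalPR xs h (i ∷ r ∷ ns)) (recursion k le xs ns i))

  definitionCodes []       = [] , refl , λ k _ xs ns → refl
  definitionCodes (d ∷ ds) with definitionCode d | definitionCodes ds
  ... | m , d≈ | l , refl , ds≈ = listCode m ∷ l , refl , λ k le xs ns → cong₂ _∷_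
    (definition-listCode k d m (d≈ k (≤-trans (m≤n⇒m≤1+n (a≤pair _ _)) le)) xs ns)
    (ds≈ k (≤-trans (m≤n⇒m≤1+n (b≤pair _ _)) le) xs ns)

  opaque
    definition-onto : ∀ {n} (d : PR q n) → ∃ λ i → definition q n i ≈PR d
    definition-onto d with definitionCode d
    ... | l , d≈ = listCode l , definition-listCode (listCode l) d l (d≈ (listCode l) ≤-refl)

-- Zero tests by χ, constant sequences, and the predicate `T`

module _ (em : ExcludedMiddle 0ℓ) where

  χ≡1⇒ : ∀ x → χ em x ≡ 1 → x ≗ 0𝒩
  χ≡1⇒ x eq with em {x ≗ 0𝒩}
  ... | yes x≗0 = x≗0

  ⇒χ≡1 : ∀ x → x ≗ 0𝒩 → χ em x ≡ 1
  ⇒χ≡1 x x≗0 with em {x ≗ 0𝒩}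
  ... | yes _   = refl
  ... | no x≢0 = contradiction x≗0 x≢0

  ≢⇒χ≡0 : ∀ x → ¬ (x ≗ 0𝒩) → χ em x ≡ 0
  ≢⇒χ≡0 x x≢0 with em {x ≗ 0𝒩}
  ... | yes x≗0 = contradiction x≗0 x≢0
  ... | no _    = refl

  -- Pointwise equal sequences give `em` two different propositions to decide, so the agreement of
  -- the decisions has to be argued.
  χ-cong : ∀ {x y} → x ≗ y → χ em x ≡ χ em y
  χ-cong {x} {y} eq with em {y ≗ 0𝒩}
  ... | yes y≗0 = ⇒χ≡1 x λ n → trans (eq n) (y≗0 n)
  ... | no y≢0  = ≢⇒χ≡0 x λ x≗0 → y≢0 λ n → trans (sym (eq n)) (x≗0 n)

  constant : ∀ {p q} → ℕ → PR𝒩 (suc p) q num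
  constant zero    = comp zero (projℕ zero ∷ []) []
  constant (suc c) = comp suc (constant c ∷ []) []

  successorIndex : ℕ
  successorIndex = proj₁ (definition-onto {1} {1} (comp suc (oracle zero ∷ [])))

  -- (n, m) ↦ the constant sequence n.  Every sequence-valued function of the
  -- class has some argument, whence the idle m.
  constantSequence : PR𝒩 2 0 baire
  constantSequence = rec𝒩 (comp theta (constant 0 ∷ []) [])
    (comp theta (constant successorIndex ∷ []) (proj𝒩 zero ∷ []))

  constant-eval : ∀ {p q} c ns (xs : Vec 𝒩 q) → eval em (constant {p} c) ns xs ≡ c
  constant-eval zero    ns xs = refl
  constant-eval (suc c) ns xs = cong suc (constant-eval c ns xs)

  constantSequence-eval : ∀ n m i → eval em constantSequence (n ∷ m ∷ []) [] i ≡ n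
  constantSequence-eval zero    m i = refl
  constantSequence-eval (suc n) m i =
    trans (cong (λ c → Θ c (y ∷ []) i) (constant-eval successorIndex (n ∷ m ∷ []) (y ∷ [])))
    (trans (proj₂ (definition-onto (comp suc (oracle zero ∷ []))) (y ∷ []) (i ∷ []))
           (cong suc (constantSequence-eval n m i)))
    where y = eval em constantSequence (n ∷ m ∷ []) []

  sequenceOf : ∀ {p q} → PR𝒩 p q num → PR𝒩 p q baire
  sequenceOf t = comp constantSequence (t ∷ t ∷ []) []

  add : ∀ {p q} → ℕ → PR𝒩 p q num → PR𝒩 p q num
  add zero    t = t
  add (suc c) t = comp suc (add c t ∷ []) []

  add-eval : ∀ {p q} c (t : PR𝒩 p q num) ns xs → eval em (add c t) ns xs ≡ c + eval em t ns xs
  add-eval zero    t ns xs = refl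
  add-eval (suc c) t ns xs = cong suc (add-eval c t ns xs)

  sequenceOf-add-eval : ∀ {p q} c (t : PR𝒩 p q num) ns xs i →
    eval em (sequenceOf (add c t)) ns xs i ≡ c + eval em t ns xs
  sequenceOf-add-eval c t ns xs i = trans (constantSequence-eval _ _ i) (add-eval c t ns xs)

  -- Three uses of one index e of a functional with oracles x, Y, Z: with Z
  -- constantly 0 it poses a question to χ, with Z constantly 1 + (the answer)
  -- it yields the next Y, and with Z constantly 3 + w it decides acceptance.
  -- Y is a constant sequence, since the class has no evaluation 𝒩 × ℕ → ℕ.
  answer : PR𝒩 2 2 num
  answer = comp chi [] (comp theta (projℕ v1 ∷ [])
    (proj𝒩 v0 ∷ proj𝒩 v1 ∷ sequenceOf (constant 0) ∷ []) ∷ [])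

  -- `definition` reads index 0 as `zero`, so the recursion starts from the constant sequence 0;
  -- state 0 therefore has to be the initial one.
  stage : PR𝒩 2 1 baire
  stage = rec𝒩 (comp theta (constant 0 ∷ []) (proj𝒩 zero ∷ []))
               (comp theta (projℕ v1 ∷ []) (proj𝒩 v0 ∷ proj𝒩 v1 ∷ sequenceOf (add 1 answer) ∷ []))

  -- χ is the only basic function that leads from 𝒩 to ℕ, so acceptance is phrased as the vanishing
  -- of a sequence. The simulation is run for `w` steps, `w` being the candidate itself.
  accept : PR𝒩 2 1 num
  accept = comp chi [] (comp theta (projℕ v0 ∷ [])
    (proj𝒩 v0 ∷ comp stage (projℕ v1 ∷ projℕ v0 ∷ []) (proj𝒩 v0 ∷ []) ∷
     sequenceOf (add 3 (projℕ v1)) ∷ []) ∷ [])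

  Accepts : Predicate 2 1
  Accepts ns xs = eval em accept ns xs ≡ 1

  χ-binary : ∀ x → χ em x ≢ 1 → χ em x ≡ 0
  χ-binary x ≢1 = ≢⇒χ≡0 x λ x≗0 → ≢1 (⇒χ≡1 x x≗0)

  accept-binary : ∀ ns xs → ¬ Accepts ns xs → eval em accept ns xs ≡ 0
  accept-binary (e ∷ w ∷ []) (x ∷ []) = χ-binary _

  Accepts-primitiveRecursive : PrimitiveRecursivePredicate em Accepts
  Accepts-primitiveRecursive = eval em accept , (accept , λ ns xs → refl) , λ ns xs →
    (λ t → t) , accept-binary ns xs

  -- What a particular machine contributes: three functions to be packed into one index and selected
  -- by the tag in `Z`.
  record Controller : Set where
    field
      question : 𝒩 → ℕ → 𝒩
      next     : ℕ → ℕ → ℕ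
      verdict  : ℕ → ℕ → ℕ

  open Controller public

  module Run (K : Controller) (x : 𝒩) where

    -- The question is put at every step; `next` uses the answer only if a zero test is due.
    state-at : ℕ → ℕ
    state-at zero    = 0
    state-at (suc k) = next K (state-at k) (χ em (question K x (state-at k)))

    module _ (D : PR 3 1)
      (D-question : ∀ Y Z i → Z 0 ≡ 0 → evalPR (x ∷ Y ∷ Z ∷ []) D (i ∷ []) ≡ question K x (Y 0) i)
      (D-next : ∀ Y Z i b → b ≤ 1 → Z 0 ≡ 1 + b →
        evalPR (x ∷ Y ∷ Z ∷ []) D (i ∷ []) ≡ next K (Y 0) b)
      (D-verdict : ∀ Y Z i w → Z 0 ≡ 3 + w → evalPR (x ∷ Y ∷ Z ∷ []) D (i ∷ []) ≡ verdict K (Y 0) w)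
      where

      private
        e : ℕ
        e = proj₁ (definition-onto D)

        Θ-e : ∀ xs i → Θ e xs i ≡ evalPR xs D (i ∷ [])
        Θ-e xs i = proj₂ (definition-onto D) xs (i ∷ [])

      χ≤1 : ∀ y → χ em y ≤ 1
      χ≤1 y with em {y ≗ 0𝒩}
      ... | yes _ = ≤-refl
      ... | no _  = z≤n

      -- The hypotheses on `D` mention `Y` and `Z` only at argument 0, so it is enough to know these
      -- sequences pointwise.
      stage-eval : ∀ k i → eval em stage (k ∷ e ∷ []) (x ∷ []) i ≡ state-at k

      answer-eval : ∀ k → eval em answer (k ∷ e ∷ [])
        (x ∷ eval em stage (k ∷ e ∷ []) (x ∷ []) ∷ []) ≡
        χ em (question K x (state-at k))
      answer-eval k = χ-cong λ i → trans (Θ-e _ i)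
        (trans (D-question Y _ i (constantSequence-eval 0 0 0))
          (cong (λ s → question K x s i) (stage-eval k 0)))
        where Y = eval em stage (k ∷ e ∷ []) (x ∷ [])

      stage-eval zero    i = refl
      stage-eval (suc k) i = trans (Θ-e _ i) (trans
        (D-next Y _ i _ (χ≤1 _)
          (trans (sequenceOf-add-eval 1 answer (k ∷ e ∷ []) (x ∷ Y ∷ []) 0)
            (cong suc (answer-eval k))))
        (cong (λ s → next K s (χ em (question K x (state-at k)))) (stage-eval k 0)))
        where Y = eval em stage (k ∷ e ∷ []) (x ∷ [])

      accepted : ∀ w i → Θ e (x ∷ eval em stage (w ∷ e ∷ []) (x ∷ []) ∷
        eval em (sequenceOf (add 3 (projℕ v1))) (e ∷ w ∷ []) (x ∷ []) ∷ []) i ≡ verdict K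
          (state-at w) w
      accepted w i = trans (Θ-e _ i) (trans
        (D-verdict Y _ i w (sequenceOf-add-eval 3 (projℕ v1) (e ∷ w ∷ []) (x ∷ []) 0))
        (cong (λ s → verdict K s w) (stage-eval w 0)))
        where Y = eval em stage (w ∷ e ∷ []) (x ∷ [])

      accepts⇒verdict : ∀ w → Accepts (e ∷ w ∷ []) (x ∷ []) → verdict K (state-at w) w ≡ 0
      accepts⇒verdict w t =
        trans (sym (accepted w 0)) (χ≡1⇒ (Θ e (x ∷ eval em stage (w ∷ e ∷ []) (x ∷ []) ∷
        eval em (sequenceOf (add 3 (projℕ v1))) (e ∷ w ∷ []) (x ∷ []) ∷ [])) t 0)

      verdict⇒accepts : ∀ w → verdict K (state-at w) w ≡ 0 → Accepts (e ∷ w ∷ []) (x ∷ [])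
      verdict⇒accepts w eq = ⇒χ≡1 _ λ i → trans (accepted w i) eq

-- Coded configurations and commands

-- The second component is itself a stream, that of the scanned cell and everything to its right.
tapeCode : Tape → ℕ
tapeCode (tape ls c rs) = pair (streamCode ls) (pair c (streamCode rs))

headCode leftCode rightCode numberCode numeralCode : ℕ → ℕ
headCode T    = fst (snd T)
leftCode T    = pair (snd (fst T)) (pair (fst (fst T)) (pair (headCode T) (snd (snd T))))
rightCode T   = pair (pair (headCode T) (fst T)) (snd (snd T))
numberCode T  = countOnes (fst T) + countOnes (snd T)
numeralCode n = pair 0 (pair 0 (natrec 0 (λ _ → pair 1) n))

setHeadCode : ℕ → ℕ → ℕ
setHeadCode T a = pair (fst T) (pair a (snd (snd T)))

module _ (ls : List ℕ) (c : ℕ) (rs : List ℕ) where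

  private T = tapeCode (tape ls c rs)

  left-tapeCode : fst T ≡ streamCode ls
  left-tapeCode = fst-pair _ _

  head-tapeCode : headCode T ≡ c
  head-tapeCode = trans (cong fst (snd-pair _ _)) (fst-pair _ _)

  right-tapeCode : snd (snd T) ≡ streamCode rs
  right-tapeCode = trans (cong snd (snd-pair _ _)) (snd-pair _ _)

setHead-tapeCode : ∀ T a → setHeadCode (tapeCode T) a ≡ tapeCode (record T { head = a })
setHead-tapeCode (tape ls c rs) a =
  cong₂ (λ l r → pair l (pair a r)) (left-tapeCode ls c rs) (right-tapeCode ls c rs)

move-leftCode : ∀ T → leftCode (tapeCode T) ≡ tapeCode (moveHead leftward T)
move-leftCode (tape ls c rs) rewrite left-tapeCode ls c rs | head-tapeCode ls c rs | right-tapeCode ls c rs = uncons ls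
  where
  uncons : ∀ ls → pair (snd (streamCode ls)) (pair (fst (streamCode ls)) (pair c (streamCode rs))) ≡
                  tapeCode (moveHead leftward (tape ls c rs))
  uncons []       = cong₂ (λ l h → pair l (pair h (pair c (streamCode rs)))) snd-0 fst-0
  uncons (l ∷ ls) = cong₂ (λ l h → pair l (pair h (pair c (streamCode rs)))) (snd-pair l _)
    (fst-pair l _)

move-rightCode : ∀ T → rightCode (tapeCode T) ≡ tapeCode (moveHead rightward T)
move-rightCode (tape ls c rs) rewrite left-tapeCode ls c rs | head-tapeCode ls c rs | right-tapeCode ls c rs = uncons rs
  where
  uncons : ∀ rs → pair (pair c (streamCode ls)) (streamCode rs) ≡ tapeCode
    (moveHead rightward (tape ls c rs))
  uncons []       = cong (pair _) (sym pair-0-0)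
  uncons (r ∷ rs) = refl

number-tapeCode : ∀ T → numberCode (tapeCode T) ≡ number T
number-tapeCode (tape ls c rs) = cong₂ _+_
  (trans (cong countOnes (fst-pair _ _)) (countOnes-streamCode ls))
  (trans (cong countOnes (snd-pair _ _)) (countOnes-streamCode (c ∷ rs)))

-- The blank that ends a numeral is a trailing zero and leaves no trace in the stream.
numeral-tapeCode : ∀ n → numeralCode n ≡ tapeCode (numerals (n ∷ []))
numeral-tapeCode n = cong (λ r → pair 0 (pair 0 r)) (trans (block n)
  (cong streamCode (sym (++-identityʳ (List.replicate n 1 ++ 0 ∷ [])))))
  where
  block : ∀ n → natrec 0 (λ _ → pair 1) n ≡ streamCode (List.replicate n 1 ++ 0 ∷ [])
  block zero    = sym pair-0-0
  block (suc n) = cong (pair 1) (block n)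

-- This lets one number code infinitely many tapes: those beyond the stream are blank.
blank-tapeCode : tapeCode (numerals []) ≡ 0
blank-tapeCode = trans (cong (pair 0) pair-0-0) pair-0-0

record Coded (c : ℕ) (C : Config) : Set where
  constructor coded
  field
    state≡ : fst c ≡ state C
    tapes≡ : ∀ t → nth (snd c) t ≡ tapeCode (tapes C t)

open Coded public

coded-pair : ∀ {s Ts C} → s ≡ state C → (∀ t → nth Ts t ≡ tapeCode (tapes C t)) →
  Coded (pair s Ts) C
coded-pair {s} {Ts} eq eqs = coded (trans (fst-pair s Ts) eq) λ t →
  trans (cong (λ l → nth l t) (snd-pair s Ts)) (eqs t)

update-replaceTape : ∀ {l Ts v T} t → (∀ u → nth l u ≡ tapeCode (Ts u)) → v ≡ tapeCode T →
  ∀ u → nth (update l t v) u ≡ tapeCode (replaceTape t T Ts u)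
update-replaceTape {l} {Ts} {v} {T} t eqs eq u with u ≟ t
... | yes refl = trans (nth-update-≡ l t v) (trans eq (cong tapeCode (sym (replaceTape-≡ t T Ts))))
... | no u≢t   = trans (nth-update-≢ l t v u≢t)
  (trans (eqs u) (cong tapeCode (sym (replaceTape-≢ T Ts u≢t))))

-- Operation numbers: 0 halt, 1 write, 2 left, 3 right, 4 branch; further on, 5 is a query or a
-- slave call, 6 the zero test, 7 the branch on the bit. Halting is 0 because entries beyond a
-- program read as 0.
stepState : (op a₁ a₂ a₃ a₄ s Ts : ℕ) → ℕ
stepState op a₁ a₂ a₃ a₄ s Ts =
  ifz (dist op 1) a₃ (ifz (dist op 2) a₂ (ifz (dist op 3) a₂
    (ifz (dist op 4) (ifz (dist (headCode (nth Ts a₁)) a₂) a₃ a₄) s)))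

stepTapes : (op a₁ a₂ Ts : ℕ) → ℕ
stepTapes op a₁ a₂ Ts =
  ifz (dist op 1) (update Ts a₁ (setHeadCode (nth Ts a₁) a₂))
    (ifz (dist op 2) (update Ts a₁ (leftCode (nth Ts a₁)))
      (ifz (dist op 3) (update Ts a₁ (rightCode (nth Ts a₁))) Ts))

opaque
  commandStep : (op a₁ a₂ a₃ a₄ c : ℕ) → ℕ
  commandStep op a₁ a₂ a₃ a₄ c =
    pair (stepState op a₁ a₂ a₃ a₄ (fst c) (snd c)) (stepTapes op a₁ a₂ (snd c))

  commandStep-def : ∀ op a₁ a₂ a₃ a₄ c → commandStep op a₁ a₂ a₃ a₄ c ≡
    pair (stepState op a₁ a₂ a₃ a₄ (fst c) (snd c)) (stepTapes op a₁ a₂ (snd c))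
  commandStep-def op a₁ a₂ a₃ a₄ c = refl

-- A relation, since fields that a command does not have may contain anything.
data BasicFields : Command → (op a₁ a₂ a₃ a₄ : ℕ) → Set where
  halt      : ∀ {a₁ a₂ a₃ a₄} → BasicFields halt 0 a₁ a₂ a₃ a₄
  write     : ∀ {t a s a₄} → BasicFields (write t a s) 1 t a s a₄
  leftward  : ∀ {t s a₃ a₄} → BasicFields (move leftward t s) 2 t s a₃ a₄
  rightward : ∀ {t s a₃ a₄} → BasicFields (move rightward t s) 3 t s a₃ a₄
  branch    : ∀ {t a s s′} → BasicFields (branch t a s s′) 4 t a s s′

opaque
  unfolding commandStep

  commandStep-coded : ∀ {b op a₁ a₂ a₃ a₄ c C} → BasicFields b op a₁ a₂ a₃ a₄ → Coded c C →
    Coded (commandStep op a₁ a₂ a₃ a₄ c) (perform b C)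
  commandStep-coded halt           (coded s≡ Ts≡) = coded-pair s≡ Ts≡
  commandStep-coded {C = C} (write {t} {a}) (coded s≡ Ts≡) = coded-pair refl
    (update-replaceTape t Ts≡
      (trans (cong (λ T → setHeadCode T a) (Ts≡ t)) (setHead-tapeCode (tapes C t) a)))
  commandStep-coded {C = C} (leftward {t}) (coded s≡ Ts≡) = coded-pair refl
    (update-replaceTape t Ts≡ (trans (cong leftCode (Ts≡ t)) (move-leftCode (tapes C t))))
  commandStep-coded {C = C} (rightward {t}) (coded s≡ Ts≡) = coded-pair refl
    (update-replaceTape t Ts≡ (trans (cong rightCode (Ts≡ t)) (move-rightCode (tapes C t))))
  commandStep-coded {C = C} (branch {t} {a} {s} {s′}) (coded s≡ Ts≡) = coded-pair
    (trans (cong (λ h → ifz (dist h a) s s′)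
      (trans (cong headCode (Ts≡ t))
        (head-tapeCode (Tape.left (tapes C t)) _ (Tape.right (tapes C t)))))
           (test (Tape.head (tapes C t)))) Ts≡
    where
    test : ∀ h → ifz (dist h a) s s′ ≡ (if does (h ≟ a) then s else s′)
    test h with h ≟ a
    ... | yes h≡a = trans (ifz-dist-≡ s s′ h≡a) (sym (if-yes (h ≟ a) h≡a))
    ... | no h≢a  = trans (ifz-dist-≢ s s′ h≢a) (sym (if-no (h ≟ a) h≢a))

data OracleFields {q} : OracleCommand q → (op a₁ a₂ a₃ a₄ : ℕ) → Set where
  basic : ∀ {b op a₁ a₂ a₃ a₄} → BasicFields b op a₁ a₂ a₃ a₄ →
    OracleFields (basic b) op a₁ a₂ a₃ a₄
  query : ∀ {j t s a₄} → OracleFields (query j t s) 5 (toℕ j) t s a₄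

sign : ℕ → ℕ
sign n = ifz n 0 1

-- The minimum of 6 and the length, as the n-th tail is nonzero iff the list has more than n
-- entries. Commands have at most five entries, so six tails tell their formats from all longer
-- lists.
len6 : ℕ → ℕ
len6 c = sign (seqDrop c 0) + (sign (seqDrop c 1) + (sign (seqDrop c 2) +
  (sign (seqDrop c 3) + (sign (seqDrop c 4) + sign (seqDrop c 5)))))

-- `suc a₁ ∸ q` vanishes iff `a₁ < q`, the guard of a query. Malformed codes mean halt, as in
-- `oracleCommand`.
operation : (q len a₀ a₁ : ℕ) → ℕ
operation q len a₀ a₁ =
  ifz (dist len 4) (ifz (dist a₀ 0) 1 (ifz (dist a₀ 4) (ifz (suc a₁ ∸ q) 5 0) 0))
    (ifz (dist len 3) (ifz (dist a₀ 1) 2 (ifz (dist a₀ 2) 3 0))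
      (ifz (dist len 5) (ifz (dist a₀ 3) 4 0) 0))

opaque
  oracleOp : ℕ → ℕ → ℕ
  oracleOp q c = operation q (len6 c) (seqNth c 0) (seqNth c 1)

  oracleOp-def : ∀ q c → oracleOp q c ≡ operation q (len6 c) (seqNth c 0) (seqNth c 1)
  oracleOp-def q c = refl

signList : List ℕ → ℕ
signList []      = 0
signList (_ ∷ _) = 1

listLen6 : List ℕ → ℕ
listLen6 l = signList l + (signList (List.drop 1 l) + (signList (List.drop 2 l) +
  (signList (List.drop 3 l) + (signList (List.drop 4 l) + signList (List.drop 5 l)))))

len6-listCode : ∀ l → len6 (listCode l) ≡ listLen6 l
len6-listCode l =
  cong₂ _+_ (at 0) (cong₂ _+_ (at 1)
    (cong₂ _+_ (at 2) (cong₂ _+_ (at 3) (cong₂ _+_ (at 4) (at 5)))))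
  where
  sign-listCode : ∀ l → sign (listCode l) ≡ signList l
  sign-listCode []      = refl
  sign-listCode (_ ∷ _) = refl

  at : ∀ n → sign (seqDrop (listCode l) n) ≡ signList (List.drop n l)
  at n = trans (cong sign (seqDrop-listCode l n)) (sign-listCode (List.drop n l))

-- The shapes are listed one by one because the final clause of `oracleCommand` reduces only when
-- the earlier patterns are excluded.
oracleCommand-fields : ∀ q l →
  OracleFields (oracleCommand q l) (operation q (listLen6 l) (listNth l 0) (listNth l 1))
  (listNth l 1) (listNth l 2) (listNth l 3) (listNth l 4)
oracleCommand-fields q [] = basic halt
oracleCommand-fields q (0 ∷ []) = basic halt
oracleCommand-fields q (0 ∷ _ ∷ []) = basic halt
oracleCommand-fields q (0 ∷ _ ∷ _ ∷ []) = basic halt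
oracleCommand-fields q (0 ∷ _ ∷ _ ∷ _ ∷ []) = basic write
oracleCommand-fields q (0 ∷ _ ∷ _ ∷ _ ∷ _ ∷ []) = basic halt
oracleCommand-fields q (0 ∷ _ ∷ _ ∷ _ ∷ _ ∷ _ ∷ _) = basic halt
oracleCommand-fields q (1 ∷ []) = basic halt
oracleCommand-fields q (1 ∷ _ ∷ []) = basic halt
oracleCommand-fields q (1 ∷ _ ∷ _ ∷ []) = basic leftward
oracleCommand-fields q (1 ∷ _ ∷ _ ∷ _ ∷ []) = basic halt
oracleCommand-fields q (1 ∷ _ ∷ _ ∷ _ ∷ _ ∷ []) = basic halt
oracleCommand-fields q (1 ∷ _ ∷ _ ∷ _ ∷ _ ∷ _ ∷ _) = basic halt
oracleCommand-fields q (2 ∷ []) = basic halt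
oracleCommand-fields q (2 ∷ _ ∷ []) = basic halt
oracleCommand-fields q (2 ∷ _ ∷ _ ∷ []) = basic rightward
oracleCommand-fields q (2 ∷ _ ∷ _ ∷ _ ∷ []) = basic halt
oracleCommand-fields q (2 ∷ _ ∷ _ ∷ _ ∷ _ ∷ []) = basic halt
oracleCommand-fields q (2 ∷ _ ∷ _ ∷ _ ∷ _ ∷ _ ∷ _) = basic halt
oracleCommand-fields q (3 ∷ []) = basic halt
oracleCommand-fields q (3 ∷ _ ∷ []) = basic halt
oracleCommand-fields q (3 ∷ _ ∷ _ ∷ []) = basic halt
oracleCommand-fields q (3 ∷ _ ∷ _ ∷ _ ∷ []) = basic halt
oracleCommand-fields q (3 ∷ _ ∷ _ ∷ _ ∷ _ ∷ []) = basic branch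
oracleCommand-fields q (3 ∷ _ ∷ _ ∷ _ ∷ _ ∷ _ ∷ _) = basic halt
oracleCommand-fields q (4 ∷ []) = basic halt
oracleCommand-fields q (4 ∷ _ ∷ []) = basic halt
oracleCommand-fields q (4 ∷ _ ∷ _ ∷ []) = basic halt
oracleCommand-fields q (4 ∷ j ∷ t ∷ s ∷ []) with j <? q
... | yes j<q rewrite m≤n⇒m∸n≡0 j<q =
  subst (λ i → OracleFields (query (fromℕ< j<q) t s) 5 i t s 0) (toℕ-fromℕ< j<q) query
... | no j≮q with suc j ∸ q in eq
...   | zero  = contradiction (m∸n≡0⇒m≤n eq) j≮q
...   | suc _ = basic halt
oracleCommand-fields q (4 ∷ _ ∷ _ ∷ _ ∷ _ ∷ []) = basic halt
oracleCommand-fields q (4 ∷ _ ∷ _ ∷ _ ∷ _ ∷ _ ∷ _) = basic halt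
oracleCommand-fields q (suc (suc (suc (suc (suc _)))) ∷ []) = basic halt
oracleCommand-fields q (suc (suc (suc (suc (suc _)))) ∷ _ ∷ []) = basic halt
oracleCommand-fields q (suc (suc (suc (suc (suc _)))) ∷ _ ∷ _ ∷ []) = basic halt
oracleCommand-fields q (suc (suc (suc (suc (suc _)))) ∷ _ ∷ _ ∷ _ ∷ []) = basic halt
oracleCommand-fields q (suc (suc (suc (suc (suc _)))) ∷ _ ∷ _ ∷ _ ∷ _ ∷ []) = basic halt
oracleCommand-fields q (suc (suc (suc (suc (suc _)))) ∷ _ ∷ _ ∷ _ ∷ _ ∷ _ ∷ _) = basic halt

opaque
  unfolding oracleOp

  oracleOp-fields : ∀ q c → OracleFields (oracleCommand q (sequence c)) (oracleOp q c)
    (seqNth c 1) (seqNth c 2) (seqNth c 3) (seqNth c 4)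
  oracleOp-fields q c = subst
    (λ d → OracleFields (oracleCommand q l) (oracleOp q d) (seqNth d 1) (seqNth d 2) (seqNth d 3)
      (seqNth d 4))
    (listCode-sequence c) (transport (oracleCommand-fields q l))
    where
    l : List ℕ
    l = sequence c

    transport : OracleFields (oracleCommand q l)
      (operation q (listLen6 l) (listNth l 0) (listNth l 1))
        (listNth l 1) (listNth l 2) (listNth l 3) (listNth l 4) →
      OracleFields (oracleCommand q l) (oracleOp q (listCode l))
        (seqNth (listCode l) 1) (seqNth (listCode l) 2) (seqNth (listCode l) 3)
          (seqNth (listCode l) 4)
    transport fields
      rewrite len6-listCode l | seqNth-listCode l 0 | seqNth-listCode l 1 | seqNth-listCode l 2
            | seqNth-listCode l 3 | seqNth-listCode l 4 = fields

-- Beyond the program `seqNth` yields 0 and `sequence 0` is empty, which decodes to halt, the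
-- default of `fetch`.
fetch-machine : ∀ q p s →
  fetch (basic halt) (machine q p) s ≡ oracleCommand q (sequence (seqNth p s))
fetch-machine q p s = trans (fetched (sequence p) s)
  (cong (oracleCommand q ∘ sequence)
    (trans (sym (seqNth-listCode (sequence p) s)) (cong (λ c → seqNth c s) (listCode-sequence p))))
  where
  fetched : ∀ l s → fetch (basic halt) (List.map (λ c → oracleCommand q (sequence c)) l) s ≡
                    oracleCommand q (sequence (listNth l s))
  fetched []      s       = refl
  fetched (c ∷ l) zero    = refl
  fetched (c ∷ l) (suc s) = fetched l s

-- Slave calls

-- In tables, 0 stands for "not yet known" and 1 + v for the value v.
queryStep : (v a₂ a₃ c : ℕ) → ℕ
queryStep v a₂ a₃ c = ifz v c (pair a₃ (update (snd c) a₂ (numeralCode (pred v))))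

oracleStep : (table op a₁ a₂ a₃ a₄ c : ℕ) → ℕ
oracleStep T op a₁ a₂ a₃ a₄ c =
  ifz (dist op 5) (queryStep (nth T (pair a₁ (numberCode (nth (snd c) a₂)))) a₂ a₃ c)
    (commandStep op a₁ a₂ a₃ a₄ c)

module Slave (r : ℕ) where

  currentCommand : (p c : ℕ) → ℕ
  currentCommand p c = seqNth p (fst c)

  opaque
    slaveStep : (p table c : ℕ) → ℕ
    slaveStep p T c = let d = currentCommand p c in
      oracleStep T (oracleOp r d) (seqNth d 1) (seqNth d 2) (seqNth d 3) (seqNth d 4) c

    slaveStep-def : ∀ p T c → let d = currentCommand p c in
      slaveStep p T c ≡ oracleStep T (oracleOp r d) (seqNth d 1) (seqNth d 2) (seqNth d 3)
        (seqNth d 4) c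
    slaveStep-def p T c = refl

  slaveStart : ℕ → ℕ
  slaveStart i = pair 0 (pair (numeralCode i) 0)

  slaveRun : (p i table steps : ℕ) → ℕ
  slaveRun p i T k = natrec (slaveStart i) (λ _ → slaveStep p T) k

  slaveResult : (p c : ℕ) → ℕ
  slaveResult p c = ifz (oracleOp r (currentCommand p c)) (suc (numberCode (nth (snd c) 0))) 0

  simulate : (p i table steps : ℕ) → ℕ
  simulate p i T k = slaveResult p (slaveRun p i T k)

  slaveStart-coded : ∀ i → Coded (slaveStart i) (initial (i ∷ []))
  slaveStart-coded i = coded-pair refl λ where
    zero    → trans (fst-pair _ _) (numeral-tapeCode i)
    (suc t) → trans (nth-pair-suc (numeralCode i) 0 t) (trans (nth-0 t) (sym blank-tapeCode))

  module _ (Y : Vec 𝒩 r) (p : ℕ) where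

    private
      P = machine r p

      fields : ∀ {c C} → Coded c C → let d = currentCommand p c in
        OracleFields (command P Y C) (oracleOp r d) (seqNth d 1) (seqNth d 2) (seqNth d 3)
          (seqNth d 4)
      fields {c} {C} cod = subst
        (λ m → OracleFields m (oracleOp r d) (seqNth d 1) (seqNth d 2) (seqNth d 3) (seqNth d 4))
        (trans (sym (fetch-machine r p (fst c))) (cong (fetch (basic halt) P) (state≡ cod)))
          (oracleOp-fields r d)
        where d = currentCommand p c

      query-coded : ∀ {c C} j t s → Coded c C → ∀ v → v ≡ suc (lookup Y j (number (tapes C t))) →
        Coded (queryStep v t s c) (performOracle P Y (query j t s) C)
      query-coded {C = C} j t s cod _ refl = coded-pair refl
        (update-replaceTape t (tapes≡ cod) (numeral-tapeCode (lookup Y j (number (tapes C t)))))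

      asked : ∀ {c C} t → Coded c C → numberCode (nth (snd c) t) ≡ number (tapes C t)
      asked {C = C} t cod = trans (cong numberCode (tapes≡ cod t)) (number-tapeCode (tapes C t))

      oracleStep-sound : ∀ {T} → (∀ j i {v} → nth T (pair (toℕ j) i) ≡ suc v → v ≡ lookup Y j i) →
        ∀ {c C m op a₁ a₂ a₃ a₄} → OracleFields m op a₁ a₂ a₃ a₄ → Coded c C →
        Coded (oracleStep T op a₁ a₂ a₃ a₄ c) C ⊎ Coded (oracleStep T op a₁ a₂ a₃ a₄ c)
          (performOracle P Y m C)
      oracleStep-sound sound (basic halt)      cod = inj₂ (commandStep-coded halt cod)
      oracleStep-sound sound (basic write)     cod = inj₂ (commandStep-coded write cod)
      oracleStep-sound sound (basic leftward)  cod = inj₂ (commandStep-coded leftward cod)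
      oracleStep-sound sound (basic rightward) cod = inj₂ (commandStep-coded rightward cod)
      oracleStep-sound sound (basic branch)    cod = inj₂ (commandStep-coded branch cod)
      oracleStep-sound {T} sound {c} {C} (query {j} {t} {s}) cod with nth T
        (pair (toℕ j) (numberCode (nth (snd c) t))) in eq
      ... | zero  = inj₁ cod
      ... | suc v = inj₂ (query-coded j t s cod (suc v) (cong suc
        (trans (sound j _ eq) (cong (lookup Y j) (asked t cod)))))

      oracleStep-complete : ∀ {T c C m op a₁ a₂ a₃ a₄} →
        (∀ j t s → m ≡ query j t s →
          nth T (pair (toℕ j) (number (tapes C t))) ≡ suc (lookup Y j (number (tapes C t)))) →
        OracleFields m op a₁ a₂ a₃ a₄ → Coded c C →
        Coded (oracleStep T op a₁ a₂ a₃ a₄ c) (performOracle P Y m C)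
      oracleStep-complete known (basic halt)      cod = commandStep-coded halt cod
      oracleStep-complete known (basic write)     cod = commandStep-coded write cod
      oracleStep-complete known (basic leftward)  cod = commandStep-coded leftward cod
      oracleStep-complete known (basic rightward) cod = commandStep-coded rightward cod
      oracleStep-complete known (basic branch)    cod = commandStep-coded branch cod
      oracleStep-complete {T} known (query {j} {t} {s}) cod = query-coded j t s cod _
        (trans (cong (λ i → nth T (pair (toℕ j) i)) (asked t cod)) (known j t s refl))

      op≡0⇒halt : ∀ {m op a₁ a₂ a₃ a₄} → OracleFields {r} m op a₁ a₂ a₃ a₄ → op ≡ 0 → m ≡ basic halt
      op≡0⇒halt (basic halt) eq = refl

      halt⇒op≡0 : ∀ {m op a₁ a₂ a₃ a₄} → OracleFields {r} m op a₁ a₂ a₃ a₄ → m ≡ basic halt → op ≡ 0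
      halt⇒op≡0 (basic halt) eq = refl

      step-coded : ∀ {T c C} → let d = currentCommand p c in
        Coded (oracleStep T (oracleOp r d) (seqNth d 1) (seqNth d 2) (seqNth d 3)
          (seqNth d 4) c) C → Coded (slaveStep p T c) C
      step-coded {T} {c} = subst (λ c′ → Coded c′ _) (sym (slaveStep-def p T c))

      ifz≡suc : ∀ op {u v} → ifz op (suc u) 0 ≡ suc v → op ≡ 0 × u ≡ v
      ifz≡suc zero refl = refl , refl

      runFrom : ℕ → ℕ → Config
      runFrom i k = run P Y k (initial (i ∷ []))

    -- A query that the table does not answer leaves the simulated slave where it is. It may thus
    -- lag behind the real run, whence `k′`, but it never departs from it, and while it waits it is
    -- not at a halt.
    simulate-sound : ∀ {T} → (∀ j i {v} → nth T (pair (toℕ j) i) ≡ suc v → v ≡ lookup Y j i) →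
      ∀ i k {v} → simulate p i T k ≡ suc v → Φ Y p (i ∷ []) v
    simulate-sound {T} sound i k {v} eq = halted (follows k)
      where
      follows : ∀ k → ∃ λ k′ → Coded (slaveRun p i T k) (runFrom i k′)
      follows zero    = 0 , slaveStart-coded i
      follows (suc k) with follows k
      ... | k′ , cod with oracleStep-sound sound (fields cod) cod
      ... | inj₁ cod′ = k′ , step-coded cod′
      ... | inj₂ cod′ = suc k′
        , subst (Coded _) (sym (run-suc P Y k′ (initial (i ∷ [])))) (step-coded cod′)

      halted : (∃ λ k′ → Coded (slaveRun p i T k) (runFrom i k′)) → Φ Y p (i ∷ []) v
      halted (k′ , cod) with ifz≡suc (oracleOp r (currentCommand p (slaveRun p i T k))) eq
      ... | op≡0 , number≡ = k′ , op≡0⇒halt (fields cod) op≡0 , trans (sym (asked 0 cod)) number≡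

    -- A halting run makes finitely many queries, so beyond the maximum of their thresholds every
    -- answer is in the table. The same `k` bounds the number of steps and so must also reach the
    -- halting time `l`.
    simulate-complete : ∀ {A : ℕ → ℕ} →
      (∀ j i → ∃ λ K → ∀ k → K ≤ k → nth (A k) (pair (toℕ j) i) ≡ suc (lookup Y j i)) →
      ∀ {i v} → Φ Y p (i ∷ []) v → ∃ λ K → ∀ k → K ≤ k → simulate p i (A k) k ≡ suc v
    simulate-complete {A} complete {i} {v} (l , halts , refl) with follows l
      where
      known : ∀ C → ∃ λ K → ∀ k → K ≤ k → ∀ j t s → command P Y C ≡ query j t s →
        nth (A k) (pair (toℕ j) (number (tapes C t))) ≡ suc (lookup Y j (number (tapes C t)))
      known C with command P Y C
      ... | basic b     = 0 , λ k _ j t s ()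
      ... | query j t s with complete j (number (tapes C t))
      ... | K , eq = K , λ { k K≤k _ _ _ refl → eq k K≤k }

      follows : ∀ l → ∃ λ K → ∀ k → K ≤ k → Coded (slaveRun p i (A k) l) (runFrom i l)
      follows zero    = 0 , λ k _ → slaveStart-coded i
      follows (suc l) with follows l | known (runFrom i l)
      ... | K , cod | K′ , eq = K ⊔ K′ , λ k le →
        let cod′ = cod k (≤-trans (m≤m⊔n K K′) le) in
        subst (Coded _) (sym (run-suc P Y l (initial (i ∷ []))))
          (step-coded (oracleStep-complete (eq k (≤-trans (m≤n⊔m K K′) le)) (fields cod′) cod′))
    ... | K , cod = K ⊔ l , λ k le → finished k (stays k (k ∸ l) (cod k (≤-trans (m≤m⊔n K l) le))
            (m∸n+n≡m (≤-trans (m≤n⊔m K l) le)))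
      where
      stays : ∀ k d {m} → Coded (slaveRun p i (A k) l) (runFrom i l) → d + l ≡ m →
        Coded (slaveRun p i (A k) m) (runFrom i l)
      stays k zero    cod refl = cod
      stays k (suc d) cod refl =
        subst (Coded _) (cong (λ m → performOracle P Y m (runFrom i l)) halts)
        (step-coded (oracleStep-complete (λ j t s eq → contradiction (trans (sym eq) halts) λ ())
          (fields cod′) cod′))
        where cod′ = stays k d cod refl

      finished : ∀ k → Coded (slaveRun p i (A k) k) (runFrom i l) →
        simulate p i (A k) k ≡ suc (output (runFrom i l))
      finished k cod = trans
        (cong (λ op → ifz op (suc (numberCode (nth (snd (slaveRun p i (A k) k)) 0))) 0)
          (halt⇒op≡0 (fields cod) halts))
        (cong suc (asked 0 cod))

Φ-deterministic : ∀ {p q} (xs : Vec 𝒩 q) e (ns : Vec ℕ p) {u v} → Φ xs e ns u → Φ xs e ns v → u ≡ v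
Φ-deterministic {q = q} xs e ns (k , halts , refl) (l , halts′ , refl) =
  cong output (trans (sym (stable k l halts))
    (trans (cong (λ n → run P xs n c) (+-comm k l)) (stable l k halts′)))
  where
  P = machine q e
  c = initial (toList ns)

  stable : ∀ k l → command P xs (run P xs k c) ≡ basic halt → run P xs (k + l) c ≡ run P xs k c
  stable k l halts = trans (run-+ P xs k l c) (run-halted P xs l _ halts)

-- The table for k lists, for each ⟨j , i⟩ below k, what is known about the
-- i-th term of Baire tape j when every slave computation is run for k steps.
-- Being finite, it is a number, which keeps nested calls primitive recursive.
module Tables (r : ℕ) where

  open Slave r public

  -- Entries are strict: the new entry at i is known only if the old one is
  -- known and the call itself has produced its i-th term.  Hence an output
  -- tape with all terms known certifies that every call was defined.
  entry : (request k table n : ℕ) → ℕ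
  entry request k T n =
    ifz (nth T n) 0 (ifz v 0 (ifz (dist (fst n) (snd request)) v (nth T n)))
    where v = simulate (fst request) (snd n) T k

  extend : (request k table : ℕ) → ℕ
  extend request k T = tabulate k (entry request k T)

  -- Baire tape 0 is the input tape; on every other tape the entry 1 stands for the known value 0.
  initialTable : 𝒩 → ℕ → ℕ
  initialTable x k = tabulate k λ n → ifz (fst n) (suc (x (snd n))) 1

  opaque

    -- h is the stream of the m calls made so far, the latest first.
    table : 𝒩 → (m h k : ℕ) → ℕ
    table x m h k = fold (initialTable x k) (λ j → extend (nth h j) k) m

    table-def : ∀ x m h k → table x m h k ≡ fold (initialTable x k) (λ j → extend (nth h j) k) m
    table-def x m h k = refl

    table-suc : ∀ x m request h k →
      table x (suc m) (pair request h) k ≡ extend request k (table x m h k)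
    table-suc x m request h k =
      trans (fold-suc (initialTable x k) (λ j → extend (nth (pair request h) j) k) m)
      (cong₂ (λ c → extend c k) (fst-pair request h)
        (fold-cong m λ j r → cong (λ c → extend c k r) (nth-pair-suc request h j)))

  tabulate≡suc : ∀ k f n {v} → nth (tabulate k f) n ≡ suc v → f n ≡ suc v
  tabulate≡suc k f n eq with n <? k
  ... | yes n<k = trans (sym (nth-tabulate f n<k)) eq
  ... | no n≮k  = contradiction (trans (sym (nth-tabulate-≥ f (≮⇒≥ n≮k))) eq) λ ()

  -- Completeness asks for knowledge at all large `k` and thereby avoids any monotonicity in `k`: a
  -- computation uses finitely many terms, and the maximum of their thresholds provides them all at
  -- once.
  record Tracks (A : ℕ → ℕ) (Y : Vec 𝒩 r) : Set where
    field
      sound    : ∀ k j i {v} → nth (A k) (pair (toℕ j) i) ≡ suc v → v ≡ lookup Y j i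
      complete : ∀ j i → ∃ λ K → ∀ k → K ≤ k → nth (A k) (pair (toℕ j) i) ≡ suc (lookup Y j i)

  open Tracks public

  tracks-cong : ∀ {A B Y} → (∀ k → A k ≡ B k) → Tracks A Y → Tracks B Y
  tracks-cong eq tr .sound k j i e =
    tr .sound k j i (trans (cong (λ T → nth T (pair (toℕ j) i)) (eq k)) e)
  tracks-cong eq tr .complete j i with tr .complete j i
  ... | K , known = K , λ k K≤k →
    trans (cong (λ T → nth T (pair (toℕ j) i)) (sym (eq k))) (known k K≤k)

  entry≡suc : ∀ p l k T j i {v} → entry (pair p l) k T (pair j i) ≡ suc v → ∃₂ λ u w →
    nth T (pair j i) ≡ suc u × simulate p i T k ≡ suc w × suc v ≡ ifz (dist j l) (suc w) (suc u)
  entry≡suc p l k T j i eq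
    rewrite fst-pair p l | snd-pair p l | fst-pair j i | snd-pair j i
    with nth T (pair j i) | simulate p i T k
  ... | suc u | suc w = u , w , refl , refl , sym eq

  entry-known : ∀ p l k T j i {u w} → nth T (pair j i) ≡ suc u → simulate p i T k ≡ suc w →
    entry (pair p l) k T (pair j i) ≡ ifz (dist j l) (suc w) (suc u)
  entry-known p l k T j i old new
    rewrite fst-pair p l | snd-pair p l | fst-pair j i | snd-pair j i | old | new = refl

  -- Definedness of the call matters even for the tapes that it does not write: entries being
  -- strict, theirs wait for it as well.
  extend-tracks : ∀ {A Y p l y} → Tracks A Y → Ψ p Y y →
    Tracks (λ k → extend (pair p (toℕ l)) k (A k)) (Y [ l ]≔ y)
  extend-tracks {A} {Y} {p} {l} {y} tr run .sound k j i {v} eq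
    with entry≡suc p (toℕ l) k (A k) (toℕ j) i
      (tabulate≡suc k (entry (pair p (toℕ l)) k (A k)) (pair (toℕ j) i) eq)
  ... | u , w , old , new , v≡ with toℕ j ≟ toℕ l
  ... | no j≢l = trans (suc-injective (trans v≡ (ifz-dist-≢ _ _ j≢l)))
      (trans (tr .sound k j i old) (cong (λ z → z i) (sym (lookup∘update′ (j≢l ∘ cong toℕ) Y y))))
  ... | yes j≡l with toℕ-injective j≡l
  ... | refl = trans (suc-injective (trans v≡ (ifz-dist-≡ _ _ j≡l)))
      (trans (Φ-deterministic Y p (i ∷ []) (simulate-sound Y p (tr .sound k) i k new) (run i))
             (cong (λ z → z i) (sym (lookup∘update l Y y))))
  extend-tracks {A} {Y} {p} {l} {y} tr run .complete j i
    with tr .complete j i | simulate-complete Y p (tr .complete) (run i)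
  ... | K , old | K′ , new = K ⊔ K′ ⊔ suc (pair (toℕ j) i) , known
    where
    value : ifz (dist (toℕ j) (toℕ l)) (suc (y i)) (suc (lookup Y j i)) ≡ suc
      (lookup (Y [ l ]≔ y) j i)
    value with toℕ j ≟ toℕ l
    ... | no j≢l = trans (ifz-dist-≢ _ _ j≢l)
      (cong (λ z → suc (z i)) (sym (lookup∘update′ (j≢l ∘ cong toℕ) Y y)))
    ... | yes j≡l with toℕ-injective j≡l
    ... | refl = trans (ifz-dist-≡ _ _ j≡l) (cong (λ z → suc (z i)) (sym (lookup∘update l Y y)))

    known : ∀ k → K ⊔ K′ ⊔ suc (pair (toℕ j) i) ≤ k →
      nth (extend (pair p (toℕ l)) k (A k)) (pair (toℕ j) i) ≡ suc (lookup (Y [ l ]≔ y) j i)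
    known k le = trans (nth-tabulate (entry (pair p (toℕ l)) k (A k))
      (≤-trans (m≤n⊔m (K ⊔ K′) _) le))
      (trans (entry-known p (toℕ l) k (A k) (toℕ j) i
        (old k (≤-trans (m≤m⊔n K K′) (≤-trans (m≤m⊔n (K ⊔ K′) _) le)))
        (new k (≤-trans (m≤n⊔m K K′) (≤-trans (m≤m⊔n (K ⊔ K′) _) le)))) value)

  Known : (ℕ → ℕ) → ℕ → Set
  Known A j = ∀ i → ∃₂ λ k v → nth (A k) (pair j i) ≡ suc v

  known-extend : ∀ {A p l j} → Known (λ k → extend (pair p l) k (A k)) j → Known A j
  known-extend {A} {p} {l} {j} known i with known i
  ... | k , v , eq with entry≡suc p l k (A k) j i
    (tabulate≡suc k (entry (pair p l) k (A k)) (pair j i) eq)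
  ... | u , _ , old , _ = k , u , old

  -- The tape `j` may differ from the target of the call: by strictness the i-th entry of every tape
  -- waits for the i-th term of the call.
  known-call : ∀ {A Y p l j} → Tracks A Y → Known (λ k → extend (pair p l) k (A k)) j → ∃ (Ψ p Y)
  known-call {A} {Y} {p} {l} {j} tr known = (λ i → proj₁ (value i)) , λ i → proj₂ (value i)
    where
    value : ∀ i → ∃ (Φ Y p (i ∷ []))
    value i with known i
    ... | k , v , eq with entry≡suc p l k (A k) j i
      (tabulate≡suc k (entry (pair p l) k (A k)) (pair j i) eq)
    ... | _ , w , _ , new , _ = w , simulate-sound Y p (tr .sound k) i k new

-- Primitive recursiveness of coded steps and tables

module _ {q : ℕ} where

  private
    Fun : ℕ → Set
    Fun n = Vec 𝒩 q → Vec ℕ n → ℕ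

  module _ {n} {f : Fun n} (d : Definable f) where

    headCodeD : Definable (λ xs ns → headCode (f xs ns))
    headCodeD = fstD (sndD d)

    leftCodeD : Definable (λ xs ns → leftCode (f xs ns))
    leftCodeD = pairD (sndD (fstD d)) (pairD (fstD (fstD d)) (pairD headCodeD (sndD (sndD d))))

    rightCodeD : Definable (λ xs ns → rightCode (f xs ns))
    rightCodeD = pairD (pairD headCodeD (fstD d)) (sndD (sndD d))

    numberCodeD : Definable (λ xs ns → numberCode (f xs ns))
    numberCodeD = +D (countOnesD (fstD d)) (countOnesD (sndD d))

    numeralCodeD : Definable (λ xs ns → numeralCode (f xs ns))
    numeralCodeD = pairD zeroD (pairD zeroD (natrecD zeroD (pairD (constD 1) (varD v1)) d))

  commandStepD : ∀ {n} {op a₁ a₂ a₃ a₄ c : Fun n} → Definable op → Definable a₁ → Definable a₂ →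
    Definable a₃ →
    Definable a₄ → Definable c →
    Definable (λ xs ns → commandStep (op xs ns) (a₁ xs ns) (a₂ xs ns) (a₃ xs ns) (a₄ xs ns)
      (c xs ns))
  commandStepD {n} op a₁ a₂ a₃ a₄ c = convD
    (pairD
      (case 1 a₃ (case 2 a₂ (case 3 a₂
        (case 4 (ifzD (distD (headCodeD T) a₂) a₃ a₄) (fstD c)))))
      (case 1 (updateD Ts a₁ (pairD (fstD T) (pairD a₂ (sndD (sndD T)))))
        (case 2 (updateD Ts a₁ (leftCodeD T)) (case 3 (updateD Ts a₁ (rightCodeD T)) Ts))))
    λ xs ns → sym (commandStep-def _ _ _ _ _ _)
    where
    Ts = sndD c
    T  = nthD Ts a₁

    case : ∀ k {f g : Fun n} → Definable f → Definable g → Definable _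
    case k d e = ifzD (distD op (constD k)) d e

  oracleOpD : ∀ r {n} {f : Fun n} → Definable f → Definable (λ xs ns → oracleOp r (f xs ns))
  oracleOpD r = app₁ (λ _ → oracleOp r) (convD
    (case len 4 (case a₀ 0 (constD 1)
      (case a₀ 4 (ifzD (∸D (sucD (seqNthD (varD v0) (constD 1))) (constD r))
        (constD 5) zeroD) zeroD))
      (case len 3 (case a₀ 1 (constD 2) (case a₀ 2 (constD 3) zeroD))
        (case len 5 (case a₀ 3 (constD 4) zeroD) zeroD)))
    λ xs ns → sym (oracleOp-def r (lookup ns v0)))
    where
    signD : ∀ k → Definable {q} {1} (λ xs ns → sign (seqDrop (lookup ns v0) k))
    signD k = ifzD (seqDropD (varD v0) (constD k)) zeroD (constD 1)

    len : Definable {q} {1} (λ xs ns → len6 (lookup ns v0))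
    len = +D (signD 0) (+D (signD 1) (+D (signD 2) (+D (signD 3) (+D (signD 4) (signD 5)))))

    a₀ : Definable {q} {1} (λ xs ns → seqNth (lookup ns v0) 0)
    a₀ = seqNthD (varD v0) zeroD

    case : ∀ {h : Fun 1} → Definable h → ∀ k {f g : Fun 1} → Definable f → Definable g →
      Definable (λ xs ns → ifz (dist (h xs ns) k) (f xs ns) (g xs ns))
    case c k d e = ifzD (distD c (constD k)) d e

module _ {q : ℕ} (r : ℕ) where

  open Tables r

  private
    Fun : ℕ → Set
    Fun n = Vec 𝒩 (suc q) → Vec ℕ n → ℕ

  opaque

    slaveStepD : ∀ {n} {p T c : Fun n} → Definable p → Definable T → Definable c →
      Definable (λ xs ns → slaveStep (p xs ns) (T xs ns) (c xs ns))
    slaveStepD = app₃ (λ _ → slaveStep) (convD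
      (ifzD (distD (oracleOpD r d) (constD 5))
        (ifzD answerD c (pairD (arg 3) (updateD (sndD c) (arg 2) (numeralCodeD (predD answerD)))))
        (commandStepD (oracleOpD r d) (arg 1) (arg 2) (arg 3) (arg 4) c))
      λ xs ns → sym (slaveStep-def (lookup ns v0) (lookup ns v1) (lookup ns v2)))
      where
      c : Definable {suc q} {3} (λ xs ns → lookup ns v2)
      c = varD v2

      d : Definable {suc q} {3} (λ xs ns → currentCommand (lookup ns v0) (lookup ns v2))
      d = seqNthD (varD v0) (fstD c)

      arg : ∀ k → Definable {suc q} {3}
        (λ xs ns → seqNth (currentCommand (lookup ns v0) (lookup ns v2)) k)
      arg k = seqNthD d (constD k)

      answerD : Definable {suc q} {3} (λ xs ns → nth (lookup ns v1)
        (pair (seqNth (currentCommand (lookup ns v0) (lookup ns v2)) 1)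
              (numberCode (nth (snd (lookup ns v2))
                (seqNth (currentCommand (lookup ns v0) (lookup ns v2)) 2)))))
      answerD = nthD (varD v1) (pairD (arg 1) (numberCodeD (nthD (sndD c) (arg 2))))

    slaveResultD : ∀ {n} {p c : Fun n} → Definable p → Definable c →
      Definable (λ xs ns → slaveResult (p xs ns) (c xs ns))
    slaveResultD = app₂ (λ _ → slaveResult)
      (ifzD (oracleOpD r (seqNthD (varD v0) (fstD (varD v1))))
        (sucD (numberCodeD (nthD (sndD (varD v1)) zeroD))) zeroD)

    entryD : Definable {suc q} {4}
      (λ xs ns → entry (lookup ns v0) (lookup ns v1) (lookup ns v2) (lookup ns v3))
    entryD = ifzD old zeroD
      (ifzD new zeroD (ifzD (distD (fstD (varD v3)) (sndD (varD v0))) new old))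
      where
      old : Definable {suc q} {4} (λ xs ns → nth (lookup ns v2) (lookup ns v3))
      old = nthD (varD v2) (varD v3)

      new : Definable {suc q} {4} (λ xs ns →
        simulate (fst (lookup ns v0)) (snd (lookup ns v3)) (lookup ns v2) (lookup ns v1))
      new = slaveResultD (fstD (varD v0))
        (natrecD (pairD zeroD (pairD (numeralCodeD (sndD (varD v3))) zeroD))
        (slaveStepD (fstD (varD v2)) (varD v4) (varD v1)) (varD v1))

    extendD : ∀ {n} {f k T : Fun n} → Definable f → Definable k → Definable T →
      Definable (λ xs ns → extend (f xs ns) (k xs ns) (T xs ns))
    extendD = app₃ (λ _ → extend)
      (tabulateD (varD v1) (app₄ (varD v1) (varD v2) (varD v3) (varD v0)))
      where
      app₄ : ∀ {n} {f k T m : Fun n} → Definable f → Definable k → Definable T → Definable m →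
        Definable (λ xs ns → entry (f xs ns) (k xs ns) (T xs ns) (m xs ns))
      app₄ d e d′ e′ .term =
        comp {m = 4} (entryD .term) (d .term ∷ e .term ∷ d′ .term ∷ e′ .term ∷ [])
      app₄ {f = f} {k} d e d′ e′ .correct xs ns = trans (entryD .correct xs _)
        (trans (cong₂ (λ a b → entry a b _ _) (d .correct xs ns) (e .correct xs ns))
               (cong₂ (entry (f xs ns) (k xs ns)) (d′ .correct xs ns) (e′ .correct xs ns)))

    tableD : ∀ {n} {m h k : Fun n} → Definable m → Definable h → Definable k →
      Definable (λ xs ns → table (lookup xs zero) (m xs ns) (h xs ns) (k xs ns))
    tableD = app₃ (λ xs → table (lookup xs zero)) (convD (foldD
      (tabulateD (varD v2) (ifzD (fstD (varD v0)) (sucD (oracleD zero (sndD (varD v0))))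
        (constD 1)))
      (extendD (nthD (varD v3) (varD v0)) (varD v4) (varD v1))
      (varD v0)) λ xs ns → sym
        (table-def (lookup xs zero) (lookup ns v0) (lookup ns v1) (lookup ns v2)))

-- A state of the simulation: number of steps, coded master configuration,
-- bit, number of slave calls, slave calls (latest first).  The initial state
-- is 0.  The number of steps makes searchIndex s at least the halting time.
opaque

  state⟨_,_,_,_,_⟩ : (t c b m h : ℕ) → ℕ
  state⟨ t , c , b , m , h ⟩ = pair t (pair c (pair b (pair m h)))

  clock configOf bitOf calls history : ℕ → ℕ
  clock s    = fst s
  configOf s = fst (snd s)
  bitOf s    = fst (snd (snd s))
  calls s    = fst (snd (snd (snd s)))
  history s  = snd (snd (snd (snd s)))

  clock-state : ∀ t c b m h → clock state⟨ t , c , b , m , h ⟩ ≡ t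
  clock-state t c b m h = fst-pair t _

  configOf-state : ∀ t c b m h → configOf state⟨ t , c , b , m , h ⟩ ≡ c
  configOf-state t c b m h = trans (cong fst (snd-pair t _)) (fst-pair c _)

  bitOf-state : ∀ t c b m h → bitOf state⟨ t , c , b , m , h ⟩ ≡ b
  bitOf-state t c b m h =
    trans (cong (fst ∘ snd) (snd-pair t _)) (trans (cong fst (snd-pair c _)) (fst-pair b _))

  tail-state : ∀ t c b m h → snd (snd (snd state⟨ t , c , b , m , h ⟩)) ≡ pair m h
  tail-state t c b m h =
    trans (cong (snd ∘ snd) (snd-pair t _)) (trans (cong snd (snd-pair c _)) (snd-pair b _))

  calls-state : ∀ t c b m h → calls state⟨ t , c , b , m , h ⟩ ≡ m
  calls-state t c b m h = trans (cong fst (tail-state t c b m h)) (fst-pair m h)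

  history-state : ∀ t c b m h → history state⟨ t , c , b , m , h ⟩ ≡ h
  history-state t c b m h = trans (cong snd (tail-state t c b m h)) (snd-pair m h)

  clock-0 : clock 0 ≡ 0
  clock-0 = fst-0

  configOf-0 : configOf 0 ≡ 0
  configOf-0 = trans (cong fst snd-0) fst-0

  bitOf-0 : bitOf 0 ≡ 0
  bitOf-0 = trans (cong (fst ∘ snd) snd-0) configOf-0

  calls-0 : calls 0 ≡ 0
  calls-0 = trans (cong (fst ∘ snd ∘ snd) snd-0) bitOf-0

  history-0 : history 0 ≡ 0
  history-0 = trans (cong (snd ∘ snd ∘ snd) snd-0)
    (trans (cong (snd ∘ snd) snd-0) (trans (cong snd snd-0) snd-0))

  clock≤ : ∀ s → clock s ≤ s
  clock≤ s = subst (fst s ≤_) (pair-fst-snd s) (a≤pair (fst s) (snd s))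

  clockD : ∀ {q n} {f : Vec 𝒩 q → Vec ℕ n → ℕ} → Definable f → Definable (λ xs ns → clock (f xs ns))
  clockD d = fstD d

  configOfD : ∀ {q n} {f : Vec 𝒩 q → Vec ℕ n → ℕ} → Definable f →
    Definable (λ xs ns → configOf (f xs ns))
  configOfD d = fstD (sndD d)

  bitOfD : ∀ {q n} {f : Vec 𝒩 q → Vec ℕ n → ℕ} → Definable f → Definable (λ xs ns → bitOf (f xs ns))
  bitOfD d = fstD (sndD (sndD d))

  callsD : ∀ {q n} {f : Vec 𝒩 q → Vec ℕ n → ℕ} → Definable f → Definable (λ xs ns → calls (f xs ns))
  callsD d = fstD (sndD (sndD (sndD d)))

  historyD : ∀ {q n} {f : Vec 𝒩 q → Vec ℕ n → ℕ} → Definable f →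
    Definable (λ xs ns → history (f xs ns))
  historyD d = sndD (sndD (sndD (sndD d)))

  stateD : ∀ {q n} {t c b m h : Vec 𝒩 q → Vec ℕ n → ℕ} →
    Definable t → Definable c → Definable b → Definable m → Definable h →
    Definable (λ xs ns → state⟨ t xs ns , c xs ns , b xs ns , m xs ns , h xs ns ⟩)
  stateD t c b m h = pairD t (pairD c (pairD b (pairD m h)))

-- The simulated master

data MasterFields {r} : MasterCommand r → (op a₁ a₂ a₃ a₄ : ℕ) → Set where
  basic    : ∀ {b op a₁ a₂ a₃ a₄} → BasicFields b op a₁ a₂ a₃ a₄ →
    MasterFields (basic b) op a₁ a₂ a₃ a₄
  call     : ∀ {l s a₃ a₄} → MasterFields (call l s) 5 (toℕ l) s a₃ a₄
  zeroTest : ∀ {s a₂ a₃ a₄} → MasterFields (zeroTest s) 6 s a₂ a₃ a₄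
  ifBit    : ∀ {s s′ a₃ a₄} → MasterFields (ifBit s s′) 7 s s′ a₃ a₄

pack : (op a₁ a₂ a₃ a₄ : ℕ) → ℕ
pack op a₁ a₂ a₃ a₄ = streamCode (op ∷ a₁ ∷ a₂ ∷ a₃ ∷ a₄ ∷ [])

masterEntry : ∀ {r} → MasterCommand r → ℕ
masterEntry (basic (write t a s))        = pack 1 t a s 0
masterEntry (basic (move leftward t s))  = pack 2 t s 0 0
masterEntry (basic (move rightward t s)) = pack 3 t s 0 0
masterEntry (basic (branch t a s s′))    = pack 4 t a s s′
masterEntry (basic halt)                 = pack 0 0 0 0 0
masterEntry (call l s)                   = pack 5 (toℕ l) s 0 0
masterEntry (zeroTest s)                 = pack 6 s 0 0 0
masterEntry (ifBit s s′)                 = pack 7 s s′ 0 0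

EntryFields : ∀ {r} → MasterCommand r → ℕ → Set
EntryFields m e = MasterFields m (nth e 0) (nth e 1) (nth e 2) (nth e 3) (nth e 4)

nth-streamCode : ∀ l n → nth (streamCode l) n ≡ listNth l n
nth-streamCode []      n       = nth-0 n
nth-streamCode (a ∷ l) zero    = fst-pair a _
nth-streamCode (a ∷ l) (suc n) = trans (nth-pair-suc a _ n) (nth-streamCode l n)

pack-fields : ∀ {r} {m : MasterCommand r} {op a₁ a₂ a₃ a₄} → MasterFields m op a₁ a₂ a₃ a₄ →
  EntryFields m (pack op a₁ a₂ a₃ a₄)
pack-fields {m = m} {op} {a₁} {a₂} {a₃} {a₄} fields = transport (at 0) (at 1) (at 2) (at 3) (at 4)
  where
  l : List ℕ
  l = op ∷ a₁ ∷ a₂ ∷ a₃ ∷ a₄ ∷ []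

  at : ∀ n → nth (streamCode l) n ≡ listNth l n
  at = nth-streamCode l

  transport : ∀ {b₀ b₁ b₂ b₃ b₄} → b₀ ≡ op → b₁ ≡ a₁ → b₂ ≡ a₂ → b₃ ≡ a₃ → b₄ ≡ a₄ →
    MasterFields m b₀ b₁ b₂ b₃ b₄
  transport refl refl refl refl refl = fields

masterEntry-fields : ∀ {r} (m : MasterCommand r) → EntryFields m (masterEntry m)
masterEntry-fields (basic (write t a s))        = pack-fields (basic write)
masterEntry-fields (basic (move leftward t s))  = pack-fields (basic leftward)
masterEntry-fields (basic (move rightward t s)) = pack-fields (basic rightward)
masterEntry-fields (basic (branch t a s s′))    = pack-fields (basic branch)
masterEntry-fields (basic halt)                 = pack-fields (basic halt)
masterEntry-fields (call l s)                   = pack-fields call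
masterEntry-fields (zeroTest s)                 = pack-fields zeroTest
masterEntry-fields (ifBit s s′)                 = pack-fields ifBit

fetch-fields : ∀ {r} (P : List (MasterCommand r)) s →
  EntryFields (fetch (basic halt) P s) (nth (streamCode (List.map masterEntry P)) s)
fetch-fields {r} P s =
  subst (EntryFields (fetch (basic halt) P s)) (sym (nth-streamCode (List.map masterEntry P) s))
    (fetched P s)
  where
  fetched : ∀ (P : List (MasterCommand r)) s →
    EntryFields (fetch (basic halt) P s) (listNth (List.map masterEntry P) s)
  fetched []      s       =
    subst (λ op → MasterFields {r} (basic halt) op (nth 0 1) (nth 0 2) (nth 0 3) (nth 0 4))
      (sym (nth-0 0)) (basic halt)
  fetched (c ∷ P) zero    = masterEntry-fields c
  fetched (c ∷ P) (suc s) = fetched P s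

-- A call is recorded, as billboard number and target tape, but not carried out: the master can
-- notice its outcome only through a later zero test.
callStepCode ifBitCode : (a₁ a₂ s : ℕ) → ℕ
callStepCode a₁ a₂ s = state⟨ suc (clock s) , pair a₂ (snd c) , bitOf s , suc (calls s) ,
  pair (pair (numberCode (nth (snd c) 1)) a₁) (history s) ⟩
  where c = configOf s
ifBitCode a₁ a₂ s =
  state⟨ suc (clock s) , pair (ifz (bitOf s) a₂ a₁) (snd (configOf s)) , bitOf s , calls s
    , history s ⟩

zeroTestCode : (a₁ s b : ℕ) → ℕ
zeroTestCode a₁ s b = state⟨ suc (clock s) , pair a₁ (snd (configOf s)) , b , calls s , history s ⟩

otherCode : (op a₁ a₂ a₃ a₄ s : ℕ) → ℕ
otherCode op a₁ a₂ a₃ a₄ s =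
  state⟨ suc (clock s) , commandStep op a₁ a₂ a₃ a₄ (configOf s) , bitOf s , calls s , history s ⟩

-- A halted state is returned unchanged, clock included, so that a run has only one halted state.
stepFields : (op a₁ a₂ a₃ a₄ s b : ℕ) → ℕ
stepFields op a₁ a₂ a₃ a₄ s b =
  ifz op s (ifz (dist op 5) (callStepCode a₁ a₂ s) (ifz (dist op 6) (zeroTestCode a₁ s b)
    (ifz (dist op 7) (ifBitCode a₁ a₂ s) (otherCode op a₁ a₂ a₃ a₄ s))))

module Master (M : MSMachine 1) where

  open MSMachine M using (working; program; #tapes; zeroTestTape; outputTape)
  open MSConfig
  open Tables #tapes

  programCode : ℕ
  programCode = streamCode (List.map masterEntry program)

  currentEntry : ℕ → ℕ
  currentEntry s = nth programCode (fst (configOf s))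

  currentOp : ℕ → ℕ
  currentOp s = nth (currentEntry s) 0

  opaque

    masterStep : ℕ → ℕ → ℕ
    masterStep s b = let e = currentEntry s in stepFields (nth e 0) (nth e 1) (nth e 2) (nth e 3) (nth e 4) s b

    masterStep-def : ∀ s b → let e = currentEntry s in
      masterStep s b ≡ stepFields (nth e 0) (nth e 1) (nth e 2) (nth e 3) (nth e 4) s b
    masterStep-def s b = refl

    masterStepD : ∀ {q n} {f g : Vec 𝒩 q → Vec ℕ n → ℕ} → Definable f → Definable g →
      Definable (λ xs ns → masterStep (f xs ns) (g xs ns))
    masterStepD {q} = app₂ (λ _ → masterStep)
      (ifzD op s (ifzD (distD op (constD 5))
        (stateD (sucD (clockD s)) (pairD (arg 2) (sndD c)) (bitOfD s) (sucD (callsD s))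
          (pairD (pairD (numberCodeD (nthD (sndD c) (constD 1))) (arg 1)) (historyD s)))
        (ifzD (distD op (constD 6))
          (stateD (sucD (clockD s)) (pairD (arg 1) (sndD c)) (varD v1) (callsD s) (historyD s))
          (ifzD (distD op (constD 7))
            (stateD (sucD (clockD s)) (pairD (ifzD (bitOfD s) (arg 2) (arg 1)) (sndD c)) (bitOfD s)
              (callsD s) (historyD s))
            (stateD (sucD (clockD s)) (commandStepD op (arg 1) (arg 2) (arg 3) (arg 4) c) (bitOfD s)
              (callsD s) (historyD s))))))
      where
      s : Definable {q} {2} (λ xs ns → lookup ns v0)
      s = varD v0

      c : Definable {q} {2} (λ xs ns → configOf (lookup ns v0))
      c = configOfD s

      arg : ∀ k → Definable {q} {2} (λ xs ns → nth (currentEntry (lookup ns v0)) k)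
      arg k = nthD (nthD (constD programCode) (fstD c)) (constD k)

      op : Definable {q} {2} (λ xs ns → nth (currentEntry (lookup ns v0)) 0)
      op = arg 0

  tableOf : 𝒩 → (s k : ℕ) → ℕ
  tableOf x s = table x (calls s) (history s)

  opaque

    -- The arguments are a term number, a state and a stage, in the order that `Search` expects:
    -- input, built-in parameter, search variable.
    contentD : ∀ {q} j → Definable {suc q} {3}
      (λ xs ns → nth (tableOf (lookup xs v0) (lookup ns v1) (lookup ns v2)) (pair j (lookup ns v0)))
    contentD j = nthD (tableD #tapes (callsD (varD v1)) (historyD (varD v1)) (varD v2))
      (pairD (constD j) (varD v0))

  open Search (contentD {0} (toℕ outputTape)) public

  -- The argument codes a term number and a stage. `pred` sends an unknown entry and the known value
  -- 0 alike to 0, so the sequence vanishes iff no stage ever shows a nonzero term.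
  tested : 𝒩 → ℕ → 𝒩
  tested x s n = pred (nth (tableOf x s (snd n)) (pair (toℕ zeroTestTape) (fst n)))

  judged : ℕ → ℕ → ℕ
  judged s w = ifz (currentOp s) (dist w (searchIndex s)) 1

  controller : (em : ExcludedMiddle 0ℓ) → Controller em
  controller em = record { question = tested ; next = masterStep ; verdict = judged }

  -- Subtracting 2 separates the tags 1 and 2, which carry the answer of χ, from the tags `3 + w`,
  -- which carry a candidate.
  controlD : Definable {3} {1} λ xs ns →
    ifz (lookup xs v2 0) (tested (lookup xs v0) (lookup xs v1 0) (lookup ns v0))
      (ifz (lookup xs v2 0 ∸ 2) (masterStep (lookup xs v1 0) (pred (lookup xs v2 0)))
        (judged (lookup xs v1 0) (lookup xs v2 0 ∸ 3)))
  controlD = ifzD flag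
    (predD (nthD (tableD #tapes (callsD s) (historyD s) (sndD (varD v0)))
      (pairD (constD (toℕ zeroTestTape)) (fstD (varD v0)))))
    (ifzD (∸D flag (constD 2)) (masterStepD s (predD flag))
      (ifzD (nthD (nthD (constD programCode) (fstD (configOfD s))) (constD 0))
        (distD (∸D flag (constD 3)) (searchIndexD s)) (constD 1)))
    where
    s : Definable {3} {1} (λ xs ns → lookup xs v1 0)
    s = oracleD v1 (constD 0)

    flag : Definable {3} {1} (λ xs ns → lookup xs v2 0)
    flag = oracleD v2 (constD 0)

-- Correctness of the simulation

bitCode : Bool → ℕ
bitCode b = if b then 1 else 0

module Simulation (M : MSMachine 1) (x : 𝒩) where

  open MSMachine M using (working; program; #tapes; zeroTestTape; outputTape)
  open MSConfig
  open Tables #tapes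
  open Master M

  -- The field `tracks` includes completeness, so the relation is available only as long as all
  -- calls recorded in `s` are defined.
  record Simulates (s : ℕ) (C : MSConfig M) : Set where
    constructor simulates
    field
      codes  : Coded (configOf s) (master C)
      bits   : bitOf s ≡ bitCode (bit C)
      tracks : Tracks (tableOf x s) (baireTapes C)

  open Simulates

  tableOf-state : ∀ t c b m h k → tableOf x state⟨ t , c , b , m , h ⟩ k ≡ table x m h k
  tableOf-state t c b m h k =
    cong₂ (λ m h → table x m h k) (calls-state t c b m h) (history-state t c b m h)

  simulates-state : ∀ t {c b m h C} → Coded c (master C) → b ≡ bitCode (bit C) →
    Tracks (table x m h) (baireTapes C) →
    Simulates state⟨ t , c , b , m , h ⟩ C
  simulates-state t {c} {b} {m} {h} cod bit≡ tr = simulates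
    (subst (λ c → Coded c _) (sym (configOf-state t c b m h)) cod)
    (trans (bitOf-state t c b m h) bit≡)
    (tracks-cong (λ k → sym (tableOf-state t c b m h k)) tr)

  initially : Simulates 0 (start M [] (x ∷ []))
  initially = simulates
    (subst (λ c → Coded c (initial [])) (sym configOf-0) (coded fst-0 blank))
    bitOf-0
    (tracks-cong (λ k → sym
      (trans (cong₂ (λ m h → table x m h k) calls-0 history-0) (table-def x 0 0 k))) base)
    where
    blank : ∀ t → nth (snd 0) t ≡ tapeCode (tapes (initial []) t)
    blank t = trans (cong (λ l → nth l t) snd-0)
      (trans (nth-0 t) (trans (sym blank-tapeCode) (all t)))
      where
      all : ∀ t → tapeCode (numerals []) ≡ tapeCode (tapes (initial []) t)
      all zero    = refl
      all (suc t) = refl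

    Y : Vec 𝒩 #tapes
    Y = x ∷ replicate (2 + working) 0𝒩

    value : ℕ → ℕ
    value n = ifz (fst n) (suc (x (snd n))) 1

    value≡ : ∀ (j : Fin #tapes) i → value (pair (toℕ j) i) ≡ suc (lookup Y j i)
    value≡ j i = trans (cong₂ (λ a b → ifz a (suc (x b)) 1) (fst-pair (toℕ j) i)
      (snd-pair (toℕ j) i)) (cases j)
      where
      cases : ∀ j → ifz (toℕ j) (suc (x i)) 1 ≡ suc (lookup Y j i)
      cases zero    = refl
      cases (suc j) = cong (λ y → suc (y i)) (sym (lookup-replicate j 0𝒩))

    base : Tracks (initialTable x) Y
    base .sound k j i eq =
      suc-injective (trans (sym (tabulate≡suc k value (pair (toℕ j) i) eq)) (value≡ j i))
    base .complete j i = suc (pair (toℕ j) i) , λ k le → trans (nth-tabulate value le) (value≡ j i)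

  question-zero : ∀ {s C} → Simulates s C → lookup (baireTapes C) zeroTestTape ≗ 0𝒩 →
    tested x s ≗ 0𝒩
  question-zero {s} sim zeros n with nth (tableOf x s (snd n))
    (pair (toℕ zeroTestTape) (fst n)) in eq
  ... | zero  = refl
  ... | suc v = trans (sim .tracks .sound (snd n) zeroTestTape (fst n) eq) (zeros (fst n))

  -- Completeness enters here: the term `i` is known from some stage `K` on, and the sequence is
  -- read at `pair i K`. After an undefined call, unknown terms could pass for zeros.
  zero-question : ∀ {s C} → Simulates s C → tested x s ≗ 0𝒩 →
    lookup (baireTapes C) zeroTestTape ≗ 0𝒩
  zero-question {s} {C} sim zeros i with sim .tracks .complete zeroTestTape i
  ... | K , known = trans (cong pred (sym (trans
    (cong₂ (λ k i → nth (tableOf x s k) (pair (toℕ zeroTestTape) i)) (snd-pair i K) (fst-pair i K))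
      (known K ≤-refl))))
    (zeros (pair i K))

  fields : ∀ {s C} → Coded (configOf s) (master C) →
    EntryFields (masterCommand M C) (currentEntry s)
  fields {s} {C} cod = subst (λ a → EntryFields (fetch (basic halt) program a) (currentEntry s))
    (state≡ cod)
    (fetch-fields program (fst (configOf s)))

  commanded : ∀ {s C m} → Simulates s C → masterCommand M C ≡ m → EntryFields m (currentEntry s)
  commanded {s} {C} sim eq =
    subst (λ m → EntryFields m (currentEntry s)) eq (fields {s} {C} (sim .codes))

  module _ {s : ℕ} {b : ℕ} {C : MSConfig M} (sim : Simulates s C) where

    private
      other : ∀ {c op a₁ a₂ a₃ a₄} → BasicFields c op a₁ a₂ a₃ a₄ →
        Simulates (otherCode op a₁ a₂ a₃ a₄ s) (record C { master = perform c (master C) })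
      other f = simulates-state (suc (clock s)) (commandStep-coded f (sim .codes)) (sim .bits)
        (sim .tracks)

    basic-simulated : ∀ {c op a₁ a₂ a₃ a₄} → BasicFields c op a₁ a₂ a₃ a₄ →
      Simulates (stepFields op a₁ a₂ a₃ a₄ s b) (record C { master = perform c (master C) })
    basic-simulated halt      = sim
    basic-simulated write     = other write
    basic-simulated leftward  = other leftward
    basic-simulated rightward = other rightward
    basic-simulated branch    = other branch

    call-simulated : ∀ {l t y op a₁ a₂ a₃ a₄} → MasterFields {#tapes} (call l t) op a₁ a₂ a₃ a₄ →
      Ψ (billboard M C) (baireTapes C) y →
      Simulates (stepFields op a₁ a₂ a₃ a₄ s b)
        (goto M t (record C { baireTapes = baireTapes C [ l ]≔ y }))
    call-simulated {l} {t} {y} call run =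
      simulates-state (suc (clock s)) (coded-pair refl (tapes≡ (sim .codes))) (sim .bits)
      (tracks-cong (λ k → trans
        (cong (λ p → extend (pair p (toℕ l)) k (tableOf x s k)) (sym billboard≡))
          (sym (table-suc x (calls s) (pair (numberCode (nth (snd (configOf s)) 1)) (toℕ l))
            (history s) k)))
        (extend-tracks (sim .tracks) run))
      where
      billboard≡ : numberCode (nth (snd (configOf s)) 1) ≡ billboard M C
      billboard≡ = trans (cong numberCode (tapes≡ (sim .codes) 1))
        (number-tapeCode (tapes (master C) 1))

    zeroTest-simulated : ∀ {t op a₁ a₂ a₃ a₄} v →
      MasterFields {#tapes} (zeroTest t) op a₁ a₂ a₃ a₄ → b ≡ bitCode v →
      Simulates (stepFields op a₁ a₂ a₃ a₄ s b) (goto M t (record C { bit = v }))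
    zeroTest-simulated v zeroTest eq =
      simulates-state (suc (clock s)) (coded-pair refl (tapes≡ (sim .codes))) eq (sim .tracks)

    ifBit-simulated : ∀ {t t′ op a₁ a₂ a₃ a₄} → MasterFields {#tapes} (ifBit t t′) op a₁ a₂ a₃ a₄ →
      Simulates (stepFields op a₁ a₂ a₃ a₄ s b) (goto M (if bit C then t else t′) C)
    ifBit-simulated {t} {t′} ifBit = simulates-state (suc (clock s))
      (coded-pair (trans (cong (λ v → ifz v t′ t) (sim .bits)) (chosen (bit C)))
        (tapes≡ (sim .codes))) (sim .bits) (sim .tracks)
      where
      chosen : ∀ v → ifz (bitCode v) t′ t ≡ (if v then t else t′)
      chosen true  = refl
      chosen false = refl

  -- A certificate that the calls recorded in `s` were defined: by strictness, one tape with all its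
  -- terms known testifies to every call.
  KnownOutput : ℕ → Set
  KnownOutput s = Known (tableOf x s) (toℕ outputTape)

  known-state : ∀ {t c b} s → KnownOutput state⟨ t , c , b , calls s , history s ⟩ → KnownOutput s
  known-state {t} {c} {b} s known i with known i
  ... | k , v , eq = k , v
    , trans (cong (λ T → nth T (pair (toℕ outputTape) i))
      (sym (tableOf-state t c b (calls s) (history s) k))) eq

  known-called : ∀ a₁ a₂ s → KnownOutput (callStepCode a₁ a₂ s) →
    Known (λ k → extend (pair (numberCode (nth (snd (configOf s)) 1)) a₁) k (tableOf x s k))
      (toℕ outputTape)
  known-called a₁ a₂ s known i with known i
  ... | k , v , eq = k , v , trans (cong (λ T → nth T (pair (toℕ outputTape) i))
    (trans (sym (table-suc x (calls s) call₁ (history s) k))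
      (sym (tableOf-state (suc (clock s)) (pair a₂ (snd (configOf s))) (bitOf s) (suc (calls s))
        (pair call₁ (history s)) k)))) eq

    where
    call₁ : ℕ
    call₁ = pair (numberCode (nth (snd (configOf s)) 1)) a₁

  known-fields : ∀ {m op a₁ a₂ a₃ a₄ b} s → MasterFields {#tapes} m op a₁ a₂ a₃ a₄ →
    KnownOutput (stepFields op a₁ a₂ a₃ a₄ s b) → KnownOutput s
  known-fields s (basic halt)      = λ known → known
  known-fields s (basic write)     = known-state s
  known-fields s (basic leftward)  = known-state s
  known-fields s (basic rightward) = known-state s
  known-fields s (basic branch)    = known-state s
  known-fields s (call {l} {t})    = known-extend ∘ known-called (toℕ l) t s
  known-fields s zeroTest          = known-state s
  known-fields s ifBit             = known-state s

  -- The certificate passes from a state to its predecessor, because a strict entry presupposes the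
  -- corresponding entry of the table before the call.
  known-step : ∀ s b → KnownOutput (masterStep s b) → KnownOutput s
  known-step s b = known-fields {b = b} s
    (fetch-fields program (fst (configOf s))) ∘ subst KnownOutput (masterStep-def s b)

  stepFields-halted : ∀ {op a₁ a₂ a₃ a₄ s b} → op ≡ 0 → stepFields op a₁ a₂ a₃ a₄ s b ≡ s
  stepFields-halted refl = refl

  stepFields-clock : ∀ {m op a₁ a₂ a₃ a₄ s b} → MasterFields {#tapes} m op a₁ a₂ a₃ a₄ →
    op ≡ 0 ⊎ clock (stepFields op a₁ a₂ a₃ a₄ s b) ≡ suc (clock s)
  stepFields-clock (basic halt)      = inj₁ refl
  stepFields-clock (basic write)     = inj₂ (clock-state _ _ _ _ _)
  stepFields-clock (basic leftward)  = inj₂ (clock-state _ _ _ _ _)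
  stepFields-clock (basic rightward) = inj₂ (clock-state _ _ _ _ _)
  stepFields-clock (basic branch)    = inj₂ (clock-state _ _ _ _ _)
  stepFields-clock call              = inj₂ (clock-state _ _ _ _ _)
  stepFields-clock zeroTest          = inj₂ (clock-state _ _ _ _ _)
  stepFields-clock ifBit             = inj₂ (clock-state _ _ _ _ _)

  module _ (em : ExcludedMiddle 0ℓ) where

    open Run em (controller em) x using (state-at)

    step-simulated : ∀ {s C C′} → Simulates s C → Step M C C′ →
      Simulates (masterStep s (χ em (tested x s))) C′
    step-simulated {s} {C} {C′} sim step =
      subst (λ s → Simulates s C′) (sym (masterStep-def s _)) (by-fields step)
      where
      e = currentEntry s

      by-fields : Step M C C′ →
        Simulates (stepFields (nth e 0) (nth e 1) (nth e 2) (nth e 3) (nth e 4) s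
          (χ em (tested x s))) C′
      by-fields (basicStep eq) with commanded sim eq
      ... | basic f = basic-simulated sim f
      by-fields (callStep eq run) = call-simulated sim (commanded sim eq) run
      by-fields (zeroStep eq zeros) =
        zeroTest-simulated sim true (commanded sim eq)
          (⇒χ≡1 em (tested x s) (question-zero sim zeros))
      by-fields (nonzeroStep eq nonzero) =
        zeroTest-simulated sim false (commanded sim eq)
          (≢⇒χ≡0 em (tested x s) (nonzero ∘ zero-question sim))
      by-fields (bitStep eq) = ifBit-simulated sim (commanded sim eq)

    call-defined : ∀ {s C l t op a₁ a₂ a₃ a₄ b} → Simulates s C →
      MasterFields {#tapes} (call l t) op a₁ a₂ a₃ a₄ →
      KnownOutput (stepFields op a₁ a₂ a₃ a₄ s b) → ∃ (Ψ (billboard M C) (baireTapes C))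
    call-defined {s} {C} {l} {t} sim call known = subst (λ p → ∃ (Ψ p (baireTapes C)))
      (trans (cong numberCode (tapes≡ (sim .codes) 1)) (number-tapeCode (tapes (master C) 1)))
      (known-call (sim .tracks) (known-called (toℕ l) t s known))

    -- Only an undefined slave call can block the master, and knowledge of the output tape after the
    -- step rules this out.
    progress : ∀ {s C b} → Simulates s C → KnownOutput (masterStep s b) → ∃ (Step M C)
    progress {s} {C} {b} sim known with masterCommand M C in eq
    ... | basic c = _ , basicStep eq
    ... | ifBit t t′ = _ , bitStep eq
    ... | call l t = _ , callStep eq
      (proj₂ (call-defined sim (commanded sim eq) (subst KnownOutput (masterStep-def s b) known)))
    ... | zeroTest t with em {lookup (baireTapes C) zeroTestTape ≗ 0𝒩}
    ...   | yes zeros = _ , zeroStep eq zeros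
    ...   | no nonzero = _ , nonzeroStep eq nonzero

    star-simulated : ∀ {C C′} k → Simulates (state-at k) C → Star (Step M) C C′ → ∃ λ n →
      Simulates (state-at n) C′
    star-simulated k sim ε             = k , sim
    star-simulated k sim (step ◅ steps) = star-simulated (suc k) (step-simulated sim step) steps

    known-before : ∀ {w} d k → d + k ≡ w → KnownOutput (state-at w) → KnownOutput (state-at k)
    known-before zero    k refl known = known
    known-before (suc d) k eq   known =
      known-step (state-at k) _ (known-before d (suc k) (trans (+-suc d k) eq) known)

    -- Simulation needs defined calls, and their definedness is read off tracked tapes. So the real
    -- run is built step by step, `known-before` bringing the certificate from `w` back to each
    -- step.
    reached : ∀ w → KnownOutput (state-at w) → ∀ k → k ≤ w → ∃ λ C →
      Star (Step M) (start M [] (x ∷ [])) C × Simulates (state-at k) C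
    reached w known zero    k≤w = _ , ε , initially
    reached w known (suc k) k<w with reached w known k (<⇒≤ k<w)
    ... | C , steps , sim with progress sim (known-before (w ∸ suc k) (suc k) (m∸n+n≡m k<w) known)
    ... | C′ , step = C′ , steps ◅◅ (step ◅ ε) , step-simulated sim step

    Halted : ℕ → Set
    Halted s = currentOp s ≡ 0

    halted-stays : ∀ k d → Halted (state-at k) → state-at (d + k) ≡ state-at k
    halted-stays k zero    h = refl
    halted-stays k (suc d) h = trans (masterStep-def (state-at (d + k)) _)
      (trans (stepFields-halted (subst Halted (sym (halted-stays k d h)) h)) (halted-stays k d h))

    halted-≤ : ∀ {k l} → Halted (state-at k) → k ≤ l → state-at l ≡ state-at k
    halted-≤ {k} {l} h k≤l =
      subst (λ m → state-at m ≡ state-at k) (m∸n+n≡m k≤l) (halted-stays k (l ∸ k) h)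

    halted-unique : ∀ {k l} → Halted (state-at k) → Halted (state-at l) → state-at k ≡ state-at l
    halted-unique {k} {l} h h′ with ≤-total k l
    ... | inj₁ k≤l = sym (halted-≤ h k≤l)
    ... | inj₂ l≤k = halted-≤ h′ l≤k

    -- The clock counts the steps and stops at halting; from then on it names a time at which the
    -- halted state is present.
    clock-at : ∀ k → clock (state-at k) ≡ k ⊎
      (Halted (state-at k) × state-at (clock (state-at k)) ≡ state-at k)
    clock-at zero = inj₁ clock-0
    clock-at (suc k) with clock-at k
    ... | inj₂ (h , eq) =
      inj₂ (subst (λ s → Halted s × state-at (clock s) ≡ s) (sym (halted-stays k 1 h)) (h , eq))
    ... | inj₁ eq with stepFields-clock {s = state-at k} {χ em (tested x (state-at k))}
      (fetch-fields program (fst (configOf (state-at k))))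
    ...   | inj₁ h = inj₂
      (subst (λ s → Halted s × state-at (clock s) ≡ s) (sym (halted-stays k 1 h))
        (h , cong state-at eq))
    ...   | inj₂ tick = inj₁
      (trans (cong clock (masterStep-def (state-at k) _)) (trans tick (cong suc eq)))

    halted-at-clock : ∀ k → state-at (clock (state-at k)) ≡ state-at k
    halted-at-clock k with clock-at k
    ... | inj₁ eq       = cong state-at eq
    ... | inj₂ (_ , eq) = eq

    -- The clock is at most the state, and the state at most its search index. So after that many
    -- steps the run is already in its halted state, and the witness passes its own test.
    halted-at-index : ∀ k → Halted (state-at k) → state-at (searchIndex (state-at k)) ≡ state-at k
    halted-at-index k h = trans (halted-≤ (subst Halted (sym (halted-at-clock k)) h)
      (≤-trans (clock≤ (state-at k)) (n≤searchIndex (state-at k)))) (halted-at-clock k)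

    halt⇒Halted : ∀ {s C} → Simulates s C → masterCommand M C ≡ basic halt → Halted s
    halt⇒Halted sim eq = by-fields (commanded sim eq)
      where
      by-fields : ∀ {op a₁ a₂ a₃ a₄} → MasterFields {#tapes} (basic halt) op a₁ a₂ a₃ a₄ → op ≡ 0
      by-fields (basic halt) = refl

    Halted⇒halt : ∀ {s C} → Simulates s C → Halted s → masterCommand M C ≡ basic halt
    Halted⇒halt {s} {C} sim h = by-fields (fields {s} {C} (sim .codes)) h
      where
      by-fields : ∀ {m op a₁ a₂ a₃ a₄} → MasterFields {#tapes} m op a₁ a₂ a₃ a₄ → op ≡ 0 →
        m ≡ basic halt
      by-fields (basic halt) eq = refl

    judged⇒ : ∀ {s w} → judged s w ≡ 0 → Halted s × w ≡ searchIndex s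
    judged⇒ {s} {w} eq with currentOp s
    ... | zero = refl , dist≡0⇒≡ w (searchIndex s) eq

    ⇒judged : ∀ {s w} → Halted s → w ≡ searchIndex s → judged s w ≡ 0
    ⇒judged {s} h refl = trans (cong (λ op → ifz op (dist (searchIndex s) (searchIndex s)) 1) h)
      (dist-refl (searchIndex s))

    content : ℕ → ℕ → ℕ → ℕ
    content s i k = nth (tableOf x s k) (pair (toℕ outputTape) i)

    -- A term that never becomes known would make its search run forever; excluded middle separates
    -- the two cases.
    searched⇒known : ∀ s {y} → Ψ (searchIndex s) (x ∷ []) y → KnownOutput s
    searched⇒known s run i with em {∃₂ λ k v → content s i k ≡ suc v}
    ... | yes known = known
    ... | no unknown = contradiction (run i) (search-diverges (x ∷ []) i s λ k → none k)
      where
      none : ∀ k → content s i k ≡ 0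
      none k with content s i k in eq
      ... | zero  = refl
      ... | suc v = contradiction (k , v , eq) unknown

    -- The search may end before the threshold of completeness, but by soundness whatever it finds
    -- is the term of the output tape.
    simulated⇒searched : ∀ {s C y} → Simulates s C → lookup (baireTapes C) outputTape ≗ y →
      Ψ (searchIndex s) (x ∷ []) y
    simulated⇒searched {s} {C} {y} sim eq i with sim .tracks .complete outputTape i
    -- The search skips stage 0, so a success is exhibited at `suc K`.
    ... | K , known with search-finds (x ∷ []) i s {K} (known (suc K) (n≤1+n K))
    ... | k , v , found , run = subst (Φ (x ∷ []) (searchIndex s) (i ∷ []))
      (trans (sim .tracks .sound k outputTape i found) (eq i)) run

-- The function `U` and the normal form

U : Partial 1 1 baire
U ns xs y = Ψ (Vec.head ns) xs y

-- Program 0 is empty: it halts at once with its input as output.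
U-TTEComputable : TTEComputable U
U-TTEComputable = Vec.head , (0 , λ { (n ∷ []) → 0 , refl , number-holds (holds-numerals n) })
                , λ ns xs y → mk⇔ (λ u → u) (λ u → u)

module _ (em : ExcludedMiddle 0ℓ) (M : MSMachine 1) where

  open Master M

  -- `x` is an oracle of `controlD` and does not enter its index, so one `e` serves all `x`.
  index-exists : ∃ λ e → ∀ x w →
    (Accepts em (e ∷ w ∷ []) (x ∷ []) → judged (Run.state-at em (controller em) x w) w ≡ 0) ×
    (judged (Run.state-at em (controller em) x w) w ≡ 0 → Accepts em (e ∷ w ∷ []) (x ∷ []))
  index-exists = proj₁ (definition-onto (controlD .term)) , λ x w →
    let open Run em (controller em) x in
    accepts⇒verdict (controlD .term) (question-case x) (next-case x) (verdict-case x) w ,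
    verdict⇒accepts (controlD .term) (question-case x) (next-case x) (verdict-case x) w
    where
    control : (x : 𝒩) (s z i : ℕ) → ℕ
    control x s z i = ifz z (tested x s i) (ifz (z ∸ 2) (masterStep s (pred z)) (judged s (z ∸ 3)))

    controlled : ∀ x Y Z i {z} → Z 0 ≡ z →
      evalPR (x ∷ Y ∷ Z ∷ []) (controlD .term) (i ∷ []) ≡ control x (Y 0) z i
    controlled x Y Z i eq =
      trans (controlD .correct (x ∷ Y ∷ Z ∷ []) (i ∷ [])) (cong (λ z → control x (Y 0) z i) eq)

    question-case : ∀ x Y Z i → Z 0 ≡ 0 →
      evalPR (x ∷ Y ∷ Z ∷ []) (controlD .term) (i ∷ []) ≡ tested x (Y 0) i
    question-case x Y Z i = controlled x Y Z i

    next-case : ∀ x Y Z i b → b ≤ 1 → Z 0 ≡ 1 + b →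
      evalPR (x ∷ Y ∷ Z ∷ []) (controlD .term) (i ∷ []) ≡ masterStep (Y 0) b
    next-case x Y Z i zero          _        = controlled x Y Z i
    next-case x Y Z i (suc zero)    _        = controlled x Y Z i
    next-case x Y Z i (suc (suc b)) (s≤s ())

    verdict-case : ∀ x Y Z i w → Z 0 ≡ 3 + w →
      evalPR (x ∷ Y ∷ Z ∷ []) (controlD .term) (i ∷ []) ≡ judged (Y 0) w
    verdict-case x Y Z i w = controlled x Y Z i

theorem2p13 : (em : ExcludedMiddle 0ℓ) →
    Σ (Predicate 2 1) λ T → Σ (Partial 1 1 baire) λ U →
    PrimitiveRecursivePredicate em T × TTEComputable U ×
    ((F : Partial 0 1 baire) → MSComputable F →
    Σ ℕ λ e → (x : 𝒩) →
    F [] (x ∷ []) ≃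
    (λ y → Σ ℕ λ z → μ (λ w → T (e ∷ w ∷ []) (x ∷ [])) z × U (z ∷ []) (x ∷ []) y))
theorem2p13 em = Accepts em , U , Accepts-primitiveRecursive em , U-TTEComputable , λ F (M , F⇔M) →
  let (e , accepts⇔judged) = index-exists em M in e , normalForm F M F⇔M e accepts⇔judged
  where
  module _ (F : Partial 0 1 baire) (M : MSMachine 1) (F⇔M : ∀ ns xs v → F ns xs v ⇔ MSResult M baire ns xs v)
    (e : ℕ) (accepts⇔judged : ∀ x w →
      (Accepts em (e ∷ w ∷ []) (x ∷ []) → Master.judged M (Run.state-at em (Master.controller M em) x w) w ≡ 0) ×
      (Master.judged M (Run.state-at em (Master.controller M em) x w) w ≡ 0 → Accepts em (e ∷ w ∷ []) (x ∷ [])))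
    (x : 𝒩) where

    open MSMachine M using (outputTape)
    open MSConfig
    open Master M
    open Simulation M x
    open Run em (controller em) x using (state-at)

    Value : 𝒩 → Set
    Value y = Σ ℕ λ z → μ (λ w → Accepts em (e ∷ w ∷ []) (x ∷ [])) z × U (z ∷ []) (x ∷ []) y

    accepted : ∀ w → Accepts em (e ∷ w ∷ []) (x ∷ []) → Halted em (state-at w) × w ≡ searchIndex (state-at w)
    accepted w t = judged⇒ em (proj₁ (accepts⇔judged x w) t)

    defined : ∀ {y} → MSResult M baire [] (x ∷ []) y → Value y
    defined {y} (C , steps , halts , same) with star-simulated em 0 initially steps
    ... | n , sim = w , (proj₂ (accepts⇔judged x w) (⇒judged em h′ (cong searchIndex (sym at-w))) , minimal)
        , simulated⇒searched em sim same
      where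
      w : ℕ
      w = searchIndex (state-at n)

      h : Halted em (state-at n)
      h = halt⇒Halted em sim halts

      at-w : state-at w ≡ state-at n
      at-w = halted-at-index em n h

      h′ : Halted em (state-at w)
      h′ = subst (Halted em) (sym at-w) h

      -- An accepted number is the search index of a halted state of the run, and there is only one
      -- such state.
      minimal : ∀ v → v < w → ¬ Accepts em (e ∷ v ∷ []) (x ∷ [])
      minimal v v<w t with accepted v t
      ... | hv , v≡ = <⇒≢ v<w (trans v≡ (cong searchIndex (halted-unique em {v} {n} hv h)))

    -- Totality of the program named by the witness certifies the slave calls, so the simulated run
    -- is a real one, and it halts. `normalForm` applies this where `F` is undefined; where it is
    -- defined, `defined` supplies the common value.
    undefined : ∀ {y} → Value y → ∃ (MSResult M baire [] (x ∷ []))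
    undefined {y} (w , (t , _) , run) with accepted w t
    ... | h , w≡ with reached em w (searched⇒known em (state-at w) (subst (λ z → Ψ z (x ∷ []) y) w≡ run)) w ≤-refl
    ... | C , steps , sim = lookup (baireTapes C) outputTape , C , steps , Halted⇒halt em sim h , λ _ → refl

    normalForm : F [] (x ∷ []) ≃ Value
    normalForm with em {∃ (F [] (x ∷ []))}
    ... | yes (y , Fy) = inj₂ (y , y , Fy , defined (Equivalence.to (F⇔M [] (x ∷ []) y) Fy) , λ _ → refl)
    ... | no ¬F = inj₁ (¬F , λ (y , value) → let (v , result) = undefined value in
      ¬F (v , Equivalence.from (F⇔M [] (x ∷ []) v) result))
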